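{- For integers $m,j,n\ge 0$ let $Q_{m,j}(n)$ denote the number of pairs $(\mu,\lambda)$ whose parts sum in total to $n$, where $\mu$ is an overpartition into even parts, each $\le 2m$, with exactly $j$ parts, and $\lambda$ is a partition into odd parts, each $\le 2m+1$, such that (i) every odd positive integer $<2m+1$ appears as a part of $\lambda$, and it appears an even number of times; (ii) the part $2m+1$ may repeat any number of times or not appear at all. Then, for $0<|q|<1$, $$\sum_{m,n,j\ge0}(-1)^jQ_{m,j}(n)q^n= \frac{1}{2}\sum_{n\ge0}q^{3n^2/2}(1+q^{2n+1})(1+q^{n+1/2})\sum_{|j|\le n}q^{j^2/2}+\frac{1}{2}\sum_{n\ge0}(-1)^nq^{3n^2/2}(1+q^{2n+1})(1-q^{n+1/2})\sum_{|j|\le n}(-1)^jq^{j^2/2}.$$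
   Context: An overpartition is a partition in which the first occurrence of each part size may be overlined (or not); the number of parts counts both overlined and non-overlined parts. Empty partitions and overpartitions are allowed where consistent with the conditions. Here $q\in\mathbb{C}$ with $0<|q|<1$, and $q^{1/2}$ is a fixed square root of $q$ (half-integer powers of $q$ are powers of $q^{1/2}$). On the right-hand side, $\sum_{|j|\le n}$ runs over all integers $j$ with $-n\le j\le n$; this $j$ is a dummy index unrelated to the $j$ on the left-hand side. -}

module Defs where

open import Level using (Level; _⊔_) renaming (suc to lsuc)
open import Algebra.Apartness.Bundles using (HeytingField; module HeytingCommutativeRing)
open import Algebra.Bundles using (CommutativeRing)
open import Algebra.Bundles.Raw using (RawRing)
import Algebra.Definitions.RawMonoid as RawMonoidDefs
import Algebra.Definitions.RawSemiring as RawSemiringDefs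
open import Data.Bool.Base using (Bool; true; false)
import Data.Bool.Properties as Bool
open import Data.Fin.Base using (toℕ)
open import Data.Integer.Base using (ℤ; _⊖_)
open import Data.List.Base
  using (List; []; _∷_; length; filter; map; upTo; cartesianProduct; cartesianProductWith)
open import Data.List.Membership.Propositional using (_∈_)
import Data.List.Membership.DecPropositional as DecMembership
open import Data.List.Membership.Propositional.Properties
  using (∈-filter⁺; ∈-filter⁻; ∈-cartesianProduct⁺; ∈-cartesianProductWith⁺;
         ∈-cartesianProductWith⁻; ∈-upTo⁺)
open import Data.List.Properties using (∷-injective)
open import Data.List.Relation.Unary.All as All using (All; []; _∷_)
open import Data.List.Relation.Unary.AllPairs using ([]; _∷_)
open import Data.List.Relation.Unary.Any using (here; there)
open import Data.List.Relation.Unary.Linked using (Linked)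
import Data.List.Relation.Unary.Linked as Linked
open import Data.List.Relation.Unary.Unique.Propositional using (Unique)
import Data.List.Relation.Unary.Unique.Propositional.Properties as Unique
open import Data.Nat.Base as ℕ using (ℕ; zero; suc; z≤n; s≤s)
open import Data.Nat.Divisibility using (_∣_; _∣?_)
open import Data.Nat.ListAction using (sum)
import Data.Nat.Properties as ℕ
open import Data.Product.Base using (∃-syntax; _×_; _,_; proj₁; proj₂)
open import Data.Sum.Base using (_⊎_; inj₂)
open import Function.Base using (_∘_)
open import Function.Bundles using (_⇔_; mk⇔; module Equivalence)
open import Relation.Binary.Core using (Rel)
open import Relation.Binary.PropositionalEquality using (_≡_; refl; sym; cong; subst)
open import Relation.Binary.Structures using (IsStrictPartialOrder)
open import Relation.Nullary using (¬_; Dec; ¬?)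
open import Relation.Nullary.Decidable using (_×-dec_; _⊎-dec_; _→-dec_)

------------------------------------------------------------------------
-- Partitions

-- Parts are listed in weakly decreasing order.
IsPartition : List ℕ → Set
IsPartition ν = Linked ℕ._≥_ ν × All (0 ℕ.<_) ν

-- The Boolean records whether the part is overlined.
MarkedPart : Set
MarkedPart = ℕ × Bool

size : MarkedPart → ℕ
size = proj₁

-- A part equal to its predecessor is not the first occurrence of its size,
-- so it may not be overlined.
MayPrecede : MarkedPart → MarkedPart → Set
MayPrecede (a , _) (b , overlined) = b ℕ.< a ⊎ (b ≡ a × overlined ≡ false)

IsOverpartition : List MarkedPart → Set
IsOverpartition μ = Linked MayPrecede μ × All ((0 ℕ.<_) ∘ size) μ

multiplicity : ℕ → List ℕ → ℕ
multiplicity k = length ∘ filter (k ℕ.≟_)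

Admissible : (m j n : ℕ) → List MarkedPart × List ℕ → Set
Admissible m j n (μ , ν) =
  (IsOverpartition μ × All (λ p → 2 ∣ size p × size p ℕ.≤ 2 ℕ.* m) μ × length μ ≡ j) ×
  (IsPartition ν × All (λ k → ¬ 2 ∣ k × k ℕ.≤ suc (2 ℕ.* m)) ν ×
    (∀ {k} → k ℕ.< suc (2 ℕ.* m) → ¬ 2 ∣ k → k ∈ ν × 2 ∣ multiplicity k ν)) ×
  sum (map size μ) ℕ.+ sum ν ≡ n

admissible? : ∀ m j n x → Dec (Admissible m j n x)
admissible? m j n (μ , ν) =
  ((Linked.linked? mayPrecede? μ ×-dec All.all? (λ p → 0 ℕ.<? size p) μ) ×-dec
    All.all? (λ p → (2 ∣? size p) ×-dec (size p ℕ.≤? 2 ℕ.* m)) μ ×-dec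
    (length μ ℕ.≟ j)) ×-dec
  ((Linked.linked? (λ a b → b ℕ.≤? a) ν ×-dec All.all? (0 ℕ.<?_) ν) ×-dec
    All.all? (λ k → ¬? (2 ∣? k) ×-dec (k ℕ.≤? suc (2 ℕ.* m))) ν ×-dec
    ℕ.allUpTo?
      (λ k → ¬? (2 ∣? k) →-dec ((k ∈? ν) ×-dec (2 ∣? multiplicity k ν)))
      (suc (2 ℕ.* m))) ×-dec
  (sum (map size μ) ℕ.+ sum ν ℕ.≟ n)
  where
  open DecMembership ℕ._≟_ using (_∈?_)
  mayPrecede? : ∀ p p′ → Dec (MayPrecede p p′)
  mayPrecede? (a , _) (b , o) = (b ℕ.<? a) ⊎-dec ((b ℕ.≟ a) ×-dec (o Bool.≟ false))

-- All words of length at most k over the alphabet as.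
words : ∀ {a} {A : Set a} → ℕ → List A → List (List A)
words zero    as = [] ∷ []
words (suc k) as = [] ∷ cartesianProductWith _∷_ as (words k as)

-- The parts are positive with total n, so no part and neither number of parts
-- exceeds n.
candidates : ℕ → List (List MarkedPart × List ℕ)
candidates n = cartesianProduct
  (words n (cartesianProduct (upTo (suc n)) (false ∷ true ∷ [])))
  (words n (upTo (suc n)))

admissiblePairs : (m j n : ℕ) → List (List MarkedPart × List ℕ)
admissiblePairs m j n = filter (admissible? m j n) (candidates n)

-- Q m j n is Q_{m,j}(n); admissiblePairs-unique and ∈-admissiblePairs below
-- show that every admissible pair is listed exactly once.
Q : (m j n : ℕ) → ℕ
Q m j n = length (admissiblePairs m j n)

module _ {a} {A : Set a} where

  words-unique : ∀ k {as : List A} → Unique as → Unique (words k as)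
  words-unique zero    u = [] ∷ []
  words-unique (suc k) {as} u =
    All.tabulate nonempty ∷
    Unique.cartesianProductWith⁺ _∷_ ∷-injective u (words-unique k u)
    where
    nonempty : ∀ {w} → w ∈ cartesianProductWith _∷_ as (words k as) → ¬ [] ≡ w
    nonempty w∈ with ∈-cartesianProductWith⁻ _∷_ as (words k as) w∈
    ... | _ , _ , _ , _ , refl = λ ()

  ∈-words : ∀ k {as} {w : List A} → length w ℕ.≤ k → All (_∈ as) w → w ∈ words k as
  ∈-words zero    {w = []}    _         []       = here refl
  ∈-words (suc k) {w = []}    _         []       = here refl
  ∈-words (suc k) {w = x ∷ w} (s≤s len) (p ∷ ps) =
    there (∈-cartesianProductWith⁺ _∷_ p (∈-words k len ps))

  module _ (f : A → ℕ) where

    length≤sum : ∀ {w} → All ((0 ℕ.<_) ∘ f) w → length w ℕ.≤ sum (map f w)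
    length≤sum []       = z≤n
    length≤sum (p ∷ ps) = ℕ.+-mono-≤ p (length≤sum ps)

    all≤sum : ∀ w → All (λ x → f x ℕ.≤ sum (map f w)) w
    all≤sum []      = []
    all≤sum (x ∷ w) =
      ℕ.m≤m+n (f x) _ ∷ All.map (λ p → ℕ.≤-trans p (ℕ.m≤n+m _ (f x))) (all≤sum w)

admissiblePairs-unique : ∀ m j n → Unique (admissiblePairs m j n)
admissiblePairs-unique m j n =
  Unique.filter⁺ (admissible? m j n)
    (Unique.cartesianProduct⁺
      (words-unique n (Unique.cartesianProduct⁺ (Unique.upTo⁺ (suc n)) (((λ ()) ∷ []) ∷ [] ∷ [])))
      (words-unique n (Unique.upTo⁺ (suc n))))

∈-admissiblePairs : ∀ m j n x → (x ∈ admissiblePairs m j n) ⇔ Admissible m j n x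
∈-admissiblePairs m j n x =
  mk⇔ (λ x∈ → proj₂ (∈-filter⁻ (admissible? m j n) {xs = candidates n} x∈))
      (λ adm → ∈-filter⁺ (admissible? m j n) (∈-candidates x adm) adm)
  where
  ∈-bools : ∀ b → b ∈ false ∷ true ∷ []
  ∈-bools false = here refl
  ∈-bools true  = there (here refl)

  map-id : ∀ ν → sum (map (λ k → k) ν) ≡ sum ν
  map-id []      = refl
  map-id (k ∷ ν) = cong (k ℕ.+_) (map-id ν)

  ∈-candidates : ∀ x → Admissible m j n x → x ∈ candidates n
  ∈-candidates (μ , ν) (((_ , posμ) , _) , ((_ , posν) , _) , total) =
    ∈-cartesianProduct⁺
      (∈-words n (ℕ.≤-trans (length≤sum size posμ) μ≤n)
        (All.map (λ p → ∈-cartesianProduct⁺ (∈-upTo⁺ (s≤s (ℕ.≤-trans p μ≤n))) (∈-bools _))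
          (all≤sum size μ)))
      (∈-words n (ℕ.≤-trans (length≤sum (λ k → k) posν) ν≤n)
        (All.map (λ p → ∈-upTo⁺ (s≤s (ℕ.≤-trans p ν≤n))) (all≤sum (λ k → k) ν)))
    where
    μ≤n : sum (map size μ) ℕ.≤ n
    μ≤n = subst (sum (map size μ) ℕ.≤_) total (ℕ.m≤m+n _ _)
    ν≤n : sum (map (λ k → k) ν) ℕ.≤ n
    ν≤n = subst (ℕ._≤ n) (sym (map-id ν))
            (subst (sum ν ℕ.≤_) total (ℕ.m≤n+m _ _))

------------------------------------------------------------------------
-- Real and complex numbers

-- The real numbers, characterised as a Cauchy-complete Archimedean ordered
-- field.  The axioms are in constructive form and hold both for the classical
-- reals and for Bishop's regular Cauchy sequences of rationals.
record RealField (c ℓ₁ ℓ₂ : Level) : Set (lsuc (c ⊔ ℓ₁ ⊔ ℓ₂)) where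
  infix 4 _<_
  field
    heytingField : HeytingField c ℓ₁ ℓ₂

  open HeytingField heytingField public

  commutativeRing : CommutativeRing c ℓ₁
  commutativeRing = HeytingCommutativeRing.commutativeRing heytingCommutativeRing

  open RawMonoidDefs (CommutativeRing.+-rawMonoid commutativeRing) public using () renaming (_×_ to _·_)

  field
    _<_                  : Rel Carrier ℓ₂
    isStrictPartialOrder : IsStrictPartialOrder _≈_ _<_
    #⇔<                  : ∀ x y → (x # y) ⇔ (x < y ⊎ y < x)
    +-monoˡ-<            : ∀ {x y} z → x < y → x + z < y + z
    *-pos                : ∀ {x y} → 0# < x → 0# < y → 0# < x * y
    0<1                  : 0# < 1#
    archimedean          : ∀ x → ∃[ n ] x < n · 1#

  -- m and k range independently, so the one inequality bounds |u m - u k|.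
  IsCauchy : (ℕ → Carrier) → Set (c ⊔ ℓ₂)
  IsCauchy u = ∀ ε → 0# < ε →
    ∃[ N ] ∀ m k → N ℕ.≤ m → N ℕ.≤ k → u m - u k < ε

  IsLimit : (ℕ → Carrier) → Carrier → Set (c ⊔ ℓ₂)
  IsLimit u l = ∀ ε → 0# < ε →
    ∃[ N ] ∀ m → N ℕ.≤ m → u m - l < ε × l - u m < ε

  field
    complete : ∀ u → IsCauchy u → ∃[ l ] IsLimit u l

module Complex {c ℓ₁ ℓ₂} (ℝ : RealField c ℓ₁ ℓ₂) where

  open RealField ℝ public using (_<_) renaming (0# to 0ℝ; 1# to 1ℝ)

  private
    module ℝ = RealField ℝ

  ℂ-rawRing : RawRing c ℓ₁
  ℂ-rawRing = record
    { Carrier = ℝ.Carrier × ℝ.Carrier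
    ; _≈_     = λ (x , y) (x′ , y′) → x ℝ.≈ x′ × y ℝ.≈ y′
    ; _+_     = λ (x , y) (x′ , y′) → x ℝ.+ x′ , y ℝ.+ y′
    ; _*_     = λ (x , y) (x′ , y′) → x ℝ.* x′ ℝ.- y ℝ.* y′ , x ℝ.* y′ ℝ.+ y ℝ.* x′
    ; -_      = λ (x , y) → ℝ.- x , ℝ.- y
    ; 0#      = ℝ.0# , ℝ.0#
    ; 1#      = ℝ.1# , ℝ.0#
    }

  open RawRing ℂ-rawRing public
    using (_≈_; _+_; _*_; -_)
    renaming (Carrier to ℂ; 0# to 0ℂ; 1# to 1ℂ)
  open RawSemiringDefs (RawRing.rawSemiring ℂ-rawRing) public
    using (_^_) renaming (_×_ to _·_)

  private
    module Σℂ = RawSemiringDefs (RawRing.rawSemiring ℂ-rawRing)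

    0<2 : ℝ.0# < ℝ.1# ℝ.+ ℝ.1#
    0<2 = <.trans ℝ.0<1 (<.<-respˡ-≈ (ℝ.+-identityˡ ℝ.1#) (ℝ.+-monoˡ-< ℝ.1# ℝ.0<1))
      where module < = IsStrictPartialOrder ℝ.isStrictPartialOrder

  infixl 6 _-_
  _-_ : ℂ → ℂ → ℂ
  z - w = z + (- w)

  -- The real part is the inverse of (1 + 1) - 0.
  ½ : ℂ
  ½ = proj₁ (ℝ.#⇒invertible (Equivalence.from (ℝ.#⇔< (ℝ.1# ℝ.+ ℝ.1#) ℝ.0#) (inj₂ 0<2))) , ℝ.0#

  -- The squared modulus.
  ∣_∣² : ℂ → ℝ.Carrier
  ∣ x , y ∣² = x ℝ.* x ℝ.+ y ℝ.* y

  -- Convergence of a sequence: |u m - l| < ε, with both sides squared.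
  infix 4 _⟶_
  _⟶_ : (ℕ → ℂ) → ℂ → Set (c ⊔ ℓ₂)
  u ⟶ l = ∀ ε → ℝ.0# < ε → ∃[ N ] ∀ m → N ℕ.≤ m → ∣ u m - l ∣² < ε ℝ.* ε

  ∑< : ℕ → (ℕ → ℂ) → ℂ
  ∑< n f = Σℂ.sum {n} (f ∘ toℕ)

  syntax ∑< n (λ i → e) = ∑[ i < n ] e

  -- The sum over all integers j with |j| ≤ n, written j = i - n for 0 ≤ i ≤ 2n.
  ∑± : ℕ → (ℤ → ℂ) → ℂ
  ∑± n f = ∑[ i < suc (2 ℕ.* n) ] f (i ⊖ n)

  HasSum : (ℕ → ℂ) → ℂ → Set (c ⊔ ℓ₂)
  HasSum f l = (λ K → ∑[ n < K ] f n) ⟶ l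

  -- The sum of a triple series is the limit of its partial sums over the
  -- cubes 0 ≤ m, n, j < K; for an absolutely convergent series this is its
  -- sum in any order.
  HasTripleSum : (ℕ → ℕ → ℕ → ℂ) → ℂ → Set (c ⊔ ℓ₂)
  HasTripleSum f l = (λ K → ∑[ m < K ] ∑[ n < K ] ∑[ j < K ] f m n j) ⟶ l

-- Write p = q² and (p)ₖ = (1 - p)(1 - p²)⋯(1 - pᵏ).  The pairs counted for a given m have the signed
-- generating function F m = (1 + q²ᵐ⁺¹) p^(m²) (p)ₘ² / (p)₂ₘ₊₁.  The expansion
--   (p)ₘ = Σ_{r ≥ m} p^(r(r-m)) (1 - p²ʳ⁺¹) (p)ᵣ₊ₘ / (p)ᵣ₋ₘ
-- turns Σ F m into a double sum over m ≤ r, whose inner sums are evaluated by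
--   Σ_{m+s=r} p^(m²+ms+s²) (p)ₘ [2m+1+s choose s] = Σ_{k+l=r} p^(k²+kl+l²).
-- Each of the two is proved by a telescoping certificate.  What results is the sum of the terms of
-- even degree in q^(1/2) of the first series A on the right-hand side; since B is A with q^(1/2)
-- replaced by -q^(1/2), this is (A + B)/2.
--
-- The identity is a congruence modulo q^K in ℤ⟦q⟧.  As Q m j n vanishes unless m, j ≤ n, the cube
-- sum up to K is a partial sum of a power series, and it differs from the partial sum of (A + B)/2
-- only by O(K²) powers of q with exponents ≥ K.

module Submission where

open import Level using (Level)
open import Data.Nat as ℕ using (ℕ)
open import Data.Integer.Base using (∣_∣)
open import Data.Product using (∃-syntax; _×_)
open import Defs

open import Algebra.Bundles using (CommutativeRing; Semiring)
open import Data.Bool.Base using (true; false)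
open import Data.Empty using (⊥-elim)
open import Data.Fin.Base using (toℕ)
open import Data.Integer.Base as ℤ using (ℤ; 0ℤ; 1ℤ; -1ℤ; +_; -[1+_]; _⊖_)
import Data.Integer.Properties as ℤ
import Data.Integer.Tactic.RingSolver as ℤ-solver
open import Data.List.Base
  using (List; []; _∷_; _++_; applyUpTo; cartesianProduct; filter; foldr; length; map)
open import Data.List.Membership.Propositional using (_∈_)
open import Data.List.Membership.Propositional.Properties
  using (∈-map⁺; ∈-map⁻; ∈-++⁺ˡ; ∈-++⁺ʳ; ∈-++⁻; ∈-filter⁺; ∈-filter⁻; ∈-cartesianProduct⁺; ∈-cartesianProduct⁻)
open import Data.List.Membership.Propositional.Properties.WithK using (unique∧set⇒bag)
open import Data.List.Properties
  using (∷-injectiveʳ; filter-accept; filter-reject; length-++; length-applyUpTo; length-filter; length-map)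
open import Data.List.Relation.Binary.BagAndSetEquality using (∼bag⇒↭)
open import Data.List.Relation.Binary.Permutation.Propositional.Properties using (↭-length)
open import Data.List.Relation.Unary.All as All using (All; []; _∷_)
import Data.List.Relation.Unary.All.Properties as All
open import Data.List.Relation.Unary.AllPairs using ([]; _∷_)
open import Data.List.Relation.Unary.Any using (here; there)
open import Data.List.Relation.Unary.Linked as Linked using (Linked; []; [-]; _∷_)
open import Data.List.Relation.Unary.Linked.Properties using (Linked⇒All)
open import Data.List.Relation.Unary.Unique.Propositional using (Unique)
import Data.List.Relation.Unary.Unique.Propositional.Properties as Unique
open import Data.Maybe.Base as Maybe using (Maybe)
open import Data.Nat.Base using (zero; suc; z≤n; s≤s)
open import Data.Nat.Divisibility using (_∣_; divides; ∣m+n∣m⇒∣n; ∣m∣n⇒∣m+n; ∣1⇒≡1; ∣-refl)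
open import Data.Nat.ListAction using (sum)
import Data.Nat.Properties as ℕ
open import Data.Nat.Tactic.RingSolver using (solve-∀)
open import Data.Product.Base using (_,_; proj₁; proj₂)
open import Data.Sum.Base using (_⊎_; inj₁; inj₂)
open import Function.Base using (_∘_)
open import Function.Bundles using (mk⇔; module Equivalence)
open import Level using (0ℓ; _⊔_)
open import Relation.Binary.PropositionalEquality as ≡ using (_≡_)
open import Relation.Binary.Structures using (IsStrictPartialOrder)
open import Relation.Nullary using (¬_; Dec; yes; no; contradiction)
open import Relation.Nullary.Decidable.Core using (dec⇒maybe)

-- Only one of the two factors (p)ₘ in F m is expanded; the other stays in the inner sum. The
-- obstacle to interchanging the sums over m and r is the factor 1 + q²ᵐ⁺¹, which depends on m,
-- while the target has 1 + q²ʳ⁺¹. One can be traded for the other because 1 - p²ʳ⁺¹ factors over q;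
-- the price is that the inner sum splits in two, along m + s = r and m + s = r - 1. With n = r
-- these become the terms with j ≡ n and with j ≢ n mod 2. The expansion of (p)ₘ is infinite, so it
-- is cut off after finitely many terms, with an explicit remainder that is divisible by a high
-- power of p. The order of the reals is constructive: inequalities cannot be decided, and moduli
-- would need square roots. Estimates are therefore strict and made separately for real and
-- imaginary parts, and a polynomial to be estimated is carried as the list of its exponents, so
-- that a bound needs only the length of the list and a lower bound for its entries.

-- Integer coefficients in a commutative ring, and finite sums

module IntegerCoefficients {c ℓ} (R : CommutativeRing c ℓ) where

  open CommutativeRing R
  open import Algebra.Properties.AbelianGroup +-abelianGroup
  open import Algebra.Properties.CommutativeSemigroup +-commutativeSemigroup using (interchange)
  open import Algebra.Properties.Ring ring using (-‿distribˡ-*; -0#≈0#)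
  -- For this multiple 1 · 1# reduces to 1#, so in solver expressions `con (+ 1)` is definitionally
  -- the unit and `con (-[1+ 0 ])` its negative.
  open import Algebra.Properties.Semiring.Mult.TCOptimised semiring
    using (×-homo-+; 1+×; ×1-homo-*) renaming (_×_ to _·_)
  open import Algebra.Solver.Ring.AlmostCommutativeRing
    using (_-Raw-AlmostCommutative⟶_; fromCommutativeRing)
  open import Relation.Binary.Reasoning.Setoid setoid

  ι : ℤ → Carrier
  ι (+ n)      = n · 1#
  ι (-[1+ n ]) = - (suc n · 1#)

  ι-⊖ : ∀ m n → ι (m ⊖ n) ≈ m · 1# - n · 1#
  ι-⊖ m       zero    = trans (sym (+-identityʳ _)) (+-congˡ (sym -0#≈0#))
  ι-⊖ zero    (suc n) = sym (+-identityˡ _)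
  ι-⊖ (suc m) (suc n) = begin
    ι (suc m ⊖ suc n) ≡⟨ ≡.cong ι (ℤ.[1+m]⊖[1+n]≡m⊖n m n) ⟩
    ι (m ⊖ n) ≈⟨ ι-⊖ m n ⟩
    m · 1# - n · 1# ≈⟨ +-identityˡ _ ⟨
    0# + (m · 1# - n · 1#) ≈⟨ +-congʳ (-‿inverseʳ 1#) ⟨
    (1# - 1#) + (m · 1# - n · 1#) ≈⟨ interchange 1# (- 1#) (m · 1#) (- (n · 1#)) ⟩
    (1# + m · 1#) + (- 1# - n · 1#) ≈⟨ +-congˡ (⁻¹-∙-comm 1# (n · 1#)) ⟩
    (1# + m · 1#) - (1# + n · 1#) ≈⟨ +-cong (1+× m 1#) (-‿cong (1+× n 1#)) ⟨
    suc m · 1# - suc n · 1# ∎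

  ι-neg : ∀ i → ι (ℤ.- i) ≈ - ι i
  ι-neg (+ zero)     = sym -0#≈0#
  ι-neg (+ suc n)    = refl
  ι-neg (-[1+ n ])   = sym (⁻¹-involutive _)

  ι-+ : ∀ i j → ι (i ℤ.+ j) ≈ ι i + ι j
  ι-+ (+ m)      (+ n)      = ×-homo-+ 1# m n
  ι-+ (+ m)      (-[1+ n ]) = ι-⊖ m (suc n)
  ι-+ (-[1+ m ]) (+ n)      = trans (ι-⊖ n (suc m)) (+-comm _ _)
  ι-+ (-[1+ m ]) (-[1+ n ]) = begin
    - (suc (suc (m ℕ.+ n)) · 1#) ≡⟨ ≡.cong (λ k → ι (-[1+ k ])) (ℕ+-suc m n) ⟨
    - ((suc m ℕ.+ suc n) · 1#) ≈⟨ -‿cong (×-homo-+ 1# (suc m) (suc n)) ⟩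
    - (suc m · 1# + suc n · 1#) ≈⟨ ⁻¹-∙-comm _ _ ⟨
    - (suc m · 1#) - suc n · 1# ∎
    where open import Data.Nat.Properties using () renaming (+-suc to ℕ+-suc)

  private
    ι-pos-* : ∀ m j → ι (+ m ℤ.* j) ≈ ι (+ m) * ι j
    ι-pos-* m (+ n)      = trans (reflexive (≡.cong ι (≡.sym (ℤ.pos-* m n)))) (×1-homo-* m n)
    ι-pos-* m (-[1+ n ]) = begin
      ι (+ m ℤ.* ℤ.- (+ suc n)) ≡⟨ ≡.cong ι (ℤ.neg-distribʳ-* (+ m) (+ suc n)) ⟨
      ι (ℤ.- (+ m ℤ.* + suc n)) ≈⟨ ι-neg (+ m ℤ.* + suc n) ⟩
      - ι (+ m ℤ.* + suc n) ≈⟨ -‿cong (ι-pos-* m (+ suc n)) ⟩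
      - (ι (+ m) * ι (+ suc n)) ≈⟨ -‿distribʳ-* _ _ ⟩
      ι (+ m) * - ι (+ suc n) ∎
      where open import Algebra.Properties.Ring ring using (-‿distribʳ-*)

  ι-* : ∀ i j → ι (i ℤ.* j) ≈ ι i * ι j
  ι-* (+ m)      j = ι-pos-* m j
  ι-* (-[1+ m ]) j = begin
    ι (ℤ.- (+ suc m) ℤ.* j) ≡⟨ ≡.cong ι (ℤ.neg-distribˡ-* (+ suc m) j) ⟨
    ι (ℤ.- (+ suc m ℤ.* j)) ≈⟨ ι-neg (+ suc m ℤ.* j) ⟩
    - ι (+ suc m ℤ.* j) ≈⟨ -‿cong (ι-pos-* (suc m) j) ⟩
    - (ι (+ suc m) * ι j) ≈⟨ -‿distribˡ-* _ _ ⟩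
    - ι (+ suc m) * ι j ∎

  private
    homomorphism : CommutativeRing.rawRing ℤ.+-*-commutativeRing
                   -Raw-AlmostCommutative⟶ fromCommutativeRing R
    homomorphism = record
      { ⟦_⟧    = ι
      ; +-homo = ι-+
      ; *-homo = ι-*
      ; -‿homo = ι-neg
      ; 0-homo = refl
      ; 1-homo = refl
      }

    ι-≟ : ∀ i j → Maybe (ι i ≈ ι j)
    ι-≟ i j = Maybe.map (λ i≡j → reflexive (≡.cong ι i≡j)) (dec⇒maybe (i ℤ.≟ j))

  module Solver where
    open import Algebra.Solver.Ring _ _ homomorphism ι-≟ public

module Antidiagonal {c ℓ} (R : CommutativeRing c ℓ) where

  open CommutativeRing R hiding (zero)
  open import Algebra.Properties.CommutativeSemigroup +-commutativeSemigroup using (interchange)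
  open import Relation.Binary.Reasoning.Setoid setoid

  ∑ : ℕ → (ℕ → Carrier) → Carrier
  ∑ zero    f = 0#
  ∑ (suc n) f = ∑ n f + f n

  ∑diag : (ℕ → ℕ → Carrier) → ℕ → Carrier
  ∑diag f zero    = f 0 0
  ∑diag f (suc n) = f 0 (suc n) + ∑diag (λ i j → f (suc i) j) n

  ∑-cong : ∀ n {f g} → (∀ i → f i ≈ g i) → ∑ n f ≈ ∑ n g
  ∑-cong zero    f≈g = refl
  ∑-cong (suc n) f≈g = +-cong (∑-cong n f≈g) (f≈g n)

  ∑-+ : ∀ n f g → ∑ n (λ i → f i + g i) ≈ ∑ n f + ∑ n g
  ∑-+ zero    f g = sym (+-identityˡ 0#)
  ∑-+ (suc n) f g = trans (+-congʳ (∑-+ n f g)) (interchange _ _ _ _)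

  ∑-*ˡ : ∀ n a f → ∑ n (λ i → a * f i) ≈ a * ∑ n f
  ∑-*ˡ zero    a f = sym (zeroʳ a)
  ∑-*ˡ (suc n) a f = trans (+-congʳ (∑-*ˡ n a f)) (sym (distribˡ _ _ _))

  ∑-suc : ∀ n f → ∑ (suc n) f ≈ f 0 + ∑ n (λ i → f (suc i))
  ∑-suc zero    f = +-comm _ _
  ∑-suc (suc n) f = trans (+-congʳ (∑-suc n f)) (+-assoc _ _ _)

  ∑diag-cong : ∀ n {f g} → (∀ i j → i ℕ.+ j ≡ n → f i j ≈ g i j) → ∑diag f n ≈ ∑diag g n
  ∑diag-cong zero    f≈g = f≈g 0 0 ≡.refl
  ∑diag-cong (suc n) f≈g =
    +-cong (f≈g 0 (suc n) ≡.refl) (∑diag-cong n (λ i j e → f≈g (suc i) j (≡.cong suc e)))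

  ∑diag-*ˡ : ∀ n a f → ∑diag (λ i j → a * f i j) n ≈ a * ∑diag f n
  ∑diag-*ˡ zero    a f = refl
  ∑diag-*ˡ (suc n) a f = trans (+-congˡ (∑diag-*ˡ n a _)) (sym (distribˡ _ _ _))

  ∑diag-last : ∀ n f → ∑diag f (suc n) ≈ ∑diag (λ i j → f i (suc j)) n + f (suc n) 0
  ∑diag-last zero    f = refl
  ∑diag-last (suc n) f = trans (+-congˡ (∑diag-last n (λ i j → f (suc i) j))) (sym (+-assoc _ _ _))

  ∑diag-+ : ∀ n f g → ∑diag (λ i j → f i j + g i j) n ≈ ∑diag f n + ∑diag g n
  ∑diag-+ zero    f g = refl
  ∑diag-+ (suc n) f g = trans (+-congˡ (∑diag-+ n _ _)) (interchange _ _ _ _)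

  -- Both sides run over the triangle i + j < n, once by rows and once by antidiagonals.
  ∑-triangle : ∀ n (f : ℕ → ℕ → Carrier) →
               ∑ n (λ i → ∑ (n ℕ.∸ i) (f i)) ≈ ∑ n (∑diag f)
  ∑-triangle zero    f = refl
  ∑-triangle (suc n) f = begin
    ∑ (suc n) (λ i → ∑ (suc n ℕ.∸ i) (f i)) ≈⟨ ∑-suc n _ ⟩
    ∑ (suc n) (f 0) + ∑ n (λ i → ∑ (n ℕ.∸ i) (f (suc i))) ≈⟨ +-cong (∑-suc n (f 0)) (∑-triangle n _) ⟩
    (f 0 0 + ∑ n (λ j → f 0 (suc j))) + ∑ n (∑diag (λ i → f (suc i))) ≈⟨ +-assoc _ _ _ ⟩
    f 0 0 + (∑ n (λ j → f 0 (suc j)) + ∑ n (∑diag (λ i → f (suc i)))) ≈⟨ +-congˡ (∑-+ n _ _) ⟨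
    f 0 0 + ∑ n (λ j → ∑diag f (suc j)) ≈⟨ ∑-suc n (∑diag f) ⟨
    ∑ (suc n) (∑diag f) ∎

-- The q-series identity in a general commutative ring

antidiagonal : ∀ {a} {A : Set a} → (ℕ → ℕ → A) → ℕ → List A
antidiagonal φ zero    = φ 0 0 ∷ []
antidiagonal φ (suc n) = φ 0 (suc n) ∷ antidiagonal (λ i j → φ (suc i) j) n

-- Twice the form i² + ij + j², because powers of p = x² are to be read as powers of x.
hex² : ℕ → ℕ → ℕ
hex² i j = (i ℕ.* i ℕ.+ i ℕ.* j ℕ.+ j ℕ.* j) ℕ.+ (i ℕ.* i ℕ.+ i ℕ.* j ℕ.+ j ℕ.* j)

-- The exponents of x, with repetition, in `low r`, in `∑diag q r + low r`, in `N r` and in `∑ n N`.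
-- As lists they can be counted, filtered and bounded.
lowExponents innerExponents latticeExponents latticeExponents< : ℕ → List ℕ
lowExponents zero    = []
lowExponents (suc r) = map (suc (suc (r ℕ.+ r) ℕ.+ suc (r ℕ.+ r)) ℕ.+_) (antidiagonal hex² r)
innerExponents r = antidiagonal hex² r ++ lowExponents r
latticeExponents r = innerExponents r ++ map (suc (r ℕ.+ r) ℕ.+_) (innerExponents r)
latticeExponents< zero    = []
latticeExponents< (suc n) = latticeExponents< n ++ latticeExponents n

module QSeries {c ℓ} (R : CommutativeRing c ℓ) where

  open CommutativeRing R hiding (zero)
  open import Algebra.Properties.Semiring.Exp semiring
  open Antidiagonal R
  open IntegerCoefficients R
  open Solver
  open import Relation.Binary.Reasoning.Setoid setoid

  module Hexagonal (x : Carrier) where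

    p : Carrier
    p = x * x

    p^-cong : ∀ {k l} → k ≡ l → p ^ k ≈ p ^ l
    p^-cong = ^-congʳ p

    p^-+₃ : ∀ k l m → p ^ (k ℕ.+ l ℕ.+ m) ≈ p ^ k * p ^ l * p ^ m
    p^-+₃ k l m = trans (^-homo-* p (k ℕ.+ l) m) (*-congʳ (^-homo-* p k l))

    -- Not the number q of the theorem, whose role is played by `x`.
    q : ℕ → ℕ → Carrier
    q m s = p ^ (m ℕ.* m ℕ.+ m ℕ.* s ℕ.+ s ℕ.* s)

    q-comm : ∀ m s → q m s ≈ q s m
    q-comm m s = p^-cong (exponents m s)
      where
      exponents : ∀ m s → m ℕ.* m ℕ.+ m ℕ.* s ℕ.+ s ℕ.* s ≡ s ℕ.* s ℕ.+ s ℕ.* m ℕ.+ m ℕ.* m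
      exponents = solve-∀

    -- What the summands with j ≢ r mod 2 contribute after multiplication by q^(r+1/2); `odds-low`
    -- makes this precise.
    low : ℕ → Carrier
    low zero    = 0#
    low (suc r) = x * p ^ suc (r ℕ.+ r) * ∑diag q r

    -- The part of even degree in q^(1/2) of the r-th term of the first series.
    N : ℕ → Carrier
    N r = (1# + x * p ^ r) * (∑diag q r + low r)

    x^-+ : ∀ k l → x ^ (k ℕ.+ l) ≈ x ^ k * x ^ l
    x^-+ = ^-homo-* x

    p^-x^ : ∀ k → p ^ k ≈ x ^ (k ℕ.+ k)
    p^-x^ k = begin
      (x * x) ^ k ≈⟨ ^-congˡ k (*-congˡ (*-identityʳ x)) ⟨
      (x ^ 2) ^ k ≈⟨ ^-assocʳ x 2 k ⟩
      x ^ (2 ℕ.* k) ≡⟨ ≡.cong (λ l → x ^ (k ℕ.+ l)) (ℕ.+-identityʳ k) ⟩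
      x ^ (k ℕ.+ k) ∎

    powers : List ℕ → Carrier
    powers = foldr (λ e s → x ^ e + s) 0#

    powers-++ : ∀ es es′ → powers (es ++ es′) ≈ powers es + powers es′
    powers-++ []       es′ = sym (+-identityˡ _)
    powers-++ (e ∷ es) es′ = trans (+-congˡ (powers-++ es es′)) (sym (+-assoc _ _ _))

    powers-map-+ : ∀ k es → powers (map (k ℕ.+_) es) ≈ x ^ k * powers es
    powers-map-+ k []       = sym (zeroʳ _)
    powers-map-+ k (e ∷ es) = trans (+-cong (x^-+ k e) (powers-map-+ k es)) (sym (distribˡ _ _ _))

    powers-antidiagonal : ∀ φ n → powers (antidiagonal φ n) ≈ ∑diag (λ i j → x ^ φ i j) n
    powers-antidiagonal φ zero    = +-identityʳ _
    powers-antidiagonal φ (suc n) = +-congˡ (powers-antidiagonal (λ i j → φ (suc i) j) n)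

    ∑diag-q : ∀ r → ∑diag q r ≈ powers (antidiagonal hex² r)
    ∑diag-q r = trans (∑diag-cong r (λ i j _ → p^-x^ (i ℕ.* i ℕ.+ i ℕ.* j ℕ.+ j ℕ.* j))) (sym (powers-antidiagonal hex² r))

    low-powers : ∀ r → low r ≈ powers (lowExponents r)
    low-powers zero    = refl
    low-powers (suc r) =
      trans (*-cong (*-congˡ (p^-x^ (suc (r ℕ.+ r)))) (∑diag-q r)) (sym (powers-map-+ _ (antidiagonal hex² r)))

    N-powers : ∀ r → N r ≈ powers (latticeExponents r)
    N-powers r = begin
      (1# + x * p ^ r) * (∑diag q r + low r)
        ≈⟨ *-cong (+-congˡ (*-congˡ (p^-x^ r))) (+-cong (∑diag-q r) (low-powers r)) ⟩
      (1# + x * x ^ (r ℕ.+ r)) * (powers (antidiagonal hex² r) + powers (lowExponents r))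
        ≈⟨ *-congˡ (powers-++ (antidiagonal hex² r) (lowExponents r)) ⟨
      (1# + x * x ^ (r ℕ.+ r)) * powers (innerExponents r)
        ≈⟨ trans (distribʳ _ _ _) (+-congʳ (*-identityˡ _)) ⟩
      powers (innerExponents r) + x ^ suc (r ℕ.+ r) * powers (innerExponents r)
        ≈⟨ +-congˡ (powers-map-+ (suc (r ℕ.+ r)) (innerExponents r)) ⟨
      powers (innerExponents r) + powers (map (suc (r ℕ.+ r) ℕ.+_) (innerExponents r))
        ≈⟨ powers-++ (innerExponents r) _ ⟨
      powers (latticeExponents r) ∎

    ∑-N : ∀ n → ∑ n N ≈ powers (latticeExponents< n)
    ∑-N zero    = refl
    ∑-N (suc n) = trans (+-cong (∑-N n) (N-powers n)) (sym (powers-++ (latticeExponents< n) (latticeExponents n)))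

  -- The ring is arbitrary, so the inverses of 1 - pᵏ⁺¹ are supplied as data. They exist in ℤ⟦X⟧
  -- with x = X, where the identity is applied.
  module Base (x : Carrier) (inv : ℕ → Carrier)
    (inverse : ∀ k → (1# - (x * x) ^ suc k) * inv k ≈ 1#) where

    open Hexagonal x

    poch : ℕ → Carrier
    poch zero    = 1#
    poch (suc k) = poch k * (1# - p ^ suc k)

    invPoch : ℕ → Carrier
    invPoch zero    = 1#
    invPoch (suc k) = invPoch k * inv k

    invPoch-suc : ∀ k → invPoch k ≈ invPoch (suc k) * (1# - p ^ suc k)
    invPoch-suc k = begin
      invPoch k ≈⟨ *-identityʳ _ ⟨
      invPoch k * 1# ≈⟨ *-congˡ (inverse k) ⟨
      invPoch k * ((1# - p ^ suc k) * inv k) ≈⟨ solve 3 (λ a b c → a :* (b :* c) := a :* c :* b) refl _ _ _ ⟩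
      invPoch (suc k) * (1# - p ^ suc k) ∎

    poch-invPoch : ∀ k → poch k * invPoch k ≈ 1#
    poch-invPoch zero    = *-identityˡ 1#
    poch-invPoch (suc k) = begin
      poch k * (1# - p ^ suc k) * invPoch (suc k) ≈⟨ solve 3 (λ a b c → a :* b :* c := a :* (c :* b)) refl _ _ _ ⟩
      poch k * (invPoch (suc k) * (1# - p ^ suc k)) ≈⟨ *-congˡ (invPoch-suc k) ⟨
      poch k * invPoch k ≈⟨ poch-invPoch k ⟩
      1# ∎

    q-sucʳ : ∀ m s → q m (suc s) ≈ q m s * (p ^ m * p ^ s * p ^ s * p)
    q-sucʳ m s = begin
      q m (suc s) ≈⟨ p^-cong (exponents m s) ⟩
      p ^ (e ℕ.+ suc (m ℕ.+ s ℕ.+ s)) ≈⟨ ^-homo-* p e _ ⟩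
      q m s * (p * p ^ (m ℕ.+ s ℕ.+ s)) ≈⟨ *-congˡ (trans (*-comm _ _) (*-congʳ (p^-+₃ m s s))) ⟩
      q m s * (p ^ m * p ^ s * p ^ s * p) ∎
      where
      e = m ℕ.* m ℕ.+ m ℕ.* s ℕ.+ s ℕ.* s
      exponents : ∀ m s → m ℕ.* m ℕ.+ m ℕ.* suc s ℕ.+ suc s ℕ.* suc s
                          ≡ (m ℕ.* m ℕ.+ m ℕ.* s ℕ.+ s ℕ.* s) ℕ.+ suc (m ℕ.+ s ℕ.+ s)
      exponents = solve-∀

    q-sucˡ : ∀ m s → q (suc m) s ≈ q m s * (p ^ m * p ^ m * p ^ s * p)
    q-sucˡ m s = begin
      q (suc m) s ≈⟨ q-comm (suc m) s ⟩
      q s (suc m) ≈⟨ q-sucʳ s m ⟩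
      q s m * (p ^ s * p ^ m * p ^ m * p) ≈⟨ *-cong (q-comm s m) (solve 3 (λ a b p → b :* a :* a :* p := a :* a :* b :* p) refl _ _ _) ⟩
      q m s * (p ^ m * p ^ m * p ^ s * p) ∎

    P : ℕ → ℕ → Carrier
    P m s = poch (suc (m ℕ.+ m ℕ.+ s))

    J : ℕ → Carrier
    J m = invPoch (suc (m ℕ.+ m))

    P-sucʳ : ∀ m s → P m (suc s) ≈ P m s * (1# - p * (p * (p ^ m * p ^ m * p ^ s)))
    P-sucʳ m s = begin
      P m (suc s) ≡⟨ ≡.cong (λ k → poch (suc k)) (ℕ.+-suc (m ℕ.+ m) s) ⟩
      P m s * (1# - p * (p * p ^ (m ℕ.+ m ℕ.+ s))) ≈⟨ *-congˡ (+-congˡ (-‿cong (*-congˡ (*-congˡ (p^-+₃ m m s))))) ⟩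
      P m s * (1# - p * (p * (p ^ m * p ^ m * p ^ s))) ∎

    P-sucˡ : ∀ m s → P (suc m) s ≈ P m (suc (suc s))
    P-sucˡ m s = reflexive (≡.cong poch (index m s))
      where
      index : ∀ m s → suc (suc m ℕ.+ suc m ℕ.+ s) ≡ suc (m ℕ.+ m ℕ.+ suc (suc s))
      index = solve-∀

    J-suc : ∀ m → J m ≈ J (suc m) * (1# - p * (p * (p * (p ^ m * p ^ m)))) * (1# - p * (p * (p ^ m * p ^ m)))
    J-suc m = begin
      J m
        ≈⟨ trans (invPoch-suc _) (*-congʳ (invPoch-suc _)) ⟩
      invPoch (suc (suc (suc (m ℕ.+ m)))) * (1# - p * (p * (p * p ^ (m ℕ.+ m)))) * (1# - p * (p * p ^ (m ℕ.+ m)))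
        ≈⟨ *-cong (*-cong (reflexive (≡.cong (λ k → invPoch (suc (suc k))) (≡.sym (ℕ.+-suc m m))))
                          (+-congˡ (-‿cong (*-congˡ (*-congˡ (*-congˡ (^-homo-* p m m)))))))
                  (+-congˡ (-‿cong (*-congˡ (*-congˡ (^-homo-* p m m))))) ⟩
      J (suc m) * (1# - p * (p * (p * (p ^ m * p ^ m)))) * (1# - p * (p * (p ^ m * p ^ m))) ∎

    -- The q-binomial coefficient [2m+1+s choose s] in base p.
    E : ℕ → ℕ → Carrier
    E m s = P m s * J m * invPoch s

    t : ℕ → ℕ → Carrier
    t m s = q m s * poch m * E m s

    -- The telescoping certificate: along m + s = r, t m (s+2) - w r * t m s is a difference of
    -- consecutive values of Y.
    Y : ℕ → ℕ → Carrier
    Y m s = (1# - p ^ (suc m ℕ.+ s)) * q (suc m) s * poch m * E m s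

    -- This is p^(3(r+1)), the quotient of `q (suc m) (suc s)` by `q m s` when m + s = r.
    w : ℕ → Carrier
    w r = p ^ r * p ^ r * p ^ r * (p * p * p)

    w-+ : ∀ m s → w (m ℕ.+ s) ≈ (p ^ m * p ^ s) * (p ^ m * p ^ s) * (p ^ m * p ^ s) * (p * p * p)
    w-+ m s = *-congʳ (*-cong (*-cong h h) h)
      where h = ^-homo-* p m s

    q-suc² : ∀ m s → q m (suc (suc s)) ≈
             q m s * (p ^ m * p ^ s * p ^ s * p) * (p ^ m * (p * p ^ s) * (p * p ^ s) * p)
    q-suc² m s = trans (q-sucʳ m (suc s)) (*-congʳ (q-sucʳ m s))

    q-diag : ∀ m s → q (suc m) (suc s) ≈
             q m s * (p ^ m * p ^ s * p ^ s * p) * (p ^ m * p ^ m * (p * p ^ s) * p)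
    q-diag m s = trans (q-sucˡ m (suc s)) (*-congʳ (q-sucʳ m s))

    one-p^ : ∀ m s → 1# - p ^ (suc m ℕ.+ s) ≈ 1# - p * (p ^ m * p ^ s)
    one-p^ m s = +-congˡ (-‿cong (*-congˡ (^-homo-* p m s)))

    invPoch-suc² : ∀ s → invPoch s ≈ invPoch (suc (suc s)) * (1# - p * (p * p ^ s)) * (1# - p * p ^ s)
    invPoch-suc² s = trans (invPoch-suc s) (*-congʳ (invPoch-suc (suc s)))

    module _ (m s : ℕ) where
      private
        u₀ = 1# - p * (p * (p ^ m * p ^ m * p ^ s))
        u₁ = 1# - p * (p * (p ^ m * p ^ m * (p * p ^ s)))

      P-suc² : P m (suc (suc s)) ≈ P m s * u₀ * u₁
      P-suc² = trans (P-sucʳ m (suc s)) (*-congʳ (P-sucʳ m s))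

      E-suc² : E m (suc (suc s)) ≈ P m s * u₀ * u₁ * J m * invPoch (suc (suc s))
      E-suc² = *-congʳ (*-congʳ P-suc²)

      E-suc : E m (suc s) ≈ P m s * u₀ * J m * (invPoch (suc (suc s)) * (1# - p * (p * p ^ s)))
      E-suc = *-cong (*-congʳ (P-sucʳ m s)) (invPoch-suc (suc s))

      E₀ : E m s ≈ P m s * J m * (invPoch (suc (suc s)) * (1# - p * (p * p ^ s)) * (1# - p * p ^ s))
      E₀ = *-congˡ (invPoch-suc² s)

    -- All Pochhammer symbols are reduced to `P (suc m) s`, `J (suc m)`, `poch m` and
    -- `invPoch (suc (suc s))`. What then remains is a polynomial identity in eight independent
    -- variables.
    telescope : ∀ m s → t (suc m) (suc (suc s)) + Y (suc m) (suc s) ≈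
                        w (suc m ℕ.+ s) * t (suc m) s + Y m (suc (suc s))
    telescope m s = begin
      t (suc m) (suc (suc s)) + Y (suc m) (suc s)
        ≈⟨ +-cong (*-cong (*-congʳ (q-suc² (suc m) s)) (E-suc² (suc m) s))
                  (*-cong (*-congʳ (*-cong (one-p^ (suc m) (suc s)) (q-diag (suc m) s))) (E-suc (suc m) s)) ⟩
      _ ≈⟨ solve 8 (λ a b p e h c j i →
             let one = con (+ 1) ; A = p :* a
                 u₀ = one :- p :* (p :* (A :* A :* b)) ; u₁ = one :- p :* (p :* (A :* A :* (p :* b))) in
             (e :* (A :* b :* b :* p) :* (A :* (p :* b) :* (p :* b) :* p)) :* (h :* (one :- A)) :* (c :* u₀ :* u₁ :* j :* i)
             :+ (one :- p :* (A :* (p :* b))) :* (e :* (A :* b :* b :* p) :* (A :* A :* (p :* b) :* p)) :* (h :* (one :- A))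
                :* (c :* u₀ :* j :* (i :* (one :- p :* (p :* b))))
             :=
             (A :* b) :* (A :* b) :* (A :* b) :* (p :* p :* p) :*
               (e :* (h :* (one :- A)) :* (c :* j :* (i :* (one :- p :* (p :* b)) :* (one :- p :* b))))
             :+ (one :- p :* (a :* (p :* (p :* b)))) :* (e :* (A :* b :* b :* p) :* (A :* (p :* b) :* (p :* b) :* p)) :* h
                :* (c :* (j :* (one :- p :* (p :* (p :* (a :* a)))) :* (one :- p :* (p :* (a :* a)))) :* i))
           refl (p ^ m) (p ^ s) p (q (suc m) s) (poch m) (P (suc m) s) (J (suc m)) (invPoch (suc (suc s))) ⟩
      _ ≈⟨ +-cong (*-cong (w-+ (suc m) s) (*-congˡ (E₀ (suc m) s)))
                  (*-cong (*-congʳ (*-cong (one-p^ m (suc (suc s))) (q-suc² (suc m) s)))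
                          (*-congʳ (*-cong (sym (P-sucˡ m s)) (J-suc m)))) ⟨
      w (suc m ℕ.+ s) * t (suc m) s + Y m (suc (suc s)) ∎

    -- The case s = -1 of `telescope`: the term multiplied by `w` has dropped out.
    telescope-end : ∀ m → t (suc m) 1 + Y (suc m) 0 ≈ Y m 1
    telescope-end m = begin
      t (suc m) 1 + Y (suc m) 0
        ≈⟨ +-cong (*-cong (*-congʳ (q-sucʳ (suc m) 0)) (*-congʳ (*-congʳ (trans (P-sucʳ (suc m) 0) (*-congʳ PM)))))
                  (*-cong (*-congʳ (*-cong (one-p^ (suc m) 0) (q-sucˡ (suc m) 0))) (*-cong (*-congʳ PM) (invPoch-suc 0))) ⟩
      _ ≈⟨ solve 7 (λ a p e h c j i →
             let one = con (+ 1) ; A = p :* a ; u = one :- p :* (p :* (a :* a :* (p :* one))) in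
             (e :* (A :* one :* one :* p)) :* (h :* (one :- A)) :* (c :* u :* (one :- p :* (p :* (A :* A :* one))) :* j :* i)
             :+ (one :- p :* (A :* one)) :* (e :* (A :* A :* one :* p)) :* (h :* (one :- A)) :* (c :* u :* j :* (i :* (one :- p :* one)))
             :=
             (one :- p :* (a :* (p :* one))) :* (e :* (A :* one :* one :* p)) :* h
               :* (c :* (j :* (one :- p :* (p :* (p :* (a :* a)))) :* (one :- p :* (p :* (a :* a)))) :* i))
           refl (p ^ m) p (q (suc m) 0) (poch m) (P m 1) (J (suc m)) (invPoch 1) ⟩
      _ ≈⟨ *-cong (*-congʳ (*-cong (one-p^ m 1) (q-sucʳ (suc m) 0))) (*-congʳ (*-congˡ (J-suc m))) ⟨
      Y m 1 ∎
      where
      PM : P (suc m) 0 ≈ P m 1 * (1# - p * (p * (p ^ m * p ^ m * (p * 1#))))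
      PM = trans (P-sucˡ m 0) (P-sucʳ m 1)

    -- The case s = -2 of `telescope`: of the four terms two are left.
    t-zeroʳ : ∀ m → t (suc m) 0 ≈ Y m 0
    t-zeroʳ m = begin
      q (suc m) 0 * poch (suc m) * E (suc m) 0
        ≈⟨ *-congˡ (trans (E-zero (suc m)) (sym (E-zero m))) ⟩
      q (suc m) 0 * (poch m * (1# - p * p ^ m)) * E m 0
        ≈⟨ solve 4 (λ e h v y → e :* (h :* v) :* y := v :* e :* h :* y) refl _ _ _ _ ⟩
      (1# - p * p ^ m) * q (suc m) 0 * poch m * E m 0
        ≈⟨ *-congʳ (*-congʳ (*-congʳ (+-congˡ (-‿cong (p^-cong (≡.sym (ℕ.+-identityʳ (suc m)))))))) ⟩
      Y m 0 ∎
      where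
      E-zero : ∀ m → E m 0 ≈ 1#
      E-zero m = trans (*-identityʳ _)
        (trans (*-congʳ (reflexive (≡.cong (λ k → poch (suc k)) (ℕ.+-identityʳ (m ℕ.+ m)))))
               (poch-invPoch (suc (m ℕ.+ m))))

    private
      V₁ : (1# - p * 1#) * J 0 ≈ 1#
      V₁ = trans (*-congˡ (*-identityˡ _)) (inverse 0)

    -- At the edge m = 0 the certificate has no predecessor. Its place is taken by twice
    -- `q 0 (suc (suc s))`, the boundary term of the recurrence `∑diag-q-suc²`.
    telescope-start : ∀ s → t 0 (suc (suc s)) + Y 0 (suc s) ≈
                            w s * t 0 s + (q 0 (suc (suc s)) + q 0 (suc (suc s)))
    telescope-start s = begin
      t 0 (suc (suc s)) + Y 0 (suc s)
        ≈⟨ +-cong (*-cong (*-congʳ (q-suc² 0 s)) (E-suc² 0 s))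
                  (*-cong (*-congʳ (*-cong (one-p^ 0 (suc s)) (q-diag 0 s))) (E-suc 0 s)) ⟩
      _ ≈⟨ solve 6 (λ b p e c j i →
             let one = con (+ 1) ; v = one :- p :* (p :* b)
                 u₀ = one :- p :* (p :* (one :* one :* b)) ; u₁ = one :- p :* (p :* (one :* one :* (p :* b)))
                 q₂ = e :* (one :* b :* b :* p) :* (one :* (p :* b) :* (p :* b) :* p) in
             q₂ :* one :* (c :* u₀ :* u₁ :* j :* i)
             :+ (one :- p :* (one :* (p :* b))) :* (e :* (one :* b :* b :* p) :* (one :* one :* (p :* b) :* p)) :* one
                :* (c :* u₀ :* j :* (i :* v))
             :=
             b :* b :* b :* (p :* p :* p) :* (e :* one :* (c :* j :* (i :* v :* (one :- p :* b))))
             :+ (q₂ :+ q₂) :* ((c :* (i :* v)) :* ((one :- p :* one) :* j)))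
           refl (p ^ s) p (q 0 s) (P 0 s) (J 0) (invPoch (suc (suc s))) ⟩
      _ ≈⟨ +-cong (*-congˡ (*-congˡ (E₀ 0 s)))
                  (trans (sym (*-identityʳ _))
                         (*-cong (+-cong (q-suc² 0 s) (q-suc² 0 s)) (sym (trans (*-cong U₁ V₁) (*-identityʳ 1#))))) ⟨
      w s * t 0 s + (q 0 (suc (suc s)) + q 0 (suc (suc s))) ∎
      where
      U₁ : P 0 s * (invPoch (suc (suc s)) * (1# - p * (p * p ^ s))) ≈ 1#
      U₁ = trans (*-congˡ (sym (invPoch-suc (suc s)))) (poch-invPoch (suc s))

    t₀₀ : t 0 0 ≈ 1#
    t₀₀ = begin
      1# * 1# * (1# * (1# - p * 1#) * J 0 * 1#) ≈⟨ solve 2 (λ p j → let one = con (+ 1) in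
                                                     one :* one :* (one :* (one :- p :* one) :* j :* one) := (one :- p :* one) :* j) refl p (J 0) ⟩
      (1# - p * 1#) * J 0 ≈⟨ V₁ ⟩
      1# ∎

    t₀₁ : t 0 1 + Y 0 0 ≈ q 0 1 + q 1 0
    t₀₁ = begin
      t 0 1 + Y 0 0
        ≈⟨ solve 2 (λ p j → let one = con (+ 1) ; v = one :- p :* one in
             (p :* one) :* one :* (one :* v :* (one :- p :* (p :* one)) :* j :* j)
             :+ v :* (p :* one) :* one :* (one :* v :* j :* one)
             := p :* (one :+ p) :* ((v :* j) :* (v :* j)) :+ p :* v :* (v :* j)) refl p (J 0) ⟩
      p * (1# + p) * (((1# - p * 1#) * J 0) * ((1# - p * 1#) * J 0)) + p * (1# - p * 1#) * ((1# - p * 1#) * J 0)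
        ≈⟨ +-cong (*-congˡ (*-cong V₁ V₁)) (*-congˡ V₁) ⟩
      p * (1# + p) * (1# * 1#) + p * (1# - p * 1#) * 1#
        ≈⟨ solve 1 (λ p → let one = con (+ 1) in
             p :* (one :+ p) :* (one :* one) :+ p :* (one :- p :* one) :* one := p :* one :+ p :* one) refl p ⟩
      q 0 1 + q 1 0 ∎

    private
      -- The tail t m n + t (m+1) (n-1) + ... + t (m+n) 0 of an antidiagonal sum, on which the
      -- telescoping runs as an induction.
      A : ℕ → ℕ → Carrier
      A m zero    = t m 0
      A m (suc n) = t m (suc n) + A (suc m) n

      A-one : ∀ m → A (suc m) 1 ≈ Y m 1
      A-one m = trans (+-congˡ (t-zeroʳ (suc m))) (telescope-end m)

      -- All interior values of `Y` cancel, and only the first one survives.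
      A-tail : ∀ m k → A (suc m) (suc (suc k)) ≈ w (suc m ℕ.+ k) * A (suc m) k + Y m (suc (suc k))
      A-tail m zero    = trans (+-congˡ (A-one (suc m))) (telescope m 0)
      A-tail m (suc k) = begin
        t (suc m) (suc (suc (suc k))) + A (suc (suc m)) (suc (suc k))
          ≈⟨ +-congˡ (A-tail (suc m) k) ⟩
        t (suc m) (suc (suc (suc k))) + (w (suc (suc m) ℕ.+ k) * A (suc (suc m)) k + Y (suc m) (suc (suc k)))
          ≈⟨ solve 3 (λ a b c → a :+ (b :+ c) := (a :+ c) :+ b) refl _ _ _ ⟩
        (t (suc m) (suc (suc (suc k))) + Y (suc m) (suc (suc k))) + w (suc (suc m) ℕ.+ k) * A (suc (suc m)) k
          ≈⟨ +-cong (telescope m (suc k)) (*-congʳ (reflexive (≡.cong (λ n → w (suc n)) (≡.sym (ℕ.+-suc m k))))) ⟩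
        (w (suc m ℕ.+ suc k) * t (suc m) (suc k) + Y m (suc (suc (suc k)))) + w (suc m ℕ.+ suc k) * A (suc (suc m)) k
          ≈⟨ solve 4 (λ u a b c → (u :* a :+ b) :+ u :* c := u :* (a :+ c) :+ b) refl _ _ _ _ ⟩
        w (suc m ℕ.+ suc k) * A (suc m) (suc k) + Y m (suc (suc (suc k))) ∎

      A-suc² : ∀ k → A 0 (suc (suc k)) ≈ w k * A 0 k + (q 0 (suc (suc k)) + q 0 (suc (suc k)))
      A-suc² zero    = trans (+-congˡ (A-one 0)) (telescope-start 0)
      A-suc² (suc k) = begin
        t 0 (suc (suc (suc k))) + A 1 (suc (suc k))
          ≈⟨ +-congˡ (A-tail 0 k) ⟩
        t 0 (suc (suc (suc k))) + (w (suc k) * A 1 k + Y 0 (suc (suc k)))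
          ≈⟨ solve 3 (λ a b c → a :+ (b :+ c) := (a :+ c) :+ b) refl _ _ _ ⟩
        (t 0 (suc (suc (suc k))) + Y 0 (suc (suc k))) + w (suc k) * A 1 k
          ≈⟨ +-congʳ (telescope-start (suc k)) ⟩
        (w (suc k) * t 0 (suc k) + (q 0 (suc (suc (suc k))) + q 0 (suc (suc (suc k))))) + w (suc k) * A 1 k
          ≈⟨ solve 4 (λ u a b c → (u :* a :+ b) :+ u :* c := u :* (a :+ c) :+ b) refl _ _ _ _ ⟩
        w (suc k) * A 0 (suc k) + (q 0 (suc (suc (suc k))) + q 0 (suc (suc (suc k)))) ∎

      A≈∑diag : ∀ m n → ∑diag (λ i j → t (i ℕ.+ m) j) n ≈ A m n
      A≈∑diag m zero    = refl
      A≈∑diag m (suc n) = +-congˡ (begin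
        ∑diag (λ i j → t (suc i ℕ.+ m) j) n ≈⟨ ∑diag-cong n (λ i j _ → reflexive (≡.cong (λ k → t k j) (ℕ.+-suc i m))) ⟨
        ∑diag (λ i j → t (i ℕ.+ suc m) j) n ≈⟨ A≈∑diag (suc m) n ⟩
        A (suc m) n ∎)

    q-suc-suc : ∀ m s → q (suc m) (suc s) ≈ w (m ℕ.+ s) * q m s
    q-suc-suc m s = begin
      q (suc m) (suc s)
        ≈⟨ q-diag m s ⟩
      q m s * (p ^ m * p ^ s * p ^ s * p) * (p ^ m * p ^ m * (p * p ^ s) * p)
        ≈⟨ solve 4 (λ a b p e → e :* (a :* b :* b :* p) :* (a :* a :* (p :* b) :* p)
                    := (a :* b) :* (a :* b) :* (a :* b) :* (p :* p :* p) :* e) refl _ _ _ _ ⟩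
      (p ^ m * p ^ s) * (p ^ m * p ^ s) * (p ^ m * p ^ s) * (p * p * p) * q m s
        ≈⟨ *-congʳ (w-+ m s) ⟨
      w (m ℕ.+ s) * q m s ∎

    -- Moving (i, j) to (i + 1, j + 1) multiplies `q` by `w k` and reaches every entry of the
    -- antidiagonal k + 2 except its two ends, which are equal.
    ∑diag-q-suc² : ∀ k → ∑diag q (suc (suc k)) ≈ w k * ∑diag q k + (q 0 (suc (suc k)) + q 0 (suc (suc k)))
    ∑diag-q-suc² k = begin
      q 0 (suc (suc k)) + ∑diag (λ i j → q (suc i) j) (suc k)
        ≈⟨ +-congˡ (∑diag-last k (λ i j → q (suc i) j)) ⟩
      q 0 (suc (suc k)) + (∑diag (λ i j → q (suc i) (suc j)) k + q (suc (suc k)) 0)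
        ≈⟨ +-congˡ (+-cong (trans (∑diag-cong k (λ i j e → trans (q-suc-suc i j) (*-congʳ (reflexive (≡.cong w e))))) (∑diag-*ˡ k (w k) q))
                           (q-comm (suc (suc k)) 0)) ⟩
      q 0 (suc (suc k)) + (w k * ∑diag q k + q 0 (suc (suc k)))
        ≈⟨ solve 2 (λ a b → a :+ (b :+ a) := b :+ (a :+ a)) refl _ _ ⟩
      w k * ∑diag q k + (q 0 (suc (suc k)) + q 0 (suc (suc k))) ∎

    -- Both sides satisfy the same recurrence of order two and agree at 0 and 1.
    ∑diag-t : ∀ n → ∑diag t n ≈ ∑diag q n
    ∑diag-t n = trans (∑diag-cong n (λ i j _ → reflexive (≡.cong (λ k → t k j) (≡.sym (ℕ.+-identityʳ i)))))
                     (trans (A≈∑diag 0 n) (A≈q n))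
      where
      A≈q : ∀ n → A 0 n ≈ ∑diag q n
      A≈q zero          = t₀₀
      A≈q (suc zero)    = trans (+-congˡ (t-zeroʳ 0)) t₀₁
      A≈q (suc (suc k)) = trans (A-suc² k) (trans (+-congʳ (*-congˡ (A≈q k))) (sym (∑diag-q-suc² k)))

    -- The summand of the expansion of (p)ₘ with r = m + s.
    z : ℕ → ℕ → Carrier
    z m s = p ^ (s ℕ.* (m ℕ.+ s)) * (1# - p ^ suc ((m ℕ.+ s) ℕ.+ (m ℕ.+ s))) * poch (m ℕ.+ m ℕ.+ s) * invPoch s

    -- The telescoping certificate for the passage from m to m + 1.
    V : ℕ → ℕ → Carrier
    V m s = p ^ (s ℕ.* suc (m ℕ.+ s)) * (1# - p ^ suc (m ℕ.+ s)) * P m s * invPoch s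

    private
      p^-double : ∀ m s → p ^ ((m ℕ.+ s) ℕ.+ (m ℕ.+ s)) ≈ (p ^ m * p ^ s) * (p ^ m * p ^ s)
      p^-double m s = trans (^-homo-* p (m ℕ.+ s) (m ℕ.+ s)) (*-cong (^-homo-* p m s) (^-homo-* p m s))

    z-step : ∀ m s → z (suc m) s + V m (suc s) ≈ (1# - p ^ suc m) * z m (suc s) + V m s
    z-step m s = begin
      z (suc m) s + V m (suc s)
        ≈⟨ +-cong (*-congʳ (*-cong (*-congˡ (+-congˡ (-‿cong (*-congˡ (p^-double (suc m) s))))) poch₁))
                  (*-congʳ (*-cong (*-cong pow₂ (+-congˡ (-‿cong (*-congˡ (^-homo-* p m (suc s)))))) (P-sucʳ m s))) ⟩
      _ ≈⟨ +-congʳ (*-congˡ (invPoch-suc s)) ⟩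
      _ ≈⟨ solve 6 (λ a b p e c i →
             let one = con (+ 1) ; u = one :- p :* (p :* (a :* a :* b)) in
             e :* (one :- p :* (((p :* a) :* b) :* ((p :* a) :* b))) :* (c :* u) :* (i :* (one :- p :* b))
             :+ (e :* (p :* (a :* b)) :* (b :* p)) :* (one :- p :* (a :* (p :* b))) :* (c :* u) :* i
             :=
             (one :- p :* a) :* ((e :* (p :* (a :* b))) :* (one :- p :* ((a :* (p :* b)) :* (a :* (p :* b)))) :* c :* i)
             :+ e :* (one :- p :* (a :* b)) :* c :* (i :* (one :- p :* b)))
           refl (p ^ m) (p ^ s) p (p ^ (s ℕ.* suc (m ℕ.+ s))) (P m s) (invPoch (suc s)) ⟩
      _ ≈⟨ +-cong (*-congˡ (*-congʳ (*-cong (*-cong pow₁ (+-congˡ (-‿cong (*-congˡ (p^-double m (suc s)))))) poch₂)))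
                  (*-cong (*-congʳ (*-congˡ (+-congˡ (-‿cong (*-congˡ (^-homo-* p m s)))))) (invPoch-suc s)) ⟨
      (1# - p ^ suc m) * z m (suc s) + V m s ∎
      where
      poch₁ : poch (suc m ℕ.+ suc m ℕ.+ s) ≈ P m s * (1# - p * (p * (p ^ m * p ^ m * p ^ s)))
      poch₁ = trans (reflexive (≡.cong poch (index m s))) (P-sucʳ m s)
        where
        index : ∀ m s → suc m ℕ.+ suc m ℕ.+ s ≡ suc (m ℕ.+ m ℕ.+ suc s)
        index = solve-∀
      poch₂ : poch (m ℕ.+ m ℕ.+ suc s) ≈ P m s
      poch₂ = reflexive (≡.cong poch (ℕ.+-suc (m ℕ.+ m) s))
      pow₁ : p ^ (suc s ℕ.* (m ℕ.+ suc s)) ≈ p ^ (s ℕ.* suc (m ℕ.+ s)) * (p * (p ^ m * p ^ s))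
      pow₁ = begin
        p ^ (suc s ℕ.* (m ℕ.+ suc s)) ≈⟨ p^-cong (exponents m s) ⟩
        p ^ (s ℕ.* suc (m ℕ.+ s) ℕ.+ suc (m ℕ.+ s)) ≈⟨ ^-homo-* p (s ℕ.* suc (m ℕ.+ s)) _ ⟩
        p ^ (s ℕ.* suc (m ℕ.+ s)) * (p * p ^ (m ℕ.+ s)) ≈⟨ *-congˡ (*-congˡ (^-homo-* p m s)) ⟩
        p ^ (s ℕ.* suc (m ℕ.+ s)) * (p * (p ^ m * p ^ s)) ∎
        where
        exponents : ∀ m s → suc s ℕ.* (m ℕ.+ suc s) ≡ s ℕ.* suc (m ℕ.+ s) ℕ.+ suc (m ℕ.+ s)
        exponents = solve-∀
      pow₂ : p ^ (suc s ℕ.* suc (m ℕ.+ suc s)) ≈ p ^ (s ℕ.* suc (m ℕ.+ s)) * (p * (p ^ m * p ^ s)) * (p ^ s * p)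
      pow₂ = begin
        p ^ (suc s ℕ.* suc (m ℕ.+ suc s)) ≈⟨ p^-cong (exponents m s) ⟩
        p ^ (suc s ℕ.* (m ℕ.+ suc s) ℕ.+ suc s) ≈⟨ ^-homo-* p (suc s ℕ.* (m ℕ.+ suc s)) _ ⟩
        p ^ (suc s ℕ.* (m ℕ.+ suc s)) * (p * p ^ s) ≈⟨ *-cong pow₁ (*-comm _ _) ⟩
        p ^ (s ℕ.* suc (m ℕ.+ s)) * (p * (p ^ m * p ^ s)) * (p ^ s * p) ∎
        where
        exponents : ∀ m s → suc s ℕ.* suc (m ℕ.+ suc s) ≡ suc s ℕ.* (m ℕ.+ suc s) ℕ.+ suc s
        exponents = solve-∀

    V₀ : ∀ m → V m 0 ≈ (1# - p ^ suc m) * z m 0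
    V₀ m = begin
      1# * (1# - p ^ suc (m ℕ.+ 0)) * (poch (m ℕ.+ m ℕ.+ 0) * (1# - p ^ suc (m ℕ.+ m ℕ.+ 0))) * 1#
        ≈⟨ *-congʳ (*-cong (*-congˡ (+-congˡ (-‿cong (p^-cong (≡.cong suc (ℕ.+-identityʳ m))))))
                           (*-congˡ (+-congˡ (-‿cong (p^-cong (index m)))))) ⟩
      1# * (1# - p ^ suc m) * (poch (m ℕ.+ m ℕ.+ 0) * (1# - p ^ suc (m ℕ.+ 0 ℕ.+ (m ℕ.+ 0)))) * 1#
        ≈⟨ solve 3 (λ u c v → con (+ 1) :* u :* (c :* v) :* con (+ 1) := u :* (con (+ 1) :* v :* c :* con (+ 1))) refl _ _ _ ⟩
      (1# - p ^ suc m) * z m 0 ∎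
      where
      index : ∀ m → suc (m ℕ.+ m ℕ.+ 0) ≡ suc (m ℕ.+ 0 ℕ.+ (m ℕ.+ 0))
      index = solve-∀

    -- Summed over s, the certificate leaves only `V m n`; by `V₀` its lower end is the additional
    -- summand z m 0 on the right.
    ∑-z-suc : ∀ m n → ∑ n (z (suc m)) + V m n ≈ (1# - p ^ suc m) * ∑ (suc n) (z m)
    ∑-z-suc m zero    = trans (+-identityˡ _) (trans (V₀ m) (*-congˡ (sym (+-identityˡ _))))
    ∑-z-suc m (suc n) = begin
      ∑ n (z (suc m)) + z (suc m) n + V m (suc n)
        ≈⟨ +-assoc _ _ _ ⟩
      ∑ n (z (suc m)) + (z (suc m) n + V m (suc n))
        ≈⟨ +-congˡ (z-step m n) ⟩
      ∑ n (z (suc m)) + ((1# - p ^ suc m) * z m (suc n) + V m n)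
        ≈⟨ solve 3 (λ a b c → a :+ (b :+ c) := (a :+ c) :+ b) refl _ _ _ ⟩
      (∑ n (z (suc m)) + V m n) + (1# - p ^ suc m) * z m (suc n)
        ≈⟨ +-congʳ (∑-z-suc m n) ⟩
      (1# - p ^ suc m) * ∑ (suc n) (z m) + (1# - p ^ suc m) * z m (suc n)
        ≈⟨ distribˡ _ _ _ ⟨
      (1# - p ^ suc m) * ∑ (suc (suc n)) (z m) ∎

    -- The cofactor of p^(n(m+n)) in the remainder of the expansion after n terms. Its recursion is
    -- the one that `∑-z-suc` forces.
    δ : ℕ → ℕ → Carrier
    δ zero    n = 1#
    δ (suc m) n = (1# - p ^ suc m) * (p ^ suc (m ℕ.+ n) * δ m (suc n))
                  + (1# - p ^ suc (m ℕ.+ n)) * P m n * invPoch n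

    -- For m = 0 the summand is p^(s²) - p^((s+1)²) and the sum telescopes. The step to m + 1
    -- multiplies the identity for m and n + 1 by 1 - pᵐ⁺¹.
    ∑-z : ∀ m n → ∑ n (z m) + p ^ (n ℕ.* (m ℕ.+ n)) * δ m n ≈ poch m
    ∑-z zero    zero    = trans (+-identityˡ _) (*-identityˡ 1#)
    ∑-z zero    (suc n) = begin
      ∑ n (z 0) + z 0 n + p ^ (suc n ℕ.* suc n) * 1#
        ≈⟨ +-cong (+-congˡ (trans (*-assoc _ _ _) (*-cong (*-congˡ (+-congˡ (-‿cong (*-congˡ (^-homo-* p n n))))) (poch-invPoch n))))
                  (*-congʳ (trans (p^-cong (exponents n)) (trans (^-homo-* p (n ℕ.* n) _) (*-congˡ (*-congˡ (^-homo-* p n n)))))) ⟩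
      ∑ n (z 0) + p ^ (n ℕ.* n) * (1# - p * (p ^ n * p ^ n)) * 1# + p ^ (n ℕ.* n) * (p * (p ^ n * p ^ n)) * 1#
        ≈⟨ solve 3 (λ a e v → a :+ e :* (con (+ 1) :- v) :* con (+ 1) :+ e :* v :* con (+ 1) := a :+ e :* con (+ 1)) refl _ _ _ ⟩
      ∑ n (z 0) + p ^ (n ℕ.* n) * 1#
        ≈⟨ ∑-z 0 n ⟩
      1# ∎
      where
      exponents : ∀ n → suc n ℕ.* suc n ≡ n ℕ.* n ℕ.+ suc (n ℕ.+ n)
      exponents = solve-∀
    ∑-z (suc m) n = begin
      ∑ n (z (suc m)) + e * δ (suc m) n
        ≈⟨ solve 7 (λ s e a f d b c → s :+ e :* (a :* (f :* d) :+ b :* c) := (s :+ e :* (b :* c)) :+ a :* ((e :* f) :* d)) refl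
             _ _ _ _ _ _ _ ⟩
      _ ≈⟨ solve 6 (λ s e b c i r → (s :+ e :* (b :* c :* i)) :+ r := (s :+ e :* b :* c :* i) :+ r) refl _ _ _ _ _ _ ⟩
      (∑ n (z (suc m)) + V m n) + (1# - p ^ suc m) * ((e * p ^ suc (m ℕ.+ n)) * δ m (suc n))
        ≈⟨ +-cong (∑-z-suc m n) (*-congˡ (*-congʳ (trans (sym (^-homo-* p (n ℕ.* suc (m ℕ.+ n)) _)) (p^-cong (exponents m n))))) ⟩
      (1# - p ^ suc m) * ∑ (suc n) (z m) + (1# - p ^ suc m) * (p ^ (suc n ℕ.* (m ℕ.+ suc n)) * δ m (suc n))
        ≈⟨ distribˡ _ _ _ ⟨
      (1# - p ^ suc m) * (∑ (suc n) (z m) + p ^ (suc n ℕ.* (m ℕ.+ suc n)) * δ m (suc n))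
        ≈⟨ trans (*-congˡ (∑-z m (suc n))) (*-comm _ _) ⟩
      poch (suc m) ∎
      where
      e = p ^ (n ℕ.* suc (m ℕ.+ n))
      exponents : ∀ m n → n ℕ.* suc (m ℕ.+ n) ℕ.+ suc (m ℕ.+ n) ≡ suc n ℕ.* (m ℕ.+ suc n)
      exponents = solve-∀

    F : ℕ → Carrier
    F m = (1# + x * p ^ m) * p ^ (m ℕ.* m) * poch m * poch m * J m

    err : ℕ → ℕ → Carrier
    err m n = p ^ (m ℕ.* m ℕ.+ n ℕ.* (m ℕ.+ n)) * ((1# + x * p ^ m) * poch m * J m * δ m n)

    private
      f : ℕ → ℕ → Carrier
      f m s = (1# + x * p ^ m) * p ^ (m ℕ.* m) * poch m * J m * z m s

      F-split : ∀ m n → F m ≈ ∑ n (f m) + err m n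
      F-split m n = begin
        F m
          ≈⟨ *-congʳ (*-congˡ (∑-z m n)) ⟨
        (1# + x * p ^ m) * p ^ (m ℕ.* m) * poch m * (∑ n (z m) + p ^ (n ℕ.* (m ℕ.+ n)) * δ m n) * J m
          ≈⟨ solve 7 (λ y e h j s g d → y :* e :* h :* (s :+ g :* d) :* j
                      := y :* e :* h :* j :* s :+ (e :* g) :* (y :* h :* j :* d)) refl _ _ _ _ _ _ _ ⟩
        _ ≈⟨ +-cong (sym (∑-*ˡ n _ (z m))) (*-congʳ (sym (^-homo-* p (m ℕ.* m) _))) ⟩
        ∑ n (f m) + err m n ∎

      y : ℕ → ℕ → ℕ → Carrier
      y r m s = x * p ^ suc (r ℕ.+ r) * t m s

      f-zero : ∀ m → f m 0 ≈ (1# + x * p ^ m) * t m 0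
      f-zero m = begin
        (1# + x * p ^ m) * p ^ (m ℕ.* m) * poch m * J m * (1# * (1# - p ^ suc (m ℕ.+ 0 ℕ.+ (m ℕ.+ 0))) * poch (m ℕ.+ m ℕ.+ 0) * 1#)
          ≈⟨ *-cong (*-congʳ (*-congʳ (*-congˡ (p^-cong (exponents m)))))
                    (*-congʳ (*-congʳ (*-congˡ (+-congˡ (-‿cong (p^-cong (index m))))))) ⟩
        (1# + x * p ^ m) * q m 0 * poch m * J m * (1# * (1# - p ^ suc (m ℕ.+ m ℕ.+ 0)) * poch (m ℕ.+ m ℕ.+ 0) * 1#)
          ≈⟨ solve 6 (λ w e h j v c → w :* e :* h :* j :* (con (+ 1) :* v :* c :* con (+ 1))
                      := w :* (e :* h :* ((c :* v) :* j :* con (+ 1)))) refl _ _ _ _ _ _ ⟩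
        (1# + x * p ^ m) * t m 0 ∎
        where
        exponents : ∀ m → m ℕ.* m ≡ m ℕ.* m ℕ.+ m ℕ.* 0 ℕ.+ 0
        exponents = solve-∀
        index : ∀ m → suc (m ℕ.+ 0 ℕ.+ (m ℕ.+ 0)) ≡ suc (m ℕ.+ m ℕ.+ 0)
        index = solve-∀

      -- Put r = m + s + 1. As p = x², the factor 1 - p²ʳ⁺¹ of z is (1 + x pʳ)(1 - x pʳ), and 1 + x
      -- pʳ is constant on the antidiagonal. The rest is (1 + x pᵐ)(1 - x pʳ) = (1 - p^(m+r+1)) + x
      -- pᵐ(1 - p^(s+1)), where the first part completes t m (s+1) and the second reduces to t m s.
      f-suc : ∀ m s → f m (suc s) ≈ (1# + x * p ^ suc (m ℕ.+ s)) * (t m (suc s) + y (m ℕ.+ s) m s)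
      f-suc m s = begin
        f m (suc s)
          ≈⟨ solve 8 (λ w g h j e u c i → w :* g :* h :* j :* (e :* u :* c :* i) := w :* (g :* e) :* h :* j :* (u :* c :* i)) refl
               _ _ _ _ _ _ _ _ ⟩
        _ ≈⟨ *-cong (*-congʳ (*-congʳ (*-congˡ pow)))
                    (*-congʳ (*-cong (+-congˡ (-‿cong (*-congˡ (p^-double m (suc s))))) poch₂)) ⟩
        _ ≈⟨ solve 8 (λ a b x e h c j i →
               let one = con (+ 1) ; p = x :* x ; e′ = e :* (a :* b :* b :* p) in
               (one :+ x :* a) :* e′ :* h :* j :* ((one :- p :* ((a :* (p :* b)) :* (a :* (p :* b)))) :* c :* i)
               :=
               (one :+ x :* (p :* (a :* b))) :*
                 (e′ :* h :* ((c :* (one :- p :* (p :* (a :* a :* b)))) :* j :* i)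
                  :+ x :* (p :* ((a :* b) :* (a :* b))) :* (e :* h :* (c :* j :* (i :* (one :- p :* b))))))
             refl (p ^ m) (p ^ s) x (q m s) (poch m) (P m s) (J m) (invPoch (suc s)) ⟩
        _ ≈⟨ *-cong (+-congˡ (*-congˡ (*-congˡ (^-homo-* p m s))))
                    (+-cong (*-cong (*-congʳ (q-sucʳ m s)) (*-congʳ (*-congʳ (P-sucʳ m s))))
                            (*-cong (*-congˡ (*-congˡ (p^-double m s))) (*-congˡ (*-congˡ (invPoch-suc s))))) ⟨
        (1# + x * p ^ suc (m ℕ.+ s)) * (t m (suc s) + y (m ℕ.+ s) m s) ∎
        where
        poch₂ : poch (m ℕ.+ m ℕ.+ suc s) ≈ P m s
        poch₂ = reflexive (≡.cong poch (ℕ.+-suc (m ℕ.+ m) s))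
        pow : p ^ (m ℕ.* m) * p ^ (suc s ℕ.* (m ℕ.+ suc s)) ≈ q m s * (p ^ m * p ^ s * p ^ s * p)
        pow = trans (sym (^-homo-* p (m ℕ.* m) _)) (trans (p^-cong (exponents m s)) (q-sucʳ m s))
          where
          exponents : ∀ m s → m ℕ.* m ℕ.+ suc s ℕ.* (m ℕ.+ suc s) ≡ m ℕ.* m ℕ.+ m ℕ.* suc s ℕ.+ suc s ℕ.* suc s
          exponents = solve-∀

    ∑diag-f : ∀ r → ∑diag f r ≈ N r
    ∑diag-f zero    = begin
      f 0 0 ≈⟨ f-zero 0 ⟩
      (1# + x * p ^ 0) * t 0 0 ≈⟨ *-congˡ (trans (∑diag-t 0) (sym (+-identityʳ _))) ⟩
      N 0 ∎
    ∑diag-f (suc r) = begin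
      ∑diag f (suc r)
        ≈⟨ ∑diag-last r f ⟩
      ∑diag (λ i j → f i (suc j)) r + f (suc r) 0
        ≈⟨ +-cong (∑diag-cong r (λ i j e → trans (f-suc i j) (reflexive (≡.cong (λ k → (1# + x * p ^ suc k) * (t i (suc j) + y k i j)) e))))
                  (f-zero (suc r)) ⟩
      ∑diag (λ i j → (1# + x * p ^ suc r) * (t i (suc j) + y r i j)) r + (1# + x * p ^ suc r) * t (suc r) 0
        ≈⟨ +-congʳ (∑diag-*ˡ r _ _) ⟩
      (1# + x * p ^ suc r) * ∑diag (λ i j → t i (suc j) + y r i j) r + (1# + x * p ^ suc r) * t (suc r) 0
        ≈⟨ distribˡ _ _ _ ⟨
      (1# + x * p ^ suc r) * (∑diag (λ i j → t i (suc j) + y r i j) r + t (suc r) 0)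
        ≈⟨ *-congˡ (+-congʳ (∑diag-+ r (λ i j → t i (suc j)) (y r))) ⟩
      (1# + x * p ^ suc r) * (∑diag (λ i j → t i (suc j)) r + ∑diag (y r) r + t (suc r) 0)
        ≈⟨ *-congˡ (solve 3 (λ a b c → a :+ b :+ c := (a :+ c) :+ b) refl _ _ _) ⟩
      (1# + x * p ^ suc r) * ((∑diag (λ i j → t i (suc j)) r + t (suc r) 0) + ∑diag (y r) r)
        ≈⟨ *-congˡ (+-cong (trans (sym (∑diag-last r t)) (∑diag-t (suc r))) (trans (∑diag-*ˡ r _ t) (*-congˡ (∑diag-t r)))) ⟩
      N (suc r) ∎

    -- Row m is cut off after n - m terms, so the rows fill the triangle m + s < n and can be
    -- regrouped by r = m + s.
    ∑-F : ∀ n → ∑ n F ≈ ∑ n N + ∑ n (λ m → err m (n ℕ.∸ m))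
    ∑-F n = begin
      ∑ n F ≈⟨ ∑-cong n (λ m → F-split m (n ℕ.∸ m)) ⟩
      ∑ n (λ m → ∑ (n ℕ.∸ m) (f m) + err m (n ℕ.∸ m)) ≈⟨ ∑-+ n _ _ ⟩
      ∑ n (λ m → ∑ (n ℕ.∸ m) (f m)) + ∑ n (λ m → err m (n ℕ.∸ m)) ≈⟨ +-congʳ (∑-triangle n f) ⟩
      ∑ n (∑diag f) + ∑ n (λ m → err m (n ℕ.∸ m)) ≈⟨ +-congʳ (∑-cong n ∑diag-f) ⟩
      ∑ n N + ∑ n (λ m → err m (n ℕ.∸ m)) ∎

    -- The hypotheses are the recurrences read off from the partitions. Solved, they say that O m is
    -- the product of (1 - pⁱ)/(1 + pⁱ) over 1 ≤ i ≤ m, that G m is p^(m²) divided by the product of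
    -- 1 - p²ⁱ⁻¹ over the same i, and that T m is G m / (1 - x pᵐ).
    module Product
      (O O′ G T : ℕ → Carrier)
      (O-zero : O 0 ≈ 1#) (O′-eq : ∀ m → O′ m ≈ O m + - 1# * (p ^ suc m * O′ m))
      (O-suc : ∀ m → O (suc m) ≈ O′ m - p ^ suc m * O′ m)
      (G-zero : G 0 ≈ 1#) (G-suc : ∀ m → G (suc m) ≈ p ^ suc (m ℕ.+ m) * (G m + G (suc m)))
      (T-eq : ∀ m → T m ≈ G m + x * p ^ m * T m)
      where

      private
        isolate : ∀ {a b c} → a ≈ b + c → b ≈ a - c
        isolate {a} {b} {c} a≈b+c = begin
          b ≈⟨ solve 2 (λ b c → b := b :+ c :- c) refl b c ⟩
          b + c - c ≈⟨ +-congʳ a≈b+c ⟨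
          a - c ∎

        p^-square : ∀ m → p ^ (m ℕ.+ m) ≈ p ^ m * p ^ m
        p^-square m = ^-homo-* p m m

      -- In (p)₂ₘ the factors of odd index cancel the denominator of G m, and those of even index, 1
      -- - p²ⁱ = (1 - pⁱ)(1 + pⁱ), cancel that of O m.
      OG-poch : ∀ m → O m * G m * poch (m ℕ.+ m) ≈ p ^ (m ℕ.* m) * poch m * poch m
      OG-poch zero    = *-congʳ (*-cong O-zero G-zero)
      OG-poch (suc m) = begin
        O (suc m) * G (suc m) * poch (suc m ℕ.+ suc m)
          ≈⟨ *-cong (*-congʳ (O-suc m)) (trans (reflexive (≡.cong (λ k → poch (suc k)) (ℕ.+-suc m m)))
               (*-congˡ (+-congˡ (-‿cong (*-congˡ (*-congˡ (p^-square m))))))) ⟩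
        (O′ m - p ^ suc m * O′ m) * G (suc m) * (poch (m ℕ.+ m) * (1# - g) * (1# - p * (p * (p ^ m * p ^ m))))
          ≈⟨ solve 6 (λ o a p y c g → let one = con (+ 1) ; A = p :* a in
               (o :- A :* o) :* y :* (c :* (one :- g) :* (one :- p :* (p :* (a :* a))))
               := (one :- A) :* (one :- A) :* (o :- con (-[1+ 0 ]) :* (A :* o)) :* (y :- g :* y) :* c)
               refl (O′ m) (p ^ m) p (G (suc m)) (poch (m ℕ.+ m)) g ⟩
        (1# - p ^ suc m) * (1# - p ^ suc m) * (O′ m - - 1# * (p ^ suc m * O′ m)) * (G (suc m) - g * G (suc m)) * poch (m ℕ.+ m)
          ≈⟨ *-congʳ (*-cong (*-congˡ (isolate (O′-eq m))) (isolate (trans (G-suc m) (distribˡ _ _ _)))) ⟨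
        (1# - p ^ suc m) * (1# - p ^ suc m) * O m * (g * G m) * poch (m ℕ.+ m)
          ≈⟨ solve 5 (λ v o g y c → v :* v :* o :* (g :* y) :* c := v :* v :* g :* (o :* y :* c)) refl _ _ _ _ _ ⟩
        (1# - p ^ suc m) * (1# - p ^ suc m) * g * (O m * G m * poch (m ℕ.+ m))
          ≈⟨ *-congˡ (OG-poch m) ⟩
        (1# - p ^ suc m) * (1# - p ^ suc m) * g * (p ^ (m ℕ.* m) * poch m * poch m)
          ≈⟨ solve 4 (λ v g e h → v :* v :* g :* (e :* h :* h) := (e :* g) :* (h :* v) :* (h :* v)) refl _ _ _ _ ⟩
        (p ^ (m ℕ.* m) * g) * poch (suc m) * poch (suc m)
          ≈⟨ *-congʳ (*-congʳ (trans (sym (^-homo-* p (m ℕ.* m) _)) (p^-cong (square m)))) ⟩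
        p ^ (suc m ℕ.* suc m) * poch (suc m) * poch (suc m) ∎
        where
        g = p ^ suc (m ℕ.+ m)
        square : ∀ m → m ℕ.* m ℕ.+ suc (m ℕ.+ m) ≡ suc m ℕ.* suc m
        square = solve-∀

      -- The factor 1 + x pᵐ of F m arises from 1/(1 - x pᵐ) = (1 + x pᵐ)/(1 - p²ᵐ⁺¹).
      OT≈F : ∀ m → O m * T m ≈ F m
      OT≈F m = begin
        O m * T m
          ≈⟨ trans (sym (*-identityʳ _)) (*-congˡ (sym (poch-invPoch (suc (m ℕ.+ m))))) ⟩
        O m * T m * (poch (m ℕ.+ m) * (1# - p * p ^ (m ℕ.+ m)) * J m)
          ≈⟨ *-congˡ (*-congʳ (*-congˡ (+-congˡ (-‿cong (*-congˡ (p^-square m)))))) ⟩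
        O m * T m * (poch (m ℕ.+ m) * (1# - p * (p ^ m * p ^ m)) * J m)
          ≈⟨ solve 6 (λ o t c x a j → let one = con (+ 1) in
               o :* t :* (c :* (one :- (x :* x) :* (a :* a)) :* j)
               := (one :+ x :* a) :* (o :* (t :- x :* a :* t) :* c) :* j) refl (O m) (T m) (poch (m ℕ.+ m)) x (p ^ m) (J m) ⟩
        (1# + x * p ^ m) * (O m * (T m - x * p ^ m * T m) * poch (m ℕ.+ m)) * J m
          ≈⟨ *-congʳ (*-congˡ (*-congʳ (*-congˡ (isolate (T-eq m))))) ⟨
        (1# + x * p ^ m) * (O m * G m * poch (m ℕ.+ m)) * J m
          ≈⟨ *-congʳ (*-congˡ (OG-poch m)) ⟩
        (1# + x * p ^ m) * (p ^ (m ℕ.* m) * poch m * poch m) * J m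
          ≈⟨ *-congʳ (solve 3 (λ y e h → y :* (e :* h :* h) := y :* e :* h :* h) refl _ _ _) ⟩
        F m ∎

-- Formal power series over ℤ

module PowerSeries where

  open ≡ using (refl; sym; trans; cong; cong₂; module ≡-Reasoning)

  Series : Set
  Series = ℕ → ℤ

  infix  4 _≋_
  infixl 6 _⊕_
  infixl 7 _⊛_

  _≋_ : Series → Series → Set
  f ≋ g = ∀ n → f n ≡ g n

  _⊕_ : Series → Series → Series
  (f ⊕ g) n = f n ℤ.+ g n

  -- Splitting off the constant coefficient of the left factor makes the ring laws plain inductions
  -- on the degree.
  _⊛_ : Series → Series → Series
  (f ⊛ g) zero    = f 0 ℤ.* g 0
  (f ⊛ g) (suc n) = f 0 ℤ.* g (suc n) ℤ.+ ((f ∘ suc) ⊛ g) n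

  constant : ℤ → Series
  constant c zero    = c
  constant c (suc n) = 0ℤ

  ⊛-cong : ∀ {f f′ g g′} → f ≋ f′ → g ≋ g′ → f ⊛ g ≋ f′ ⊛ g′
  ⊛-cong f≋ g≋ zero    = cong₂ ℤ._*_ (f≋ 0) (g≋ 0)
  ⊛-cong f≋ g≋ (suc n) = cong₂ ℤ._+_ (cong₂ ℤ._*_ (f≋ 0) (g≋ (suc n))) (⊛-cong (f≋ ∘ suc) g≋ n)

  ⊛-distribʳ : ∀ h f g → (f ⊕ g) ⊛ h ≋ f ⊛ h ⊕ g ⊛ h
  ⊛-distribʳ h f g zero    = ℤ.*-distribʳ-+ (h 0) (f 0) (g 0)
  ⊛-distribʳ h f g (suc n) = begin
    (f 0 ℤ.+ g 0) ℤ.* h (suc n) ℤ.+ (((f ⊕ g) ∘ suc) ⊛ h) n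
      ≡⟨ cong (ℤ._+_ ((f 0 ℤ.+ g 0) ℤ.* h (suc n))) (⊛-distribʳ h (f ∘ suc) (g ∘ suc) n) ⟩
    (f 0 ℤ.+ g 0) ℤ.* h (suc n) ℤ.+ (((f ∘ suc) ⊛ h) n ℤ.+ ((g ∘ suc) ⊛ h) n)
      ≡⟨ rearrange (f 0) (g 0) (h (suc n)) (((f ∘ suc) ⊛ h) n) (((g ∘ suc) ⊛ h) n) ⟩
    (f ⊛ h) (suc n) ℤ.+ (g ⊛ h) (suc n) ∎
    where
    open ≡-Reasoning
    rearrange : ∀ a b c d e → (a ℤ.+ b) ℤ.* c ℤ.+ (d ℤ.+ e) ≡ (a ℤ.* c ℤ.+ d) ℤ.+ (b ℤ.* c ℤ.+ e)
    rearrange = ℤ-solver.solve-∀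

  ⊛-scaleˡ : ∀ c f g → (λ n → c ℤ.* f n) ⊛ g ≋ λ n → c ℤ.* (f ⊛ g) n
  ⊛-scaleˡ c f g zero    = ℤ.*-assoc c (f 0) (g 0)
  ⊛-scaleˡ c f g (suc n) =
    trans (cong₂ ℤ._+_ (ℤ.*-assoc c (f 0) (g (suc n))) (⊛-scaleˡ c (f ∘ suc) g n))
          (sym (ℤ.*-distribˡ-+ c (f 0 ℤ.* g (suc n)) (((f ∘ suc) ⊛ g) n)))

  ⊛-last : ∀ f g n → (f ⊛ g) (suc n) ≡ f (suc n) ℤ.* g 0 ℤ.+ (f ⊛ (g ∘ suc)) n
  ⊛-last f g zero    = ℤ.+-comm (f 0 ℤ.* g 1) (f 1 ℤ.* g 0)
  ⊛-last f g (suc n) = trans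
    (cong (ℤ._+_ (f 0 ℤ.* g (suc (suc n)))) (⊛-last (f ∘ suc) g n))
    (rearrange (f 0 ℤ.* g (suc (suc n))) (f (suc (suc n)) ℤ.* g 0) (((f ∘ suc) ⊛ (g ∘ suc)) n))
    where
    rearrange : ∀ a b c → a ℤ.+ (b ℤ.+ c) ≡ b ℤ.+ (a ℤ.+ c)
    rearrange = ℤ-solver.solve-∀

  ⊛-comm : ∀ f g → f ⊛ g ≋ g ⊛ f
  ⊛-comm f g zero    = ℤ.*-comm (f 0) (g 0)
  ⊛-comm f g (suc n) =
    trans (cong₂ ℤ._+_ (ℤ.*-comm (f 0) (g (suc n))) (⊛-comm (f ∘ suc) g n)) (sym (⊛-last g f n))

  ⊛-assoc : ∀ f g h → (f ⊛ g) ⊛ h ≋ f ⊛ (g ⊛ h)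
  ⊛-assoc f g h zero    = ℤ.*-assoc (f 0) (g 0) (h 0)
  ⊛-assoc f g h (suc n) = begin
    f 0 ℤ.* g 0 ℤ.* h (suc n) ℤ.+ (((λ i → f 0 ℤ.* g (suc i)) ⊕ (f ∘ suc) ⊛ g) ⊛ h) n
      ≡⟨ cong (ℤ._+_ (f 0 ℤ.* g 0 ℤ.* h (suc n))) (⊛-distribʳ h (λ i → f 0 ℤ.* g (suc i)) ((f ∘ suc) ⊛ g) n) ⟩
    f 0 ℤ.* g 0 ℤ.* h (suc n) ℤ.+ (((λ i → f 0 ℤ.* g (suc i)) ⊛ h) n ℤ.+ (((f ∘ suc) ⊛ g) ⊛ h) n)
      ≡⟨ cong (ℤ._+_ (f 0 ℤ.* g 0 ℤ.* h (suc n))) (cong₂ ℤ._+_ (⊛-scaleˡ (f 0) (g ∘ suc) h n) (⊛-assoc (f ∘ suc) g h n)) ⟩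
    f 0 ℤ.* g 0 ℤ.* h (suc n) ℤ.+ (f 0 ℤ.* ((g ∘ suc) ⊛ h) n ℤ.+ ((f ∘ suc) ⊛ (g ⊛ h)) n)
      ≡⟨ rearrange (f 0) (g 0) (h (suc n)) (((g ∘ suc) ⊛ h) n) (((f ∘ suc) ⊛ (g ⊛ h)) n) ⟩
    (f ⊛ (g ⊛ h)) (suc n) ∎
    where
    open ≡-Reasoning
    rearrange : ∀ a b c d e → a ℤ.* b ℤ.* c ℤ.+ (a ℤ.* d ℤ.+ e) ≡ a ℤ.* (b ℤ.* c ℤ.+ d) ℤ.+ e
    rearrange = ℤ-solver.solve-∀

  ⊛-zeroˡ : ∀ f → (λ _ → 0ℤ) ⊛ f ≋ λ _ → 0ℤ
  ⊛-zeroˡ f zero    = refl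
  ⊛-zeroˡ f (suc n) = trans (ℤ.+-identityˡ (((λ _ → 0ℤ) ⊛ f) n)) (⊛-zeroˡ f n)

  ⊛-identityˡ : ∀ f → constant 1ℤ ⊛ f ≋ f
  ⊛-identityˡ f zero    = ℤ.*-identityˡ (f 0)
  ⊛-identityˡ f (suc n) =
    trans (cong₂ ℤ._+_ (ℤ.*-identityˡ (f (suc n))) (⊛-zeroˡ f n)) (ℤ.+-identityʳ _)

  ℤ⟦X⟧ : CommutativeRing 0ℓ 0ℓ
  ℤ⟦X⟧ = record
    { Carrier = Series
    ; _≈_     = _≋_
    ; _+_     = _⊕_
    ; _*_     = _⊛_
    ; -_      = λ f n → ℤ.- f n
    ; 0#      = λ _ → 0ℤ
    ; 1#      = constant 1ℤ
    ; isCommutativeRing = record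
      { isRing = record
        { +-isAbelianGroup = record
          { isGroup = record
            { isMonoid = record
              { isSemigroup = record
                { isMagma = record
                  { isEquivalence = record
                    { refl  = λ _ → refl
                    ; sym   = λ e n → sym (e n)
                    ; trans = λ e e′ n → trans (e n) (e′ n)
                    }
                  ; ∙-cong = λ e e′ n → cong₂ ℤ._+_ (e n) (e′ n)
                  }
                ; assoc = λ f g h n → ℤ.+-assoc (f n) (g n) (h n)
                }
              ; identity = (λ f n → ℤ.+-identityˡ (f n)) , (λ f n → ℤ.+-identityʳ (f n))
              }
            ; inverse = (λ f n → ℤ.+-inverseˡ (f n)) , (λ f n → ℤ.+-inverseʳ (f n))
            ; ⁻¹-cong = λ e n → cong ℤ.-_ (e n)
            }
          ; comm = λ f g n → ℤ.+-comm (f n) (g n)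
          }
        ; *-cong     = ⊛-cong
        ; *-assoc    = ⊛-assoc
        ; *-identity = ⊛-identityˡ , λ f n → trans (⊛-comm f _ n) (⊛-identityˡ f n)
        ; distrib    = (λ h f g n → trans (⊛-comm h _ n) (trans (⊛-distribʳ h f g n)
                                     (cong₂ ℤ._+_ (⊛-comm f h n) (⊛-comm g h n))))
                       , ⊛-distribʳ
        }
      ; *-comm = ⊛-comm
      }
    }

  module S = CommutativeRing ℤ⟦X⟧
  open import Algebra.Properties.Semiring.Exp S.semiring public using (_^_; ^-congʳ)

  X : Series
  X zero          = 0ℤ
  X (suc zero)    = 1ℤ
  X (suc (suc _)) = 0ℤ

  X-suc : X ∘ suc ≋ constant 1ℤ
  X-suc zero    = refl
  X-suc (suc n) = refl

  X⊛-suc : ∀ f n → (X ⊛ f) (suc n) ≡ f n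
  X⊛-suc f n = trans (ℤ.+-identityˡ _) (trans (⊛-cong X-suc (λ _ → refl) n) (⊛-identityˡ f n))

  X^⊛-zero : ∀ k f → (X ^ suc k ⊛ f) 0 ≡ 0ℤ
  X^⊛-zero k f = ⊛-assoc X (X ^ k) f 0

  X^⊛-suc : ∀ k f n → (X ^ suc k ⊛ f) (suc n) ≡ (X ^ k ⊛ f) n
  X^⊛-suc k f n = trans (⊛-assoc X (X ^ k) f (suc n)) (X⊛-suc (X ^ k ⊛ f) n)

  -- geometric c k j is X ^ j / (1 - c X ^ (k + 1)).
  geometric : ℤ → ℕ → ℕ → Series
  geometric c k zero    zero    = 1ℤ
  -- The counter is the number of zeros before the next power of c. Resetting it to k puts these
  -- powers k + 1 places apart.
  geometric c k zero    (suc n) = c ℤ.* geometric c k k n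
  geometric c k (suc j) zero    = 0ℤ
  geometric c k (suc j) (suc n) = geometric c k j n

  geometric-shift : ∀ c k j → geometric c k j ≋ X ^ j ⊛ geometric c k 0
  geometric-shift c k zero    n       = sym (⊛-identityˡ _ n)
  geometric-shift c k (suc j) zero    = sym (X^⊛-zero j (geometric c k 0))
  geometric-shift c k (suc j) (suc n) = trans (geometric-shift c k j n) (sym (X^⊛-suc j (geometric c k 0) n))

  geometric-eq : ∀ c k n → geometric c k 0 n ≡ constant 1ℤ n ℤ.+ c ℤ.* (X ^ suc k ⊛ geometric c k 0) n
  geometric-eq c k zero    = sym (trans (cong (λ i → 1ℤ ℤ.+ c ℤ.* i) (X^⊛-zero k (geometric c k 0))) (cong (ℤ._+_ 1ℤ) (ℤ.*-zeroʳ c)))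
  geometric-eq c k (suc n) = sym (trans (ℤ.+-identityˡ _)
    (cong (c ℤ.*_) (trans (X^⊛-suc k (geometric c k 0) n) (sym (geometric-shift c k k n)))))

  divide : ℤ → ℕ → Series → Series
  divide c k f = f ⊛ geometric c k 0

  divide-eq : ∀ c k f n → divide c k f n ≡ f n ℤ.+ c ℤ.* (X ^ suc k ⊛ divide c k f) n
  divide-eq c k f n = begin
    (f ⊛ G) n ≡⟨ ⊛-cong (λ _ → refl) (geometric-eq c k) n ⟩
    (f ⊛ (constant 1ℤ ⊕ λ i → c ℤ.* (X ^ suc k ⊛ G) i)) n ≡⟨ S.distribˡ f _ _ n ⟩
    (f ⊛ constant 1ℤ) n ℤ.+ (f ⊛ λ i → c ℤ.* (X ^ suc k ⊛ G) i) n ≡⟨ cong₂ ℤ._+_ (S.*-identityʳ f n) (⊛-comm f _ n) ⟩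
    f n ℤ.+ ((λ i → c ℤ.* (X ^ suc k ⊛ G) i) ⊛ f) n ≡⟨ cong (ℤ._+_ (f n)) (⊛-scaleˡ c _ f n) ⟩
    f n ℤ.+ c ℤ.* (X ^ suc k ⊛ G ⊛ f) n ≡⟨ cong (λ i → f n ℤ.+ c ℤ.* i)
                                                                       (trans (⊛-assoc (X ^ suc k) G f n) (⊛-cong (λ _ → refl) (⊛-comm G f) n)) ⟩
    f n ℤ.+ c ℤ.* (X ^ suc k ⊛ (f ⊛ G)) n ∎
    where
    open ≡-Reasoning
    G = geometric c k 0

-- Generating functions of the two kinds of partitions

module GeneratingFunctions where

  open ≡ using (refl; sym; trans; cong; cong₂; module ≡-Reasoning)
  open PowerSeries
  open Antidiagonal ℤ⟦X⟧ using (∑; ∑-cong)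
  open QSeries ℤ⟦X⟧ using (module Hexagonal; module Base)
  open Hexagonal X using (p; p^-x^; powers; ∑-N; N)

  X^⊛-below : ∀ k f n → n ℕ.< k → (X ^ k ⊛ f) n ≡ 0ℤ
  X^⊛-below (suc k) f zero    _         = X^⊛-zero k f
  X^⊛-below (suc k) f (suc n) (s≤s n<k) = trans (X^⊛-suc k f n) (X^⊛-below k f n n<k)

  p^-suc : ∀ k → p ^ suc k ≋ X ^ suc (suc (k ℕ.+ k))
  p^-suc k n = trans (p^-x^ (suc k) n) (^-congʳ X (cong suc (ℕ.+-suc k k)) n)

  inv : ℕ → Series
  inv k = geometric 1ℤ (suc (k ℕ.+ k)) 0

  inverse : ∀ k → (S.1# S.- p ^ suc k) ⊛ inv k ≋ S.1#
  inverse k = begin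
    (S.1# S.- p ^ suc k) ⊛ inv k
      ≈⟨ S.trans (S.distribʳ (inv k) S.1# (S.- p ^ suc k))
                 (S.+-cong (S.*-identityˡ (inv k)) (S.sym (-‿distribˡ-* (p ^ suc k) (inv k)))) ⟩
    inv k S.- p ^ suc k ⊛ inv k
      ≈⟨ S.+-cong (λ n → trans (geometric-eq 1ℤ (suc (k ℕ.+ k)) n) (cong (ℤ._+_ (S.1# n)) (ℤ.*-identityˡ _)))
                  (S.-‿cong {p ^ suc k ⊛ inv k} {W} (S.*-congʳ {inv k} (p^-suc k))) ⟩
    (S.1# ⊕ W) S.- W
      ≈⟨ S.trans (S.+-assoc S.1# W (S.- W)) (S.trans (S.+-congˡ {S.1#} (S.-‿inverseʳ W)) (S.+-identityʳ S.1#)) ⟩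
    S.1# ∎
    where
    open import Relation.Binary.Reasoning.Setoid S.setoid
    open import Algebra.Properties.Ring S.ring using (-‿distribˡ-*)
    W = X ^ suc (suc (k ℕ.+ k)) ⊛ inv k

  open Base X inv inverse

  -- O m and O′ m count the overpartitions μ into even parts with sign (-1)^(number of parts):
  -- all those with parts ≤ 2m, and those with parts ≤ 2m+2 and no overlined 2m+2.
  mutual
    O O′ : ℕ → Series
    O zero    = constant 1ℤ
    O (suc m) = O′ m S.- X ^ suc (suc (m ℕ.+ m)) ⊛ O′ m
    O′ m = divide -1ℤ (suc (m ℕ.+ m)) (O m)

  odd : ℕ → ℕ
  odd m = suc (m ℕ.+ m)

  -- G m counts the partitions into the odd parts < 2m+1, each occurring a positive even
  -- number of times; T m allows in addition any number of parts 2m+1.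
  G T : ℕ → Series
  G zero    = constant 1ℤ
  -- The part 2m+1 contributes X⁴ᵐ⁺² / (1 - X⁴ᵐ⁺²); the index of `divide` is one less than the
  -- exponent.
  G (suc m) = divide 1ℤ (m ℕ.+ m ℕ.+ odd m) (X ^ (odd m ℕ.+ odd m) ⊛ G m)
  T m = divide 1ℤ (m ℕ.+ m) (G m)

  G-eq : ∀ m → G (suc m) ≋ X ^ (odd m ℕ.+ odd m) ⊛ (G m ⊕ G (suc m))
  G-eq m n = trans (divide-eq 1ℤ (m ℕ.+ m ℕ.+ odd m) (X ^ (odd m ℕ.+ odd m) ⊛ G m) n)
    (trans (cong (ℤ._+_ ((X ^ (odd m ℕ.+ odd m) ⊛ G m) n)) (ℤ.*-identityˡ _))
           (sym (S.distribˡ (X ^ (odd m ℕ.+ odd m)) (G m) (G (suc m)) n)))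

  T-eq : ∀ m → T m ≋ G m ⊕ X ^ odd m ⊛ T m
  T-eq m n = trans (divide-eq 1ℤ (m ℕ.+ m) (G m) n) (cong (ℤ._+_ (G m n)) (ℤ.*-identityˡ _))

  O′-eq : ∀ m n → O′ m n ≡ O m n ℤ.+ -1ℤ ℤ.* (X ^ suc (suc (m ℕ.+ m)) ⊛ O′ m) n
  O′-eq m = divide-eq -1ℤ (suc (m ℕ.+ m)) (O m)

  private
    -1⊛ : ∀ f n → -1ℤ ℤ.* f n ≡ (S.- S.1# ⊛ f) n
    -1⊛ f n = trans (ℤ.-1*i≡-i (f n)) (sym (-1*x≈-x f n))
      where open import Algebra.Properties.Ring S.ring using (-1*x≈-x)

  O⊛T≋F : ∀ m → O m ⊛ T m ≋ F m
  O⊛T≋F = Product.OT≈F O O′ G T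
    (λ _ → refl)
    (λ m n → trans (O′-eq m n) (cong (ℤ._+_ (O m n))
      (trans (-1⊛ (X ^ suc (suc (m ℕ.+ m)) ⊛ O′ m) n)
             (S.*-congˡ {S.- S.1#} (S.*-congʳ {O′ m} (S.sym (p^-suc m))) n))))
    (λ m → S.+-congˡ {O′ m} (S.-‿cong (S.*-congʳ {O′ m} (S.sym (p^-suc m)))))
    (λ _ → refl)
    (λ m → S.trans (G-eq m) (S.*-congʳ {G m ⊕ G (suc m)} (S.sym (p^-x^ (odd m)))))
    (λ m → S.trans (T-eq m) (S.+-congˡ {G m} (S.*-congʳ {T m} (S.*-congˡ {X} (S.sym (p^-x^ m))))))

  private
    n≤n*n : ∀ n → n ℕ.≤ n ℕ.* n
    n≤n*n zero    = z≤n
    n≤n*n (suc n) = ℕ.m≤m+n (suc n) (n ℕ.* suc n)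

  -- Since m² ≥ m and d(m + d) ≥ d, the power taken out of the remainder already has order at least
  -- m + d.
  err-below : ∀ m d n → n ℕ.< m ℕ.+ d → err m d n ≡ 0ℤ
  err-below m d n n<m+d =
    trans (S.*-congʳ {rest} (p^-x^ e) n)
          (X^⊛-below (e ℕ.+ e) rest n (ℕ.≤-trans n<m+d (ℕ.≤-trans m+d≤e (ℕ.m≤m+n e e))))
    where
    e = m ℕ.* m ℕ.+ d ℕ.* (m ℕ.+ d)
    rest = (S.1# ⊕ X ⊛ p ^ m) ⊛ poch m ⊛ J m ⊛ δ m d
    m+d≤e : m ℕ.+ d ℕ.≤ e
    m+d≤e = ℕ.+-mono-≤ (n≤n*n m) (ℕ.≤-trans (n≤n*n d) (ℕ.*-monoʳ-≤ d (ℕ.m≤n+m d m)))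

  ∑-below : ∀ k f n → (∀ i → i ℕ.< k → f i n ≡ 0ℤ) → ∑ k f n ≡ 0ℤ
  ∑-below zero    f n f≡0 = refl
  ∑-below (suc k) f n f≡0 =
    cong₂ ℤ._+_ (∑-below k f n (λ i i<k → f≡0 i (ℕ.m<n⇒m<1+n i<k))) (f≡0 k ℕ.≤-refl)

  -- With k - m terms kept in row m, every remainder has order at least m + (k - m) = k > n.
  ∑-O⊛T : ∀ k n → n ℕ.< k → ∑ k (λ m → O m ⊛ T m) n ≡ powers (latticeExponents< k) n
  ∑-O⊛T k n n<k = begin
    ∑ k (λ m → O m ⊛ T m) n ≡⟨ ∑-cong k O⊛T≋F n ⟩
    ∑ k F n ≡⟨ ∑-F k n ⟩
    ∑ k N n ℤ.+ ∑ k (λ m → err m (k ℕ.∸ m)) n ≡⟨ cong₂ ℤ._+_ (∑-N k n) (∑-below k (λ m → err m (k ℕ.∸ m)) n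
                                                          (λ m m<k → err-below m (k ℕ.∸ m) n
                                                            (ℕ.≤-trans n<k (ℕ.≤-reflexive (sym (ℕ.m+[n∸m]≡n (ℕ.<⇒≤ m<k))))))) ⟩
    powers (latticeExponents< k) n ℤ.+ 0ℤ ≡⟨ ℤ.+-identityʳ _ ⟩
    powers (latticeExponents< k) n ∎
    where open ≡-Reasoning

-- Lists without repetition and their weighted counts

record Enumerates {a p} {A : Set a} (P : A → Set p) (xs : List A) : Set (a ⊔ p) where
  field
    unique   : Unique xs
    sound    : ∀ {w} → w ∈ xs → P w
    complete : ∀ {w} → P w → w ∈ xs

module Enumeration {a} {A : Set a} where

  open ≡ using (refl; sym; trans; cong)
  open Enumerates

  enumerates-⇔ : ∀ {p q} {P : A → Set p} {Q : A → Set q} {xs} →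
                 (∀ {w} → P w → Q w) → (∀ {w} → Q w → P w) → Enumerates P xs → Enumerates Q xs
  enumerates-⇔ P⇒Q Q⇒P e = record
    { unique = unique e ; sound = P⇒Q ∘ sound e ; complete = complete e ∘ Q⇒P }

  enumerates-[] : ∀ {p} {P : A → Set p} → (∀ {w} → ¬ P w) → Enumerates P []
  enumerates-[] ¬P = record { unique = [] ; sound = λ () ; complete = λ p → ⊥-elim (¬P p) }

  enumerates-++ : ∀ {p q} {P : A → Set p} {Q : A → Set q} {xs ys} → (∀ {w} → P w → ¬ Q w) →
                  Enumerates P xs → Enumerates Q ys → Enumerates (λ w → P w ⊎ Q w) (xs ++ ys)
  enumerates-++ {P = P} {Q} {xs} P∩Q=∅ e e′ = record
    { unique   = Unique.++⁺ (unique e) (unique e′) λ (w∈ , w∈′) → P∩Q=∅ (sound e w∈) (sound e′ w∈′)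
    ; sound    = λ w∈ → split (∈-++⁻ xs w∈)
    ; complete = λ where
        (inj₁ p) → ∈-++⁺ˡ (complete e p)
        (inj₂ q) → ∈-++⁺ʳ xs (complete e′ q)
    }
    where
    split : ∀ {w} → w ∈ xs ⊎ w ∈ _ → P w ⊎ Q w
    split (inj₁ w∈) = inj₁ (sound e w∈)
    split (inj₂ w∈) = inj₂ (sound e′ w∈)

  enumerates-map : ∀ {b p} {B : Set b} {P : A → Set p} {xs} (f : A → B) → (∀ {v w} → f v ≡ f w → v ≡ w) →
                   Enumerates P xs → Enumerates (λ y → ∃[ w ] y ≡ f w × P w) (map f xs)
  enumerates-map f f-injective e = record
    { unique   = Unique.map⁺ f-injective (unique e)
    ; sound    = λ y∈ → let w , w∈ , y≡ = ∈-map⁻ f y∈ in w , y≡ , sound e w∈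
    ; complete = λ where (w , refl , p) → ∈-map⁺ f (complete e p)
    }

  -- `L (i - k)`, or nothing if i < k: the counterpart for lists of multiplication by Xᵏ.
  shift : ℕ → (ℕ → List A) → ℕ → List A
  shift zero    L i       = L i
  shift (suc k) L zero    = []
  shift (suc k) L (suc i) = shift k L i

  -- The hypothesis is confined to the one relevant i′, so that a bound on i′ obtained from i can
  -- enter its proof.
  enumerates-shift : ∀ {p} {P : A → Set p} (total : A → ℕ) k (L : ℕ → List A) i →
    (∀ i′ → k ℕ.+ i′ ≡ i → Enumerates (λ w → P w × total w ≡ i′) (L i′)) →
    Enumerates (λ w → P w × k ℕ.+ total w ≡ i) (shift k L i)
  enumerates-shift total zero    L i       e = e i refl
  enumerates-shift total (suc k) L zero    e = enumerates-[] λ ()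
  enumerates-shift total (suc k) L (suc i) e =
    enumerates-⇔ (λ (p , k+) → p , cong suc k+) (λ (p , k+) → p , ℕ.suc-injective k+)
      (enumerates-shift total k L i (λ i′ eq → e i′ (cong suc eq)))

  open PowerSeries using (Series; X; _⊛_; _^_; X^⊛-zero; X^⊛-suc; ⊛-identityˡ)

  ∑ᴸ : (A → ℤ) → List A → ℤ
  ∑ᴸ φ []       = 0ℤ
  ∑ᴸ φ (w ∷ ws) = φ w ℤ.+ ∑ᴸ φ ws

  ∑ᴸ-++ : ∀ φ xs ys → ∑ᴸ φ (xs ++ ys) ≡ ∑ᴸ φ xs ℤ.+ ∑ᴸ φ ys
  ∑ᴸ-++ φ []       ys = sym (ℤ.+-identityˡ _)
  ∑ᴸ-++ φ (x ∷ xs) ys = trans (cong (ℤ._+_ (φ x)) (∑ᴸ-++ φ xs ys)) (sym (ℤ.+-assoc (φ x) _ _))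

  ∑ᴸ-*ˡ : ∀ c φ xs → ∑ᴸ (λ w → c ℤ.* φ w) xs ≡ c ℤ.* ∑ᴸ φ xs
  ∑ᴸ-*ˡ c φ []       = sym (ℤ.*-zeroʳ c)
  ∑ᴸ-*ˡ c φ (x ∷ xs) = trans (cong (ℤ._+_ (c ℤ.* φ x)) (∑ᴸ-*ˡ c φ xs)) (sym (ℤ.*-distribˡ-+ c (φ x) (∑ᴸ φ xs)))

  ∑ᴸ-shift : ∀ φ (g : Series) k L i → (∀ i′ → k ℕ.+ i′ ≡ i → ∑ᴸ φ (L i′) ≡ g i′) →
             ∑ᴸ φ (shift k L i) ≡ (X ^ k ⊛ g) i
  ∑ᴸ-shift φ g zero    L i       e = trans (e i refl) (sym (⊛-identityˡ g i))
  ∑ᴸ-shift φ g (suc k) L zero    e = sym (X^⊛-zero k g)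
  ∑ᴸ-shift φ g (suc k) L (suc i) e =
    trans (∑ᴸ-shift φ g k L i (λ i′ eq → e i′ (cong suc eq))) (sym (X^⊛-suc k g i))

∑ᴸ-map : ∀ {a b} {A : Set a} {B : Set b} φ (f : B → A) xs →
         Enumeration.∑ᴸ φ (map f xs) ≡ Enumeration.∑ᴸ (φ ∘ f) xs
∑ᴸ-map φ f []       = ≡.refl
∑ᴸ-map φ f (x ∷ xs) = ≡.cong (ℤ._+_ (φ (f x))) (∑ᴸ-map φ f xs)

module Parity where

  open ≡ using (sym; trans; cong; subst)
  2∣m+m : ∀ m → 2 ∣ m ℕ.+ m
  2∣m+m m = divides m (trans (cong (m ℕ.+_) (sym (ℕ.+-identityʳ m))) (ℕ.*-comm 2 m))

  ¬2∣suc : ∀ {n} → 2 ∣ n → ¬ 2 ∣ suc n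
  ¬2∣suc {n} 2∣n 2∣1+n
    with ∣1⇒≡1 (∣m+n∣m⇒∣n (subst (2 ∣_) (ℕ.+-comm 1 n) 2∣1+n) 2∣n)
  ... | ()

-- Overpartitions into even parts

module Overpartitions where

  open ≡ using (refl; sym; trans; cong; cong₂; subst; _≢_)
  open Enumeration
  open GeneratingFunctions using (O; O′; O′-eq)
  open PowerSeries using (X; _⊛_; _^_; X^⊛-zero)
  open Parity

  top : ℕ → ℕ
  top m = suc (suc (m ℕ.+ m))

  top≡ : ∀ m → suc m ℕ.+ suc m ≡ top m
  top≡ m = cong suc (ℕ.+-suc m m)

  Over : ℕ → List MarkedPart → Set
  Over m μ = IsOverpartition μ × All (λ p → 2 ∣ size p × size p ℕ.≤ m ℕ.+ m) μ

  -- An overlined part is the first of its size, and 2m+2 is the largest size allowed, so an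
  -- overlined 2m+2 could only stand at the head.
  Over′ : ℕ → List MarkedPart → Set
  Over′ m μ = Over (suc m) μ × (∀ {μ′} → μ ≢ (top m , true) ∷ μ′)

  total : List MarkedPart → ℕ
  total μ = sum (map size μ)

  linked-bound : ∀ {x μ} → Linked MayPrecede (x ∷ μ) → All (λ y → size y ℕ.≤ size x) (x ∷ μ)
  linked-bound {x} l =
    Linked⇒All {R = _≥ₛ_} (λ {u} {v} {w} → ≥ₛ-trans {u} {v} {w}) {v = x} ℕ.≤-refl (Linked.map (λ {u} {v} → weaken {u} {v}) l)
    where
    _≥ₛ_ : MarkedPart → MarkedPart → Set
    u ≥ₛ v = size v ℕ.≤ size u
    ≥ₛ-trans : ∀ {u v w} → u ≥ₛ v → v ≥ₛ w → u ≥ₛ w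
    ≥ₛ-trans v≤u w≤v = ℕ.≤-trans w≤v v≤u
    weaken : ∀ {x y} → MayPrecede x y → size y ℕ.≤ size x
    weaken (inj₁ b<a)        = ℕ.<⇒≤ b<a
    weaken (inj₂ (refl , _)) = ℕ.≤-refl

  -- The former head, if it has the same size, must not be overlined. This is what `Over′` excludes,
  -- and the mark of the new part is free.
  over-∷ : ∀ m b {μ} → Over′ m μ → Over (suc m) ((top m , b) ∷ μ)
  over-∷ m b (((l , pos) , parts) , unmarked) =
    (link l parts unmarked , s≤s z≤n ∷ pos) ,
    (∣m∣n⇒∣m+n ∣-refl (2∣m+m m) , ℕ.≤-reflexive (sym (top≡ m))) ∷ parts
    where
    link : ∀ {μ} → Linked MayPrecede μ → All (λ p → 2 ∣ size p × size p ℕ.≤ suc m ℕ.+ suc m) μ →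
           (∀ {μ′} → μ ≢ (top m , true) ∷ μ′) → Linked MayPrecede ((top m , b) ∷ μ)
    link {[]}          l _                un = [-]
    link {(a , o) ∷ _} l ((_ , a≤) ∷ _) un with ℕ.m≤n⇒m<n∨m≡n (subst (a ℕ.≤_) (top≡ m) a≤)
    link {(a , o) ∷ _}     l _ un | inj₁ a<   = inj₁ a< ∷ l
    link {(a , false) ∷ _} l _ un | inj₂ a≡   = inj₂ (a≡ , refl) ∷ l
    link {(a , true) ∷ _}  l _ un | inj₂ refl = ⊥-elim (un refl)

  over-tail : ∀ m b {μ} → Over (suc m) ((top m , b) ∷ μ) → Over′ m μ
  over-tail m b ((l , _ ∷ pos) , _ ∷ parts) = ((Linked.tail l , pos) , parts) , unmarked l
    where
    unmarked : ∀ {μ} → Linked MayPrecede ((top m , b) ∷ μ) → ∀ {μ′} → μ ≢ (top m , true) ∷ μ′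
    unmarked (inj₁ top<top ∷ _)   refl = ℕ.<-irrefl refl top<top
    unmarked (inj₂ (_ , ()) ∷ _)  refl

  over-weaken : ∀ m {μ} → Over m μ → Over′ m μ
  over-weaken m (over , parts) =
    (over , All.map (λ (2∣ , ≤) → 2∣ , ℕ.≤-trans ≤ (ℕ.+-mono-≤ (ℕ.n≤1+n m) (ℕ.n≤1+n m))) parts) ,
    λ where refl → ℕ.<⇒≱ (s≤s (ℕ.n≤1+n _)) (proj₂ (All.head parts))

  ¬over-top : ∀ m {b μ} → ¬ Over m ((top m , b) ∷ μ)
  ¬over-top m (_ , (_ , top≤) ∷ _) = ℕ.<⇒≱ (s≤s (ℕ.n≤1+n _)) top≤

  even-≤ : ∀ m {a} → 2 ∣ a → a ℕ.< top m → a ℕ.≤ m ℕ.+ m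
  even-≤ m {a} 2∣a (s≤s a≤) with ℕ.m≤n⇒m<n∨m≡n a≤
  ... | inj₁ (s≤s a≤m+m) = a≤m+m
  ... | inj₂ refl        = ⊥-elim (¬2∣suc (2∣m+m m) 2∣a)

  -- The combinatorial form of O′ m = O m - X²ᵐ⁺² O′ m: either 2m+2 does not occur, or one copy that
  -- is not overlined can be removed.
  over′-split : ∀ m {μ} → Over′ m μ → Over m μ ⊎ (∃[ μ′ ] μ ≡ (top m , false) ∷ μ′ × Over′ m μ′)
  over′-split m {[]} _ = inj₁ (([] , []) , [])
  over′-split m {(a , o) ∷ μ} (over@((l , pos) , parts@((_ , a≤) ∷ _)) , un)
    with ℕ.m≤n⇒m<n∨m≡n (subst (a ℕ.≤_) (top≡ m) a≤)
  over′-split m {(a , o) ∷ μ} (over@((l , pos) , parts) , un) | inj₁ a< =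
    inj₁ ((l , pos) , All.zipWith (λ ((2∣ , _) , ≤a) → 2∣ , even-≤ m 2∣ (ℕ.≤-<-trans ≤a a<)) (parts , linked-bound l))
  over′-split m {(a , false) ∷ μ} (over , un) | inj₂ refl = inj₂ (μ , refl , over-tail m false over)
  over′-split m {(a , true) ∷ μ}  (over , un) | inj₂ refl = ⊥-elim (un refl)

  -- The combinatorial form of O (m+1) = O′ m - X²ᵐ⁺² O′ m. Removing the overlined 2m+2 leaves
  -- copies that cannot be overlined.
  over-split : ∀ m {μ} → Over (suc m) μ → Over′ m μ ⊎ (∃[ μ′ ] μ ≡ (top m , true) ∷ μ′ × Over′ m μ′)
  over-split m {[]}              over = inj₁ (over , λ ())
  over-split m {(a , false) ∷ μ} over = inj₁ (over , λ ())
  over-split m {(a , true) ∷ μ}  over with a ℕ.≟ top m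
  ... | yes refl = inj₂ (μ , refl , over-tail m true over)
  ... | no  a≢   = inj₁ (over , λ where refl → a≢ refl)

  over-zero : ∀ {μ} → Over 0 μ → μ ≡ []
  over-zero {[]}    _ = refl
  over-zero {_ ∷ _} ((_ , 0<a ∷ _) , (_ , a≤0) ∷ _) = ⊥-elim (ℕ.<⇒≱ 0<a a≤0)

  -- All elements of Over m (of Over′ m) of total i, provided that i is at most the fuel,
  -- the first argument.
  mutual
    overs overs′ : ℕ → ℕ → ℕ → List (List MarkedPart)
    overs f       zero    zero    = [] ∷ []
    overs f       zero    (suc i) = []
    overs zero    (suc m) i       = overs′ zero m i
    overs (suc f) (suc m) i       =
      overs′ (suc f) m i ++ map ((top m , true) ∷_) (shift (top m) (overs′ f m) i)
    overs′ zero    m i = overs zero m i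
    overs′ (suc f) m i =
      overs (suc f) m i ++ map ((top m , false) ∷_) (shift (top m) (overs′ f m) i)

  private
    -- Removing a positive amount lowers the total strictly, which pays for one unit of fuel.
    ≤-fuel : ∀ {k i i′ f} → suc k ℕ.+ i′ ≡ i → i ℕ.≤ suc f → i′ ℕ.≤ f
    ≤-fuel {k} {i′ = i′} refl (s≤s k+i′≤f) = ℕ.≤-trans (ℕ.m≤n+m i′ k) k+i′≤f

  mutual
    overs-enumerates : ∀ f m i → i ℕ.≤ f → Enumerates (λ μ → Over m μ × total μ ≡ i) (overs f m i)
    overs-enumerates f zero zero i≤f = record
      { unique   = [] ∷ []
      ; sound    = λ where (here refl) → (([] , []) , []) , refl
      ; complete = λ (over , _) → here (over-zero over)
      }
    overs-enumerates f zero (suc i) i≤f = enumerates-[] λ (over , t) → absurd (over-zero over) t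
      where
      absurd : ∀ {μ} → μ ≡ [] → total μ ≢ suc i
      absurd refl ()
    overs-enumerates zero (suc m) zero i≤f =
      enumerates-⇔ (λ ((over , _) , t) → over , t) back (overs′-enumerates zero m zero i≤f)
      where
      back : ∀ {μ} → Over (suc m) μ × total μ ≡ 0 → Over′ m μ × total μ ≡ 0
      back (over , t) with over-split m over
      ... | inj₁ over′          = over′ , t
      ... | inj₂ (_ , refl , _) = contradiction t λ ()
    overs-enumerates (suc f) (suc m) i i≤f =
      enumerates-⇔ forth back
        (enumerates-++ disjoint (overs′-enumerates (suc f) m i i≤f)
          (enumerates-map ((top m , true) ∷_) ∷-injectiveʳ (overs′-shift f m i i≤f)))
      where
      Marked : List MarkedPart → Set
      Marked μ = ∃[ μ′ ] μ ≡ (top m , true) ∷ μ′ × Over′ m μ′ × top m ℕ.+ total μ′ ≡ i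
      disjoint : ∀ {μ} → Over′ m μ × total μ ≡ i → ¬ Marked μ
      disjoint ((_ , un) , _) (_ , refl , _) = un refl
      forth : ∀ {μ} → (Over′ m μ × total μ ≡ i) ⊎ Marked μ → Over (suc m) μ × total μ ≡ i
      forth (inj₁ ((over , _) , t))         = over , t
      forth (inj₂ (_ , refl , over′ , t)) = over-∷ m true over′ , t
      back : ∀ {μ} → Over (suc m) μ × total μ ≡ i → (Over′ m μ × total μ ≡ i) ⊎ Marked μ
      back (over , t) with over-split m over
      ... | inj₁ over′                = inj₁ (over′ , t)
      ... | inj₂ (μ′ , refl , over′) = inj₂ (μ′ , refl , over′ , t)

    overs′-enumerates : ∀ f m i → i ℕ.≤ f → Enumerates (λ μ → Over′ m μ × total μ ≡ i) (overs′ f m i)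
    overs′-enumerates zero m zero i≤f =
      enumerates-⇔ (λ (over , t) → over-weaken m over , t) back (overs-enumerates zero m zero i≤f)
      where
      back : ∀ {μ} → Over′ m μ × total μ ≡ 0 → Over m μ × total μ ≡ 0
      back (over′ , t) with over′-split m over′
      ... | inj₁ over           = over , t
      ... | inj₂ (_ , refl , _) = contradiction t λ ()
    overs′-enumerates (suc f) m i i≤f =
      enumerates-⇔ forth back
        (enumerates-++ disjoint (overs-enumerates (suc f) m i i≤f)
          (enumerates-map ((top m , false) ∷_) ∷-injectiveʳ (overs′-shift f m i i≤f)))
      where
      Unmarked : List MarkedPart → Set
      Unmarked μ = ∃[ μ′ ] μ ≡ (top m , false) ∷ μ′ × Over′ m μ′ × top m ℕ.+ total μ′ ≡ i
      disjoint : ∀ {μ} → Over m μ × total μ ≡ i → ¬ Unmarked μ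
      disjoint (over , _) (_ , refl , _) = ¬over-top m over
      forth : ∀ {μ} → (Over m μ × total μ ≡ i) ⊎ Unmarked μ → Over′ m μ × total μ ≡ i
      forth (inj₁ (over , t))             = over-weaken m over , t
      forth (inj₂ (_ , refl , over′ , t)) = (over-∷ m false over′ , λ ()) , t
      back : ∀ {μ} → Over′ m μ × total μ ≡ i → (Over m μ × total μ ≡ i) ⊎ Unmarked μ
      back (over′ , t) with over′-split m over′
      ... | inj₁ over                 = inj₁ (over , t)
      ... | inj₂ (μ′ , refl , over′₁) = inj₂ (μ′ , refl , over′₁ , t)

    overs′-shift : ∀ f m i → i ℕ.≤ suc f →
      Enumerates (λ μ → Over′ m μ × top m ℕ.+ total μ ≡ i) (shift (top m) (overs′ f m) i)
    overs′-shift f m i i≤f =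
      enumerates-shift total (top m) (overs′ f m) i (λ i′ eq → overs′-enumerates f m i′ (≤-fuel eq i≤f))

  sign : List MarkedPart → ℤ
  sign μ = -1ℤ ℤ.^ length μ

  mutual
    -- The lists were built clause by clause after the recurrences of O and O′, so the signed count
    -- follows by the same induction.
    ∑-overs : ∀ f m i → i ℕ.≤ f → ∑ᴸ sign (overs f m i) ≡ O m i
    ∑-overs f zero zero    i≤f = refl
    ∑-overs f zero (suc i) i≤f = refl
    ∑-overs zero (suc m) zero i≤f =
      trans (∑-overs′ zero m zero i≤f)
        (sym (trans (cong (λ j → O′ m 0 ℤ.- j) (X^⊛-zero (suc (m ℕ.+ m)) (O′ m))) (ℤ.+-identityʳ (O′ m 0))))
    ∑-overs (suc f) (suc m) i i≤f = trans
      (∑ᴸ-++ sign (overs′ (suc f) m i) _)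
      (cong₂ ℤ._+_ (∑-overs′ (suc f) m i i≤f)
                   (trans (∑-shift true f m i i≤f) (ℤ.-1*i≡-i ((X ^ top m ⊛ O′ m) i))))

    ∑-overs′ : ∀ f m i → i ℕ.≤ f → ∑ᴸ sign (overs′ f m i) ≡ O′ m i
    ∑-overs′ zero m zero i≤f =
      trans (∑-overs zero m zero i≤f)
        (sym (trans (O′-eq m 0) (trans (cong (λ j → O m 0 ℤ.+ -1ℤ ℤ.* j) (X^⊛-zero (suc (m ℕ.+ m)) (O′ m)))
                                       (ℤ.+-identityʳ (O m 0)))))
    ∑-overs′ (suc f) m i i≤f = trans
      (∑ᴸ-++ sign (overs (suc f) m i) _)
      (trans (cong₂ ℤ._+_ (∑-overs (suc f) m i i≤f) (∑-shift false f m i i≤f)) (sym (O′-eq m i)))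

    -- An additional part changes the sign, overlined or not.
    ∑-shift : ∀ b f m i → i ℕ.≤ suc f →
      ∑ᴸ sign (map ((top m , b) ∷_) (shift (top m) (overs′ f m) i)) ≡ -1ℤ ℤ.* (X ^ top m ⊛ O′ m) i
    ∑-shift b f m i i≤f = trans
      (∑ᴸ-map sign ((top m , b) ∷_) (shift (top m) (overs′ f m) i))
      (trans (∑ᴸ-*ˡ -1ℤ sign (shift (top m) (overs′ f m) i))
             (cong (ℤ._*_ -1ℤ) (∑ᴸ-shift sign (O′ m) (top m) (overs′ f m) i
               (λ i′ eq → ∑-overs′ f m i′ (≤-fuel eq i≤f)))))

-- Partitions into odd parts with prescribed multiplicities

module OddPartitions where

  open ≡ using (refl; sym; trans; cong; cong₂; subst; _≢_; module ≡-Reasoning)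
  open Enumeration
  open GeneratingFunctions using (G; T; G-eq; T-eq; odd)
  open PowerSeries using (X; X^⊛-zero; _⊛_; _^_; module S)
  open Parity

  EvenBelow : ℕ → List ℕ → Set
  EvenBelow m ν = ∀ {k} → k ℕ.< odd m → ¬ 2 ∣ k → k ∈ ν × 2 ∣ multiplicity k ν

  -- These are the conditions on λ. They are counted by `T m`, and `Paired m`, where the part 2m+1
  -- is excluded, by `G m`.
  Capped : ℕ → List ℕ → Set
  Capped m ν = IsPartition ν × All (λ k → ¬ 2 ∣ k × k ℕ.≤ odd m) ν × EvenBelow m ν

  Paired : ℕ → List ℕ → Set
  Paired m ν = IsPartition ν × All (λ k → ¬ 2 ∣ k × k ℕ.< odd m) ν × EvenBelow m ν

  multiplicity-≡ : ∀ k ν → multiplicity k (k ∷ ν) ≡ suc (multiplicity k ν)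
  multiplicity-≡ k ν = cong length (filter-accept (k ℕ.≟_) refl)

  multiplicity-≢ : ∀ {k l} ν → k ≢ l → multiplicity k (l ∷ ν) ≡ multiplicity k ν
  multiplicity-≢ {k} ν k≢l = cong length (filter-reject (k ℕ.≟_) k≢l)

  multiplicity-absent : ∀ {k ν} → All (ℕ._< k) ν → multiplicity k ν ≡ 0
  multiplicity-absent         []          = refl
  multiplicity-absent {ν = _ ∷ ν} (l<k ∷ <k) =
    trans (multiplicity-≢ ν (ℕ.>⇒≢ l<k)) (multiplicity-absent <k)

  ¬2∣odd : ∀ m → ¬ 2 ∣ odd m
  ¬2∣odd m = ¬2∣suc (2∣m+m m)

  odd< : ∀ m → odd m ℕ.< odd (suc m)
  odd< m = s≤s (ℕ.≤-trans (ℕ.n≤1+n _) (ℕ.≤-reflexive (cong suc (sym (ℕ.+-suc m m)))))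

  odd-≤ : ∀ m {k} → ¬ 2 ∣ k → k ℕ.< odd (suc m) → k ℕ.≤ odd m
  odd-≤ m {k} ¬2∣k (s≤s k≤) with ℕ.m≤n⇒m<n∨m≡n k≤
  ... | inj₁ k< = ℕ.≤-pred (subst (k ℕ.<_) (cong suc (ℕ.+-suc m m)) k<)
  ... | inj₂ refl = ⊥-elim (¬2∣k (2∣m+m (suc m)))

  descending : ∀ {k ν} → Linked ℕ._≥_ (k ∷ ν) → All (ℕ._≤ k) (k ∷ ν)
  descending l = Linked⇒All (λ b≤a c≤b → ℕ.≤-trans c≤b b≤a) ℕ.≤-refl l

  linked-∷ : ∀ {k ν} → All (ℕ._≤ k) ν → Linked ℕ._≥_ ν → Linked ℕ._≥_ (k ∷ ν)
  linked-∷ []        _ = [-]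
  linked-∷ (l≤k ∷ _) l = l≤k ∷ l

  strip : ∀ {k l ν} → k ≢ l → k ∈ l ∷ ν × 2 ∣ multiplicity k (l ∷ ν) → k ∈ ν × 2 ∣ multiplicity k ν
  strip         k≢l (here k≡l , _)  = ⊥-elim (k≢l k≡l)
  strip {ν = ν} k≢l (there k∈ , 2∣) = k∈ , subst (2 ∣_) (multiplicity-≢ ν k≢l) 2∣

  unstrip : ∀ {k l ν} → k ≢ l → k ∈ ν × 2 ∣ multiplicity k ν → k ∈ l ∷ ν × 2 ∣ multiplicity k (l ∷ ν)
  unstrip {ν = ν} k≢l (k∈ , 2∣) = there k∈ , subst (2 ∣_) (sym (multiplicity-≢ ν k≢l)) 2∣

  evenBelow-tail : ∀ m {ν} → EvenBelow m (odd m ∷ ν) → EvenBelow m ν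
  evenBelow-tail m even k< ¬2∣k = strip (ℕ.<⇒≢ k<) (even k< ¬2∣k)

  evenBelow-∷ : ∀ m {ν} → EvenBelow m ν → EvenBelow m (odd m ∷ ν)
  evenBelow-∷ m even k< ¬2∣k = unstrip (ℕ.<⇒≢ k<) (even k< ¬2∣k)

  capped-∷ : ∀ m {ν} → Capped m ν → Capped m (odd m ∷ ν)
  capped-∷ m ((l , pos) , parts , even) =
    (linked-∷ (All.map proj₂ parts) l , s≤s z≤n ∷ pos) , (¬2∣odd m , ℕ.≤-refl) ∷ parts , evenBelow-∷ m even

  capped-tail : ∀ m {ν} → Capped m (odd m ∷ ν) → Capped m ν
  capped-tail m ((l , _ ∷ pos) , _ ∷ parts , even) = (Linked.tail l , pos) , parts , evenBelow-tail m even

  paired⇒capped : ∀ m {ν} → Paired m ν → Capped m ν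
  paired⇒capped m (partition , parts , even) = partition , All.map (λ (¬2∣ , <) → ¬2∣ , ℕ.<⇒≤ <) parts , even

  ¬paired-∷ : ∀ m {ν} → ¬ Paired m (odd m ∷ ν)
  ¬paired-∷ m (_ , (_ , odd<odd) ∷ _ , _) = ℕ.<-irrefl refl odd<odd

  capped-split : ∀ m {ν} → Capped m ν → Paired m ν ⊎ (∃[ ν′ ] ν ≡ odd m ∷ ν′ × Capped m ν′)
  capped-split m {[]} (partition , _ , even) = inj₁ (partition , [] , even)
  capped-split m {a ∷ ν} capped@((l , pos) , parts@((_ , a≤) ∷ _) , even) with ℕ.m≤n⇒m<n∨m≡n a≤
  ... | inj₂ refl = inj₂ (ν , refl , capped-tail m capped)
  ... | inj₁ a<   = inj₁ ((l , pos) , All.zipWith (λ ((¬2∣ , _) , ≤a) → ¬2∣ , ℕ.≤-<-trans ≤a a<) (parts , descending l) , even)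

  paired-zero : ∀ {ν} → Paired 0 ν → ν ≡ []
  paired-zero {[]} _ = refl
  paired-zero {_ ∷ _} ((_ , 0<a ∷ _) , (_ , a<1) ∷ _ , _) = ⊥-elim (ℕ.<⇒≱ 0<a (ℕ.≤-pred a<1))

  paired-[] : Paired 0 []
  paired-[] = ([] , []) , [] , λ where (s≤s z≤n) ¬2∣0 → ⊥-elim (¬2∣0 (divides 0 refl))

  -- The part 2m+1 is compulsory on one side and too large on the other.
  paired-disjoint : ∀ m {ν} → Paired m ν → ¬ Paired (suc m) ν
  paired-disjoint m (_ , parts , _) (_ , _ , even) =
    ℕ.<-irrefl refl (proj₂ (All.lookup parts (proj₁ (even (odd< m) (¬2∣odd m)))))

  paired-∷∷ : ∀ m {ν} → Paired m ν ⊎ Paired (suc m) ν → Paired (suc m) (odd m ∷ odd m ∷ ν)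
  paired-∷∷ m {ν} p = (linked , s≤s z≤n ∷ s≤s z≤n ∷ pos p) , (¬2∣odd m , odd< m) ∷ (¬2∣odd m , odd< m) ∷ parts p , even
    where
    pos : Paired m ν ⊎ Paired (suc m) ν → All (0 ℕ.<_) ν
    pos (inj₁ ((_ , pos) , _)) = pos
    pos (inj₂ ((_ , pos) , _)) = pos
    parts : Paired m ν ⊎ Paired (suc m) ν → All (λ k → ¬ 2 ∣ k × k ℕ.< odd (suc m)) ν
    parts (inj₁ (_ , parts , _)) = All.map (λ (¬2∣ , <) → ¬2∣ , ℕ.<-trans < (odd< m)) parts
    parts (inj₂ (_ , parts , _)) = parts
    tail-linked : Paired m ν ⊎ Paired (suc m) ν → Linked ℕ._≥_ ν
    tail-linked (inj₁ ((l , _) , _)) = l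
    tail-linked (inj₂ ((l , _) , _)) = l
    linked : Linked ℕ._≥_ (odd m ∷ odd m ∷ ν)
    linked = ℕ.≤-refl ∷ linked-∷ (All.map (λ (¬2∣ , <) → odd-≤ m ¬2∣ <) (parts p)) (tail-linked p)
    multiplicity-top : Paired m ν ⊎ Paired (suc m) ν → 2 ∣ multiplicity (odd m) ν
    multiplicity-top (inj₁ (_ , parts , _)) =
      subst (2 ∣_) (sym (multiplicity-absent (All.map proj₂ parts))) (divides 0 refl)
    multiplicity-top (inj₂ (_ , _ , even)) = proj₂ (even (odd< m) (¬2∣odd m))
    below : Paired m ν ⊎ Paired (suc m) ν → ∀ {k} → k ℕ.< odd m → ¬ 2 ∣ k → k ∈ ν × 2 ∣ multiplicity k ν
    below (inj₁ (_ , _ , even)) = even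
    below (inj₂ (_ , _ , even)) k< = even (ℕ.<-trans k< (odd< m))
    even : EvenBelow (suc m) (odd m ∷ odd m ∷ ν)
    even k< ¬2∣k with ℕ.m≤n⇒m<n∨m≡n (odd-≤ m ¬2∣k k<)
    ... | inj₁ k<odd = unstrip (ℕ.<⇒≢ k<odd) (unstrip (ℕ.<⇒≢ k<odd) (below p k<odd ¬2∣k))
    ... | inj₂ refl  = here refl ,
      subst (2 ∣_) (sym (trans (multiplicity-≡ (odd m) (odd m ∷ ν)) (cong suc (multiplicity-≡ (odd m) ν))))
            (∣m∣n⇒∣m+n ∣-refl (multiplicity-top p))

  -- The part 2m+1 has to occur and is the largest possible one, so it is the head; even
  -- multiplicity forces a second copy behind it. The remaining copies are again even in number, and
  -- the alternatives are that there are none or some.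
  paired-split : ∀ m {ν} → Paired (suc m) ν →
                 ∃[ ν′ ] ν ≡ odd m ∷ odd m ∷ ν′ × (Paired m ν′ ⊎ Paired (suc m) ν′)
  paired-split m {ν} ((l , pos) , parts , even) =
    split l pos (All.map (λ (¬2∣ , <) → ¬2∣ , odd-≤ m ¬2∣ <) parts) (proj₁ top) (proj₂ top)
      λ k< → even (ℕ.<-trans k< (odd< m))
    where
    top = even (odd< m) (¬2∣odd m)
    split : ∀ {ν} → Linked ℕ._≥_ ν → All (0 ℕ.<_) ν → All (λ k → ¬ 2 ∣ k × k ℕ.≤ odd m) ν →
            odd m ∈ ν → 2 ∣ multiplicity (odd m) ν → EvenBelow m ν →
            ∃[ ν′ ] ν ≡ odd m ∷ odd m ∷ ν′ × (Paired m ν′ ⊎ Paired (suc m) ν′)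
    split {a ∷ ν} l pos ((_ , a≤) ∷ parts) odd∈ 2∣ even
      with refl ← ℕ.≤-antisym a≤ (All.lookup (descending l) odd∈)
      = second ν l pos parts (subst (2 ∣_) (multiplicity-≡ (odd m) ν) 2∣) (evenBelow-tail m even)
      where
      third : ∀ ν → Linked ℕ._≥_ ν → All (0 ℕ.<_) ν → All (λ k → ¬ 2 ∣ k × k ℕ.≤ odd m) ν →
              2 ∣ multiplicity (odd m) ν → EvenBelow m ν → Paired m ν ⊎ Paired (suc m) ν
      third ν l pos parts 2∣ even with capped-split m ((l , pos) , parts , even)
      ... | inj₁ paired             = inj₁ paired
      ... | inj₂ (ν′ , refl , _) = inj₂ ((l , pos) , All.map (λ (¬2∣ , ≤) → ¬2∣ , ℕ.≤-<-trans ≤ (odd< m)) parts , even′)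
        where
        even′ : EvenBelow (suc m) (odd m ∷ ν′)
        even′ k< ¬2∣k with ℕ.m≤n⇒m<n∨m≡n (odd-≤ m ¬2∣k k<)
        ... | inj₁ k<odd = even k<odd ¬2∣k
        ... | inj₂ refl  = here refl , 2∣
      second : ∀ ν → Linked ℕ._≥_ (odd m ∷ ν) → All (0 ℕ.<_) (odd m ∷ ν) → All (λ k → ¬ 2 ∣ k × k ℕ.≤ odd m) ν →
               2 ∣ suc (multiplicity (odd m) ν) → EvenBelow m ν →
               ∃[ ν′ ] odd m ∷ ν ≡ odd m ∷ odd m ∷ ν′ × (Paired m ν′ ⊎ Paired (suc m) ν′)
      second ν l (_ ∷ pos) parts 2∣ even with capped-split m ((Linked.tail l , pos) , parts , even)
      -- Without a second copy the multiplicity would be 1.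
      ... | inj₁ (_ , parts′ , _) = ⊥-elim (¬2∣suc (divides 0 (multiplicity-absent (All.map proj₂ parts′))) 2∣)
      ... | inj₂ (ν′ , refl , ((l′ , pos′) , parts′ , even′)) =
        ν′ , refl , third ν′ l′ pos′ parts′
          (∣m+n∣m⇒∣n (subst (λ n → 2 ∣ suc n) (multiplicity-≡ (odd m) ν′) 2∣) ∣-refl) even′

  paireds cappeds : ℕ → ℕ → ℕ → List (List ℕ)
  paireds f       zero    zero    = [] ∷ []
  paireds f       zero    (suc i) = []
  -- The compulsory part 2m+1 makes the total positive, whereas fuel 0 admits only the total 0.
  paireds zero    (suc m) i       = []
  paireds (suc f) (suc m) i       =
    map (λ ν → odd m ∷ odd m ∷ ν)
        (shift (odd m ℕ.+ odd m) (paireds f m) i ++ shift (odd m ℕ.+ odd m) (paireds f (suc m)) i)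
  cappeds zero    m i = paireds zero m i
  cappeds (suc f) m i = paireds (suc f) m i ++ map (odd m ∷_) (shift (odd m) (cappeds f m) i)

  private
    ≤-fuel : ∀ {k i i′ f} → suc k ℕ.+ i′ ≡ i → i ℕ.≤ suc f → i′ ℕ.≤ f
    ≤-fuel {k} {i′ = i′} refl (s≤s k+i′≤f) = ℕ.≤-trans (ℕ.m≤n+m i′ k) k+i′≤f

  paireds-enumerates : ∀ f m i → i ℕ.≤ f → Enumerates (λ ν → Paired m ν × sum ν ≡ i) (paireds f m i)
  paireds-enumerates f zero zero i≤f = record
    { unique   = [] ∷ []
    ; sound    = λ where (here refl) → paired-[] , refl
    ; complete = λ (p , _) → here (paired-zero p)
    }
  paireds-enumerates f zero (suc i) i≤f = enumerates-[] λ (p , t) → absurd (paired-zero p) t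
    where
    absurd : ∀ {ν} → ν ≡ [] → sum ν ≢ suc i
    absurd refl ()
  paireds-enumerates zero (suc m) zero i≤f = enumerates-[] λ (p , t) → absurd (paired-split m p) t
    where
    absurd : ∀ {ν} → ∃[ ν′ ] ν ≡ odd m ∷ odd m ∷ ν′ × (Paired m ν′ ⊎ Paired (suc m) ν′) → sum ν ≢ 0
    absurd (_ , refl , _) ()
  paireds-enumerates (suc f) (suc m) i i≤f =
    enumerates-⇔ forth back
      (enumerates-map (λ ν → odd m ∷ odd m ∷ ν) (∷-injectiveʳ ∘ ∷-injectiveʳ)
        (enumerates-++ (λ (p , _) (p′ , _) → paired-disjoint m p p′)
          (enumerates-shift sum (odd m ℕ.+ odd m) (paireds f m) i (λ i′ eq → paireds-enumerates f m i′ (≤-fuel eq i≤f)))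
          (enumerates-shift sum (odd m ℕ.+ odd m) (paireds f (suc m)) i (λ i′ eq → paireds-enumerates f (suc m) i′ (≤-fuel eq i≤f)))))
    where
    Tail : List ℕ → Set
    Tail ν = (Paired m ν × (odd m ℕ.+ odd m) ℕ.+ sum ν ≡ i) ⊎ (Paired (suc m) ν × (odd m ℕ.+ odd m) ℕ.+ sum ν ≡ i)
    forth : ∀ {ν} → (∃[ ν′ ] ν ≡ odd m ∷ odd m ∷ ν′ × Tail ν′) → Paired (suc m) ν × sum ν ≡ i
    forth (ν′ , refl , inj₁ (p , t)) = paired-∷∷ m (inj₁ p) , trans (sym (ℕ.+-assoc (odd m) (odd m) (sum ν′))) t
    forth (ν′ , refl , inj₂ (p , t)) = paired-∷∷ m (inj₂ p) , trans (sym (ℕ.+-assoc (odd m) (odd m) (sum ν′))) t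
    back : ∀ {ν} → Paired (suc m) ν × sum ν ≡ i → ∃[ ν′ ] ν ≡ odd m ∷ odd m ∷ ν′ × Tail ν′
    back (p , t) with paired-split m p
    ... | ν′ , refl , inj₁ p′ = ν′ , refl , inj₁ (p′ , trans (ℕ.+-assoc (odd m) (odd m) (sum ν′)) t)
    ... | ν′ , refl , inj₂ p′ = ν′ , refl , inj₂ (p′ , trans (ℕ.+-assoc (odd m) (odd m) (sum ν′)) t)

  cappeds-enumerates : ∀ f m i → i ℕ.≤ f → Enumerates (λ ν → Capped m ν × sum ν ≡ i) (cappeds f m i)
  cappeds-enumerates zero m zero i≤f =
    enumerates-⇔ (λ (p , t) → paired⇒capped m p , t) back (paireds-enumerates zero m zero i≤f)
    where
    back : ∀ {ν} → Capped m ν × sum ν ≡ 0 → Paired m ν × sum ν ≡ 0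
    back (c , t) with capped-split m c
    ... | inj₁ p              = p , t
    ... | inj₂ (_ , refl , _) = contradiction t λ ()
  cappeds-enumerates (suc f) m i i≤f =
    enumerates-⇔ forth back
      (enumerates-++ disjoint (paireds-enumerates (suc f) m i i≤f)
        (enumerates-map (odd m ∷_) ∷-injectiveʳ
          (enumerates-shift sum (odd m) (cappeds f m) i (λ i′ eq → cappeds-enumerates f m i′ (≤-fuel eq i≤f)))))
    where
    Longer : List ℕ → Set
    Longer ν = ∃[ ν′ ] ν ≡ odd m ∷ ν′ × Capped m ν′ × odd m ℕ.+ sum ν′ ≡ i
    disjoint : ∀ {ν} → Paired m ν × sum ν ≡ i → ¬ Longer ν
    disjoint (p , _) (_ , refl , _) = ¬paired-∷ m p
    forth : ∀ {ν} → (Paired m ν × sum ν ≡ i) ⊎ Longer ν → Capped m ν × sum ν ≡ i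
    forth (inj₁ (p , t))            = paired⇒capped m p , t
    forth (inj₂ (_ , refl , c , t)) = capped-∷ m c , t
    back : ∀ {ν} → Capped m ν × sum ν ≡ i → (Paired m ν × sum ν ≡ i) ⊎ Longer ν
    back (c , t) with capped-split m c
    ... | inj₁ p                = inj₁ (p , t)
    ... | inj₂ (ν′ , refl , c′) = inj₂ (ν′ , refl , c′ , t)

  one : List ℕ → ℤ
  one _ = 1ℤ

  ∑-paireds : ∀ f m i → i ℕ.≤ f → ∑ᴸ one (paireds f m i) ≡ G m i
  ∑-paireds f zero zero    i≤f = refl
  ∑-paireds f zero (suc i) i≤f = refl
  ∑-paireds zero (suc m) zero i≤f = sym (trans (G-eq m 0) (X^⊛-zero (m ℕ.+ m ℕ.+ odd m) (G m S.+ G (suc m))))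
  ∑-paireds (suc f) (suc m) i i≤f = begin
    ∑ᴸ one (map (λ ν → odd m ∷ odd m ∷ ν) (xs ++ ys))
      ≡⟨ ∑ᴸ-map one (λ ν → odd m ∷ odd m ∷ ν) (xs ++ ys) ⟩
    ∑ᴸ one (xs ++ ys)
      ≡⟨ ∑ᴸ-++ one xs ys ⟩
    ∑ᴸ one xs ℤ.+ ∑ᴸ one ys
      ≡⟨ cong₂ ℤ._+_ (∑ᴸ-shift one (G m) w (paireds f m) i (λ i′ eq → ∑-paireds f m i′ (≤-fuel eq i≤f)))
                     (∑ᴸ-shift one (G (suc m)) w (paireds f (suc m)) i (λ i′ eq → ∑-paireds f (suc m) i′ (≤-fuel eq i≤f))) ⟩
    (X ^ w ⊛ G m) i ℤ.+ (X ^ w ⊛ G (suc m)) i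
      ≡⟨ S.distribˡ (X ^ w) (G m) (G (suc m)) i ⟨
    (X ^ w ⊛ (G m S.+ G (suc m))) i
      ≡⟨ G-eq m i ⟨
    G (suc m) i ∎
    where
    open ≡-Reasoning
    w = odd m ℕ.+ odd m
    xs = shift w (paireds f m) i
    ys = shift w (paireds f (suc m)) i

  ∑-cappeds : ∀ f m i → i ℕ.≤ f → ∑ᴸ one (cappeds f m i) ≡ T m i
  ∑-cappeds zero m zero i≤f =
    trans (∑-paireds zero m zero i≤f)
      (sym (trans (T-eq m 0) (trans (cong (ℤ._+_ (G m 0)) (X^⊛-zero (m ℕ.+ m) (T m))) (ℤ.+-identityʳ (G m 0)))))
  ∑-cappeds (suc f) m i i≤f = trans
    (∑ᴸ-++ one (paireds (suc f) m i) _)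
    (trans (cong₂ ℤ._+_ (∑-paireds (suc f) m i i≤f)
                        (trans (∑ᴸ-map one (odd m ∷_) (shift (odd m) (cappeds f m) i))
                               (∑ᴸ-shift one (T m) (odd m) (cappeds f m) i (λ i′ eq → ∑-cappeds f m i′ (≤-fuel eq i≤f)))))
           (sym (T-eq m i)))

-- Pairs of partitions and the signed sum over the number of parts

module Pairs where

  open ≡ using (refl; sym; trans; cong; cong₂; _≢_; module ≡-Reasoning)
  open Enumeration
  open Enumerates
  open Overpartitions using (Over; total; sign; overs; overs-enumerates; ∑-overs)
  open OddPartitions using (Capped; cappeds; cappeds-enumerates; ∑-cappeds)
  open GeneratingFunctions using (O; T)
  open PowerSeries using (Series; _⊛_)
  open Antidiagonal ℤ.+-*-commutativeRing using (∑; ∑-cong; ∑-+)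

  -- The recursion is that of `_⊛_`, so weighted counts of these lists are coefficients of a product
  -- of series.
  pairs : ∀ {a b} {A : Set a} {B : Set b} → (ℕ → List A) → (ℕ → List B) → ℕ → List (A × B)
  pairs xs ys zero    = cartesianProduct (xs 0) (ys 0)
  pairs xs ys (suc n) = cartesianProduct (xs 0) (ys (suc n)) ++ pairs (xs ∘ suc) ys n

  module _ {a b} {A : Set a} {B : Set b} where

    enumerates-× : ∀ {p q} {P : A → Set p} {Q : B → Set q} {xs ys} → Enumerates P xs → Enumerates Q ys →
                   Enumerates (λ (x , y) → P x × Q y) (cartesianProduct xs ys)
    enumerates-× {xs = xs} {ys} e e′ = record
      { unique   = Unique.cartesianProduct⁺ (unique e) (unique e′)
      ; sound    = λ xy∈ → let x∈ , y∈ = ∈-cartesianProduct⁻ xs ys xy∈ in sound e x∈ , sound e′ y∈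
      ; complete = λ (p , q) → ∈-cartesianProduct⁺ (complete e p) (complete e′ q)
      }

    -- The offset c records how often `xs` has been shifted in the recursion: after c shifts, `xs i`
    -- holds the elements of size c + i.
    enumerates-pairs : ∀ {p q} {P : A → Set p} {Q : B → Set q} (s : A → ℕ) (t : B → ℕ) c n {xs ys} →
      (∀ i → i ℕ.≤ n → Enumerates (λ x → P x × s x ≡ c ℕ.+ i) (xs i)) →
      (∀ i → i ℕ.≤ n → Enumerates (λ y → Q y × t y ≡ i) (ys i)) →
      Enumerates (λ (x , y) → (P x × Q y) × (∃[ i ] s x ≡ c ℕ.+ i × i ℕ.+ t y ≡ n)) (pairs xs ys n)
    enumerates-pairs s t c zero e e′ =
      enumerates-⇔ (λ ((p , s≡) , (q , t≡)) → (p , q) , 0 , s≡ , t≡)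
                   (λ where ((p , q) , zero , s≡ , t≡) → (p , s≡) , (q , t≡))
                   (enumerates-× (e 0 z≤n) (e′ 0 z≤n))
    enumerates-pairs {P = P} {Q} s t c (suc n) {xs} {ys} e e′ =
      enumerates-⇔ forth back
        (enumerates-++ disjoint
          (enumerates-× (e 0 z≤n) (e′ (suc n) ℕ.≤-refl))
          (enumerates-pairs s t (suc c) n
            (λ i i≤n → enumerates-⇔ (λ (p , s≡) → p , trans s≡ (ℕ.+-suc c i)) (λ (p , s≡) → p , trans s≡ (sym (ℕ.+-suc c i)))
                         (e (suc i) (s≤s i≤n)))
            (λ i i≤n → e′ i (ℕ.m≤n⇒m≤1+n i≤n))))
      where
      Here There Both : A × B → Set _
      Here (x , y) = (P x × s x ≡ c ℕ.+ 0) × (Q y × t y ≡ suc n)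
      There (x , y) = (P x × Q y) × (∃[ i ] s x ≡ suc c ℕ.+ i × i ℕ.+ t y ≡ n)
      Both (x , y) = (P x × Q y) × (∃[ i ] s x ≡ c ℕ.+ i × i ℕ.+ t y ≡ suc n)
      disjoint : ∀ {xy} → Here xy → ¬ There xy
      disjoint ((_ , s≡) , _) (_ , i , s≡′ , _) =
        ℕ.m≢1+m+n c (trans (sym (ℕ.+-identityʳ c)) (trans (sym s≡) s≡′))
      forth : ∀ {xy} → Here xy ⊎ There xy → Both xy
      forth (inj₁ ((p , s≡) , (q , t≡)))  = (p , q) , 0 , s≡ , t≡
      forth (inj₂ (pq , i , s≡ , t≡))     = pq , suc i , trans s≡ (sym (ℕ.+-suc c i)) , cong suc t≡
      back : ∀ {xy} → Both xy → Here xy ⊎ There xy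
      back ((p , q) , zero , s≡ , t≡) = inj₁ ((p , s≡) , (q , t≡))
      back (pq , suc i , s≡ , t≡)     = inj₂ (pq , i , trans s≡ (ℕ.+-suc c i) , ℕ.suc-injective t≡)

    ∑-cartesianProduct : ∀ (φ : A → ℤ) (xs : List A) (ys : List B) →
      ∑ᴸ (φ ∘ proj₁) (cartesianProduct xs ys) ≡ ∑ᴸ φ xs ℤ.* ∑ᴸ (λ _ → 1ℤ) ys
    ∑-cartesianProduct φ []       ys = sym (ℤ.*-zeroˡ (∑ᴸ (λ _ → 1ℤ) ys))
    ∑-cartesianProduct φ (x ∷ xs) ys = begin
      ∑ᴸ (φ ∘ proj₁) (map (x ,_) ys ++ cartesianProduct xs ys)
        ≡⟨ ∑ᴸ-++ (φ ∘ proj₁) (map (x ,_) ys) (cartesianProduct xs ys) ⟩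
      ∑ᴸ (φ ∘ proj₁) (map (x ,_) ys) ℤ.+ ∑ᴸ (φ ∘ proj₁) (cartesianProduct xs ys)
        ≡⟨ cong₂ ℤ._+_ (row ys) (∑-cartesianProduct φ xs ys) ⟩
      φ x ℤ.* ∑ᴸ (λ _ → 1ℤ) ys ℤ.+ ∑ᴸ φ xs ℤ.* ∑ᴸ (λ _ → 1ℤ) ys
        ≡⟨ ℤ.*-distribʳ-+ (∑ᴸ (λ _ → 1ℤ) ys) (φ x) (∑ᴸ φ xs) ⟨
      (φ x ℤ.+ ∑ᴸ φ xs) ℤ.* ∑ᴸ (λ _ → 1ℤ) ys ∎
      where
      open ≡-Reasoning
      row : ∀ ys → ∑ᴸ (φ ∘ proj₁) (map (x ,_) ys) ≡ φ x ℤ.* ∑ᴸ (λ _ → 1ℤ) ys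
      row []       = sym (ℤ.*-zeroʳ (φ x))
      row (y ∷ ys) = trans (cong (ℤ._+_ (φ x)) (row ys))
        (trans (cong (λ j → j ℤ.+ φ x ℤ.* ∑ᴸ (λ _ → 1ℤ) ys) (sym (ℤ.*-identityʳ (φ x))))
               (sym (ℤ.*-distribˡ-+ (φ x) 1ℤ (∑ᴸ (λ _ → 1ℤ) ys))))

    ∑-pairs : ∀ (φ : A → ℤ) (f g : Series) n {xs : ℕ → List A} {ys : ℕ → List B} →
      (∀ i → i ℕ.≤ n → ∑ᴸ φ (xs i) ≡ f i) → (∀ i → i ℕ.≤ n → ∑ᴸ (λ _ → 1ℤ) (ys i) ≡ g i) →
      ∑ᴸ (φ ∘ proj₁) (pairs xs ys n) ≡ (f ⊛ g) n
    ∑-pairs φ f g zero {xs} {ys} e e′ =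
      trans (∑-cartesianProduct φ (xs 0) (ys 0)) (cong₂ ℤ._*_ (e 0 z≤n) (e′ 0 z≤n))
    ∑-pairs φ f g (suc n) {xs} {ys} e e′ = trans
      (∑ᴸ-++ (φ ∘ proj₁) (cartesianProduct (xs 0) (ys (suc n))) (pairs (xs ∘ suc) ys n))
      (cong₂ ℤ._+_
        (trans (∑-cartesianProduct φ (xs 0) (ys (suc n))) (cong₂ ℤ._*_ (e 0 z≤n) (e′ (suc n) ℕ.≤-refl)))
        (∑-pairs φ (f ∘ suc) g n (λ i i≤n → e (suc i) (s≤s i≤n)) (λ i i≤n → e′ i (ℕ.m≤n⇒m≤1+n i≤n))))

  admissibles : ℕ → ℕ → List (List MarkedPart × List ℕ)
  admissibles m n = pairs (overs n m) (cappeds n m) n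

  admissibles-enumerates : ∀ m n →
    Enumerates (λ (μ , ν) → (Over m μ × Capped m ν) × total μ ℕ.+ sum ν ≡ n) (admissibles m n)
  admissibles-enumerates m n =
    enumerates-⇔ (λ where (oc , _ , refl , t) → oc , t) (λ (oc , t) → oc , _ , refl , t)
      (enumerates-pairs total sum 0 n (overs-enumerates n m) (cappeds-enumerates n m))

  ∑-admissibles : ∀ m n → ∑ᴸ (sign ∘ proj₁) (admissibles m n) ≡ (O m ⊛ T m) n
  ∑-admissibles m n = ∑-pairs sign (O m) (T m) n (∑-overs n m) (∑-cappeds n m)

  private
    2*≡ : ∀ m → 2 ℕ.* m ≡ m ℕ.+ m
    2*≡ m = cong (m ℕ.+_) (ℕ.+-identityʳ m)

  unpack : ∀ m j n {μν} → Admissible m j n μν →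
    ((Over m (proj₁ μν) × Capped m (proj₂ μν)) × total (proj₁ μν) ℕ.+ sum (proj₂ μν) ≡ n) × length (proj₁ μν) ≡ j
  unpack m j n ((over , parts , len) , (partition , parts′ , even) , t) rewrite 2*≡ m =
    (((over , parts) , (partition , parts′ , even)) , t) , len

  pack : ∀ m j n {μν} →
    ((Over m (proj₁ μν) × Capped m (proj₂ μν)) × total (proj₁ μν) ℕ.+ sum (proj₂ μν) ≡ n) × length (proj₁ μν) ≡ j →
    Admissible m j n μν
  pack m j n ((((over , parts) , (partition , parts′ , even)) , t) , len) rewrite 2*≡ m =
    (over , parts , len) , (partition , parts′ , even) , t

  -- Two lists without repetition that have the same members are permutations of each other, hence
  -- equally long.
  Q≡ : ∀ m j n → Q m j n ≡ length (filter (λ μν → length (proj₁ μν) ℕ.≟ j) (admissibles m n))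
  Q≡ m j n = ↭-length (∼bag⇒↭ (unique∧set⇒bag (admissiblePairs-unique m j n) (Unique.filter⁺ len? (unique e))
    (mk⇔ (λ x∈ → let s , len = unpack m j n (Equivalence.to (∈-admissiblePairs m j n _) x∈)
                 in ∈-filter⁺ len? (complete e s) len)
         (λ x∈ → let x∈′ , len = ∈-filter⁻ len? {xs = admissibles m n} x∈
                 in Equivalence.from (∈-admissiblePairs m j n _) (pack m j n (sound e x∈′ , len))))))
    where
    e = admissibles-enumerates m n
    len? = λ (μν : List MarkedPart × List ℕ) → length (proj₁ μν) ℕ.≟ j

  module _ {a} {A : Set a} (len : A → ℕ) where

    private
      kronecker : ℕ → ℕ → ℤ
      kronecker l j with l ℕ.≟ j
      ... | yes _ = 1ℤ
      ... | no  _ = 0ℤ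

      kronecker-≡ : ∀ l → kronecker l l ≡ 1ℤ
      kronecker-≡ l with l ℕ.≟ l
      ... | yes _  = refl
      ... | no l≢l = contradiction refl l≢l

      kronecker-≢ : ∀ {l j} → l ≢ j → kronecker l j ≡ 0ℤ
      kronecker-≢ {l} {j} l≢j with l ℕ.≟ j
      ... | yes l≡j = contradiction l≡j l≢j
      ... | no _    = refl

      ∑-kronecker-≥ : ∀ (f : ℕ → ℤ) l k → k ℕ.≤ l → ∑ k (λ j → f j ℤ.* kronecker l j) ≡ 0ℤ
      ∑-kronecker-≥ f l zero    _   = refl
      ∑-kronecker-≥ f l (suc k) k<l = cong₂ ℤ._+_ (∑-kronecker-≥ f l k (ℕ.<⇒≤ k<l))
        (trans (cong (ℤ._*_ (f k)) (kronecker-≢ (ℕ.>⇒≢ k<l))) (ℤ.*-zeroʳ (f k)))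

      ∑-kronecker : ∀ (f : ℕ → ℤ) l k → l ℕ.< k → ∑ k (λ j → f j ℤ.* kronecker l j) ≡ f l
      ∑-kronecker f l (suc k) (s≤s l≤k) with ℕ.m≤n⇒m<n∨m≡n l≤k
      ... | inj₁ l<k = trans (cong₂ ℤ._+_ (∑-kronecker f l k l<k)
              (trans (cong (ℤ._*_ (f k)) (kronecker-≢ (ℕ.<⇒≢ l<k))) (ℤ.*-zeroʳ (f k)))) (ℤ.+-identityʳ (f l))
      ... | inj₂ refl = trans (cong₂ ℤ._+_ (∑-kronecker-≥ f l k ℕ.≤-refl)
              (trans (cong (ℤ._*_ (f k)) (kronecker-≡ l)) (ℤ.*-identityʳ (f k)))) (ℤ.+-identityˡ (f k))

      filter-∷ : ∀ j x xs → ℤ.+ length (filter (λ y → len y ℕ.≟ j) (x ∷ xs)) ≡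
                            kronecker (len x) j ℤ.+ ℤ.+ length (filter (λ y → len y ℕ.≟ j) xs)
      filter-∷ j x xs = by-cases (len x ℕ.≟ j)
        where
        n = ℤ.+ length (filter (λ y → len y ℕ.≟ j) xs)
        by-cases : Dec (len x ≡ j) → ℤ.+ length (filter (λ y → len y ℕ.≟ j) (x ∷ xs)) ≡ kronecker (len x) j ℤ.+ n
        by-cases (yes refl) = trans (cong (λ ys → ℤ.+ length ys) (filter-accept (λ y → len y ℕ.≟ j) refl))
                                    (cong (λ i → i ℤ.+ n) (sym (kronecker-≡ j)))
        by-cases (no l≢j)   = trans (cong (λ ys → ℤ.+ length ys) (filter-reject (λ y → len y ℕ.≟ j) l≢j))
                                    (trans (sym (ℤ.+-identityˡ n)) (cong (λ i → i ℤ.+ n) (sym (kronecker-≢ l≢j))))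

    -- Each x is counted for exactly one j, namely `len x`, and the hypothesis puts this j inside
    -- the range of summation.
    ∑-filter : ∀ (f : ℕ → ℤ) k xs → (∀ {x} → x ∈ xs → len x ℕ.< k) →
      ∑ k (λ j → f j ℤ.* ℤ.+ length (filter (λ y → len y ℕ.≟ j) xs)) ≡ ∑ᴸ (f ∘ len) xs
    ∑-filter f k []       _  = zeros k
      where
      zeros : ∀ k → ∑ k (λ j → f j ℤ.* 0ℤ) ≡ 0ℤ
      zeros zero    = refl
      zeros (suc k) = cong₂ ℤ._+_ (zeros k) (ℤ.*-zeroʳ (f k))
    ∑-filter f k (x ∷ xs) lt = begin
      ∑ k (λ j → f j ℤ.* ℤ.+ length (filter (λ y → len y ℕ.≟ j) (x ∷ xs)))
        ≡⟨ ∑-cong k (λ j → trans (cong (ℤ._*_ (f j)) (filter-∷ j x xs)) (ℤ.*-distribˡ-+ (f j) (kronecker (len x) j) (ℤ.+ length (filter (λ y → len y ℕ.≟ j) xs)))) ⟩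
      ∑ k (λ j → f j ℤ.* kronecker (len x) j ℤ.+ f j ℤ.* ℤ.+ length (filter (λ y → len y ℕ.≟ j) xs))
        ≡⟨ ∑-+ k (λ j → f j ℤ.* kronecker (len x) j) (λ j → f j ℤ.* ℤ.+ length (filter (λ y → len y ℕ.≟ j) xs)) ⟩
      ∑ k (λ j → f j ℤ.* kronecker (len x) j) ℤ.+ ∑ k (λ j → f j ℤ.* ℤ.+ length (filter (λ y → len y ℕ.≟ j) xs))
        ≡⟨ cong₂ ℤ._+_ (∑-kronecker f (len x) k (lt (here refl))) (∑-filter f k xs (lt ∘ there)) ⟩
      f (len x) ℤ.+ ∑ᴸ (f ∘ len) xs ∎
      where open ≡-Reasoning

  -- The parts of μ are positive, so there are at most n < k of them, and the cut-off of j at k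
  -- loses nothing.
  ∑-Q : ∀ k m n → n ℕ.< k → ∑ k (λ j → -1ℤ ℤ.^ j ℤ.* ℤ.+ Q m j n) ≡ (O m ⊛ T m) n
  ∑-Q k m n n<k = begin
    ∑ k (λ j → -1ℤ ℤ.^ j ℤ.* ℤ.+ Q m j n)
      ≡⟨ ∑-cong k (λ j → cong (λ l → -1ℤ ℤ.^ j ℤ.* ℤ.+ l) (Q≡ m j n)) ⟩
    ∑ k (λ j → -1ℤ ℤ.^ j ℤ.* ℤ.+ length (filter (λ μν → length (proj₁ μν) ℕ.≟ j) (admissibles m n)))
      ≡⟨ ∑-filter (length ∘ proj₁) (-1ℤ ℤ.^_) k (admissibles m n) short ⟩
    ∑ᴸ (sign ∘ proj₁) (admissibles m n)
      ≡⟨ ∑-admissibles m n ⟩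
    (O m ⊛ T m) n ∎
    where
    open ≡-Reasoning
    short : ∀ {μν} → μν ∈ admissibles m n → length (proj₁ μν) ℕ.< k
    short {μ , ν} μν∈ =
      let ((((_ , pos) , _) , _) , t) = sound (admissibles-enumerates m n) μν∈
      in ℕ.≤-<-trans (ℕ.≤-trans (length≤sum size pos) (ℕ.≤-trans (ℕ.m≤m+n (total μ) (sum ν)) (ℕ.≤-reflexive t))) n<k

-- The terms of the two series on the right-hand side

-- The expansion of (k - l)², with the mixed term moved to the left so that no subtraction of
-- natural numbers occurs.
∣⊖∣-square : ∀ k l → ∣ k ⊖ l ∣ ℕ.^ 2 ℕ.+ (k ℕ.* l ℕ.+ k ℕ.* l) ≡ k ℕ.* k ℕ.+ l ℕ.* l
∣⊖∣-square zero    zero    = ≡.refl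
∣⊖∣-square zero    (suc l) = lemma l
  where
  lemma : ∀ l → suc l ℕ.* (suc l ℕ.* 1) ℕ.+ 0 ≡ suc l ℕ.* suc l
  lemma = solve-∀
∣⊖∣-square (suc k) zero    = lemma k
  where
  lemma : ∀ k → suc k ℕ.* (suc k ℕ.* 1) ℕ.+ (suc k ℕ.* 0 ℕ.+ suc k ℕ.* 0) ≡ suc k ℕ.* suc k ℕ.+ 0
  lemma = solve-∀
∣⊖∣-square (suc k) (suc l) = begin
  ∣ suc k ⊖ suc l ∣ ℕ.^ 2 ℕ.+ (suc k ℕ.* suc l ℕ.+ suc k ℕ.* suc l)
    ≡⟨ ≡.cong (λ i → ∣ i ∣ ℕ.^ 2 ℕ.+ (suc k ℕ.* suc l ℕ.+ suc k ℕ.* suc l)) (ℤ.[1+m]⊖[1+n]≡m⊖n k l) ⟩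
  d ℕ.+ (suc k ℕ.* suc l ℕ.+ suc k ℕ.* suc l)
    ≡⟨ expand d k l ⟩
  d ℕ.+ (k ℕ.* l ℕ.+ k ℕ.* l) ℕ.+ (k ℕ.+ k ℕ.+ (l ℕ.+ l) ℕ.+ 2)
    ≡⟨ ≡.cong (ℕ._+ (k ℕ.+ k ℕ.+ (l ℕ.+ l) ℕ.+ 2)) (∣⊖∣-square k l) ⟩
  k ℕ.* k ℕ.+ l ℕ.* l ℕ.+ (k ℕ.+ k ℕ.+ (l ℕ.+ l) ℕ.+ 2)
    ≡⟨ collect k l ⟩
  suc k ℕ.* suc k ℕ.+ suc l ℕ.* suc l ∎
  where
  open ≡.≡-Reasoning
  d = ∣ k ⊖ l ∣ ℕ.^ 2
  expand : ∀ d k l → d ℕ.+ (suc k ℕ.* suc l ℕ.+ suc k ℕ.* suc l)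
                     ≡ d ℕ.+ (k ℕ.* l ℕ.+ k ℕ.* l) ℕ.+ (k ℕ.+ k ℕ.+ (l ℕ.+ l) ℕ.+ 2)
  expand = solve-∀
  collect : ∀ k l → k ℕ.* k ℕ.+ l ℕ.* l ℕ.+ (k ℕ.+ k ℕ.+ (l ℕ.+ l) ℕ.+ 2) ≡ suc k ℕ.* suc k ℕ.+ suc l ℕ.* suc l
  collect = solve-∀

hex : ℕ → ℕ → ℕ
hex k l = k ℕ.* k ℕ.+ k ℕ.* l ℕ.+ l ℕ.* l

-- With n = k + l and j = k - l, 3n² + j² is four times the hexagonal form.
even-exponent : ∀ k l → 3 ℕ.* (k ℕ.+ l) ℕ.^ 2 ℕ.+ ∣ (k ℕ.+ k) ⊖ (k ℕ.+ l) ∣ ℕ.^ 2 ≡ 4 ℕ.* hex k l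
even-exponent k l = ℕ.+-cancelʳ-≡ (k ℕ.* l ℕ.+ k ℕ.* l) _ _ (begin
  3 ℕ.* (k ℕ.+ l) ℕ.^ 2 ℕ.+ ∣ (k ℕ.+ k) ⊖ (k ℕ.+ l) ∣ ℕ.^ 2 ℕ.+ (k ℕ.* l ℕ.+ k ℕ.* l)
    ≡⟨ ≡.cong (λ i → 3 ℕ.* (k ℕ.+ l) ℕ.^ 2 ℕ.+ ∣ i ∣ ℕ.^ 2 ℕ.+ (k ℕ.* l ℕ.+ k ℕ.* l)) (ℤ.+-cancelˡ-⊖ k k l) ⟩
  3 ℕ.* (k ℕ.+ l) ℕ.^ 2 ℕ.+ ∣ k ⊖ l ∣ ℕ.^ 2 ℕ.+ (k ℕ.* l ℕ.+ k ℕ.* l)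
    ≡⟨ ℕ.+-assoc (3 ℕ.* (k ℕ.+ l) ℕ.^ 2) _ _ ⟩
  3 ℕ.* (k ℕ.+ l) ℕ.^ 2 ℕ.+ (∣ k ⊖ l ∣ ℕ.^ 2 ℕ.+ (k ℕ.* l ℕ.+ k ℕ.* l))
    ≡⟨ ≡.cong (3 ℕ.* (k ℕ.+ l) ℕ.^ 2 ℕ.+_) (∣⊖∣-square k l) ⟩
  3 ℕ.* (k ℕ.+ l) ℕ.^ 2 ℕ.+ (k ℕ.* k ℕ.+ l ℕ.* l)
    ≡⟨ identity k l ⟩
  4 ℕ.* hex k l ℕ.+ (k ℕ.* l ℕ.+ k ℕ.* l) ∎)
  where
  open ≡.≡-Reasoning
  identity : ∀ k l → 3 ℕ.* ((k ℕ.+ l) ℕ.* ((k ℕ.+ l) ℕ.* 1)) ℕ.+ (k ℕ.* k ℕ.+ l ℕ.* l)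
                     ≡ 4 ℕ.* (k ℕ.* k ℕ.+ k ℕ.* l ℕ.+ l ℕ.* l) ℕ.+ (k ℕ.* l ℕ.+ k ℕ.* l)
  identity = solve-∀

-- Here n = k + l + 1 and j = k - l. Compared with `even-exponent`, 3n² has grown by 3(2(k + l) +
-- 1).
odd-exponent : ∀ k l → 3 ℕ.* suc (k ℕ.+ l) ℕ.^ 2 ℕ.+ ∣ suc (k ℕ.+ k) ⊖ suc (k ℕ.+ l) ∣ ℕ.^ 2
                       ≡ 4 ℕ.* hex k l ℕ.+ (6 ℕ.* (k ℕ.+ l) ℕ.+ 3)
odd-exponent k l = begin
  3 ℕ.* suc (k ℕ.+ l) ℕ.^ 2 ℕ.+ ∣ suc (k ℕ.+ k) ⊖ suc (k ℕ.+ l) ∣ ℕ.^ 2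
    ≡⟨ ≡.cong (λ i → 3 ℕ.* suc (k ℕ.+ l) ℕ.^ 2 ℕ.+ ∣ i ∣ ℕ.^ 2) (ℤ.[1+m]⊖[1+n]≡m⊖n (k ℕ.+ k) (k ℕ.+ l)) ⟩
  3 ℕ.* suc (k ℕ.+ l) ℕ.^ 2 ℕ.+ d
    ≡⟨ expand k l d ⟩
  3 ℕ.* (k ℕ.+ l) ℕ.^ 2 ℕ.+ d ℕ.+ (6 ℕ.* (k ℕ.+ l) ℕ.+ 3)
    ≡⟨ ≡.cong (ℕ._+ (6 ℕ.* (k ℕ.+ l) ℕ.+ 3)) (even-exponent k l) ⟩
  4 ℕ.* hex k l ℕ.+ (6 ℕ.* (k ℕ.+ l) ℕ.+ 3) ∎
  where
  open ≡.≡-Reasoning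
  d = ∣ (k ℕ.+ k) ⊖ (k ℕ.+ l) ∣ ℕ.^ 2
  expand : ∀ k l d → 3 ℕ.* (suc (k ℕ.+ l) ℕ.* (suc (k ℕ.+ l) ℕ.* 1)) ℕ.+ d
                     ≡ 3 ℕ.* ((k ℕ.+ l) ℕ.* ((k ℕ.+ l) ℕ.* 1)) ℕ.+ d ℕ.+ (6 ℕ.* (k ℕ.+ l) ℕ.+ 3)
  expand = solve-∀

module Theta {c ℓ} (R : CommutativeRing c ℓ) where

  open CommutativeRing R hiding (zero)
  open import Algebra.Properties.Semiring.Exp semiring
  open import Algebra.Properties.CommutativeSemiring.Exp commutativeSemiring using (^-distrib-*)
  open Antidiagonal R
  open QSeries R using (module Hexagonal)
  open IntegerCoefficients R
  open Solver
  open import Relation.Binary.Reasoning.Setoid setoid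

  ∑-as-∑diag : ∀ n h → ∑ (suc n) h ≈ ∑diag (λ i _ → h i) n
  ∑-as-∑diag zero    h = +-identityˡ _
  ∑-as-∑diag (suc n) h = trans (∑-suc (suc n) h) (+-congˡ (∑-as-∑diag n (λ i → h (suc i))))

  ∑-parity : ∀ n f → ∑ (suc (n ℕ.+ n)) f ≈ ∑ (suc n) (λ i → f (i ℕ.+ i)) + ∑ n (λ i → f (suc (i ℕ.+ i)))
  ∑-parity zero    f = sym (+-identityʳ _)
  ∑-parity (suc n) f = begin
    ∑ (suc (suc n ℕ.+ suc n)) f
      ≡⟨ ≡.cong (λ k → ∑ (suc k) f) (≡.cong suc (ℕ.+-suc n n)) ⟩
    ∑ (suc (n ℕ.+ n)) f + f (suc (n ℕ.+ n)) + f (suc (suc (n ℕ.+ n)))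
      ≈⟨ +-congʳ (+-congʳ (∑-parity n f)) ⟩
    ∑ (suc n) (λ i → f (i ℕ.+ i)) + ∑ n (λ i → f (suc (i ℕ.+ i))) + f (suc (n ℕ.+ n)) + f (suc (suc (n ℕ.+ n)))
      ≈⟨ solve 4 (λ a b c d → a :+ b :+ c :+ d := (a :+ d) :+ (b :+ c)) refl _ _ _ _ ⟩
    (∑ (suc n) (λ i → f (i ℕ.+ i)) + f (suc (suc (n ℕ.+ n)))) + ∑ (suc n) (λ i → f (suc (i ℕ.+ i)))
      ≡⟨ ≡.cong (λ k → (∑ (suc n) (λ i → f (i ℕ.+ i)) + f (suc k)) + ∑ (suc n) (λ i → f (suc (i ℕ.+ i)))) (ℕ.+-suc n n) ⟨
    ∑ (suc (suc n)) (λ i → f (i ℕ.+ i)) + ∑ (suc n) (λ i → f (suc (i ℕ.+ i))) ∎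

  module _ (x z : Carrier) (z*z≈x : z * z ≈ x) where

    open Hexagonal x using (p; q; low; N)

    z^double : ∀ n → z ^ (2 ℕ.* n) ≈ x ^ n
    z^double n = trans (sym (^-assocʳ z 2 n)) (^-congˡ n (trans (*-congˡ (*-identityʳ z)) z*z≈x))

    z^quadruple : ∀ n → z ^ (4 ℕ.* n) ≈ p ^ n
    z^quadruple n = begin
      z ^ (4 ℕ.* n) ≡⟨ ≡.cong (z ^_) (ℕ.*-assoc 2 2 n) ⟩
      z ^ (2 ℕ.* (2 ℕ.* n)) ≈⟨ z^double (2 ℕ.* n) ⟩
      x ^ (2 ℕ.* n) ≈⟨ ^-assocʳ x 2 n ⟨
      (x ^ 2) ^ n ≈⟨ ^-congˡ n (*-congˡ (*-identityʳ x)) ⟩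
      p ^ n ∎

    theta : ℕ → Carrier
    theta n = ∑ (suc (2 ℕ.* n)) (λ i → z ^ (∣ i ⊖ n ∣ ℕ.^ 2))

    -- One factor z is split off and the remaining even power is written in x and p, so the sign
    -- change under z ↦ -z can be read off.
    odds : ℕ → Carrier
    odds zero    = 0#
    odds (suc n) = ∑diag (λ k l → z * (p ^ hex k l * x ^ (3 ℕ.* (k ℕ.+ l) ℕ.+ 1))) n

    z^-odd : ∀ a b → z ^ (4 ℕ.* a ℕ.+ (6 ℕ.* b ℕ.+ 3)) ≈ z * (p ^ a * x ^ (3 ℕ.* b ℕ.+ 1))
    z^-odd a b = begin
      z ^ (4 ℕ.* a ℕ.+ (6 ℕ.* b ℕ.+ 3)) ≡⟨ ≡.cong (z ^_) (lemma a b) ⟩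
      z * z ^ (4 ℕ.* a ℕ.+ 2 ℕ.* (3 ℕ.* b ℕ.+ 1)) ≈⟨ *-congˡ (^-homo-* z (4 ℕ.* a) _) ⟩
      z * (z ^ (4 ℕ.* a) * z ^ (2 ℕ.* (3 ℕ.* b ℕ.+ 1))) ≈⟨ *-congˡ (*-cong (z^quadruple a) (z^double (3 ℕ.* b ℕ.+ 1))) ⟩
      z * (p ^ a * x ^ (3 ℕ.* b ℕ.+ 1)) ∎
      where
      lemma : ∀ a b → 4 ℕ.* a ℕ.+ (6 ℕ.* b ℕ.+ 3) ≡ suc (4 ℕ.* a ℕ.+ 2 ℕ.* (3 ℕ.* b ℕ.+ 1))
      lemma = solve-∀

    -- With j = i - n the parity of i decides. An even i = 2k gives j = k - l with k + l = n; an odd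
    -- i = 2k + 1 gives j = k - l with k + l = n - 1.
    theta-split : ∀ n → z ^ (3 ℕ.* n ℕ.^ 2) * theta n ≈ ∑diag q n + odds n
    theta-split n = begin
      z ^ (3 ℕ.* n ℕ.^ 2) * theta n
        ≈⟨ ∑-*ˡ (suc (2 ℕ.* n)) _ _ ⟨
      ∑ (suc (2 ℕ.* n)) g
        ≡⟨ ≡.cong (λ k → ∑ (suc (n ℕ.+ k)) g) (ℕ.+-identityʳ n) ⟩
      ∑ (suc (n ℕ.+ n)) g
        ≈⟨ ∑-parity n g ⟩
      ∑ (suc n) (λ i → g (i ℕ.+ i)) + ∑ n (λ i → g (suc (i ℕ.+ i)))
        ≈⟨ +-cong (trans (∑-as-∑diag n _) (∑diag-cong n even)) (odd n) ⟩
      ∑diag q n + odds n ∎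
      where
      g : ℕ → Carrier
      g i = z ^ (3 ℕ.* n ℕ.^ 2) * z ^ (∣ i ⊖ n ∣ ℕ.^ 2)
      even : ∀ k l → k ℕ.+ l ≡ n → g (k ℕ.+ k) ≈ q k l
      even k l ≡.refl = trans (sym (^-homo-* z (3 ℕ.* n ℕ.^ 2) _))
        (trans (^-congʳ z (even-exponent k l)) (z^quadruple (hex k l)))
      odd : ∀ n → ∑ n (λ i → z ^ (3 ℕ.* n ℕ.^ 2) * z ^ (∣ suc (i ℕ.+ i) ⊖ n ∣ ℕ.^ 2)) ≈ odds n
      odd zero    = refl
      odd (suc n) = trans (∑-as-∑diag n _) (∑diag-cong n λ where
        k l ≡.refl → trans (sym (^-homo-* z (3 ℕ.* suc (k ℕ.+ l) ℕ.^ 2) _))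
          (trans (^-congʳ z (odd-exponent k l)) (z^-odd (hex k l) (k ℕ.+ l))))

    z^2n+1 : ∀ n → z ^ (2 ℕ.* n ℕ.+ 1) ≈ z * x ^ n
    z^2n+1 n = trans (^-congʳ z (ℕ.+-comm (2 ℕ.* n) 1)) (*-congˡ (z^double n))

    odds-low : ∀ n → z ^ (2 ℕ.* n ℕ.+ 1) * odds n ≈ low n
    odds-low zero    = zeroʳ _
    odds-low (suc n) = begin
      z ^ (2 ℕ.* suc n ℕ.+ 1) * odds (suc n)
        ≈⟨ trans (*-congʳ (z^2n+1 (suc n))) (sym (∑diag-*ˡ n _ _)) ⟩
      ∑diag (λ k l → z * x ^ suc n * (z * (p ^ hex k l * x ^ (3 ℕ.* (k ℕ.+ l) ℕ.+ 1)))) n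
        ≈⟨ ∑diag-cong n term ⟩
      ∑diag (λ k l → x * p ^ suc (n ℕ.+ n) * q k l) n
        ≈⟨ ∑diag-*ˡ n _ q ⟩
      low (suc n) ∎
      where
      open Hexagonal x using (p^-x^)
      term : ∀ k l → k ℕ.+ l ≡ n → z * x ^ suc n * (z * (p ^ hex k l * x ^ (3 ℕ.* (k ℕ.+ l) ℕ.+ 1)))
                                   ≈ x * p ^ suc (n ℕ.+ n) * q k l
      term k l ≡.refl = begin
        z * x ^ suc n * (z * (p ^ hex k l * x ^ (3 ℕ.* n ℕ.+ 1)))
          ≈⟨ solve 4 (λ z a b c → z :* a :* (z :* (b :* c)) := (z :* z) :* (a :* c) :* b) refl _ _ _ _ ⟩
        z * z * (x ^ suc n * x ^ (3 ℕ.* n ℕ.+ 1)) * q k l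
          ≈⟨ *-congʳ (*-cong z*z≈x (trans (sym (^-homo-* x (suc n) _)) (trans (^-congʳ x (exponent n)) (sym (p^-x^ (suc (n ℕ.+ n))))))) ⟩
        x * p ^ suc (n ℕ.+ n) * q k l ∎
        where
        exponent : ∀ n → suc n ℕ.+ (3 ℕ.* n ℕ.+ 1) ≡ suc (n ℕ.+ n) ℕ.+ suc (n ℕ.+ n)
        exponent = solve-∀

    term⁺ : ℕ → Carrier
    term⁺ n = z ^ (3 ℕ.* n ℕ.^ 2) * (1# + x ^ (2 ℕ.* n ℕ.+ 1)) * (1# + z ^ (2 ℕ.* n ℕ.+ 1)) * theta n

    term⁺-split : ∀ n → term⁺ n ≈ (1# + x ^ (2 ℕ.* n ℕ.+ 1)) *
                        (∑diag q n + low n + (odds n + z ^ (2 ℕ.* n ℕ.+ 1) * ∑diag q n))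
    term⁺-split n = begin
      term⁺ n
        ≈⟨ solve 4 (λ a b c d → a :* b :* c :* d := b :* (c :* (a :* d))) refl _ _ _ _ ⟩
      (1# + x ^ (2 ℕ.* n ℕ.+ 1)) * ((1# + z ^ (2 ℕ.* n ℕ.+ 1)) * (z ^ (3 ℕ.* n ℕ.^ 2) * theta n))
        ≈⟨ *-congˡ (*-congˡ (theta-split n)) ⟩
      (1# + x ^ (2 ℕ.* n ℕ.+ 1)) * ((1# + z ^ (2 ℕ.* n ℕ.+ 1)) * (∑diag q n + odds n))
        ≈⟨ *-congˡ (solve 3 (λ y a o → (con (+ 1) :+ y) :* (a :+ o) := a :+ y :* o :+ (o :+ y :* a)) refl _ _ _) ⟩
      (1# + x ^ (2 ℕ.* n ℕ.+ 1)) *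
        (∑diag q n + z ^ (2 ℕ.* n ℕ.+ 1) * odds n + (odds n + z ^ (2 ℕ.* n ℕ.+ 1) * ∑diag q n))
        ≈⟨ *-congˡ (+-congʳ (+-congˡ (odds-low n))) ⟩
      _ ∎

    N≈ : ∀ n → N n ≈ (1# + x ^ (2 ℕ.* n ℕ.+ 1)) * (∑diag q n + low n)
    N≈ n = *-congʳ (+-congˡ (begin
      x * p ^ n ≈⟨ *-congˡ (p^-x^ n) ⟩
      x ^ suc (n ℕ.+ n) ≈⟨ ^-congʳ x (exponent n) ⟩
      x ^ (2 ℕ.* n ℕ.+ 1) ∎))
      where
      open Hexagonal x using (p^-x^)
      exponent : ∀ n → suc (n ℕ.+ n) ≡ 2 ℕ.* n ℕ.+ 1
      exponent = solve-∀

  module _ (x z : Carrier) (z*z≈x : z * z ≈ x) where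

    open Hexagonal x using (p; q; low; N)
    open import Algebra.Properties.Ring ring using (-‿distribˡ-*; -1*x≈-x)

    -z*-z≈x : - z * - z ≈ x
    -z*-z≈x = trans (solve 1 (λ z → (:- z) :* (:- z) := z :* z) refl z) z*z≈x

    -- Replacing z by -z changes the sign of the terms of odd degree in z.
    term⁺-even : ∀ n → term⁺ x z z*z≈x n + term⁺ x (- z) -z*-z≈x n ≈ N n + N n
    term⁺-even n = begin
      term⁺ x z z*z≈x n + term⁺ x (- z) -z*-z≈x n
        ≈⟨ +-cong (term⁺-split x z z*z≈x n) (term⁺-split x (- z) -z*-z≈x n) ⟩
      e * (a + (odds x z z*z≈x n + z ^ (2 ℕ.* n ℕ.+ 1) * ∑diag q n))
        + e * (a + (odds x (- z) -z*-z≈x n + (- z) ^ (2 ℕ.* n ℕ.+ 1) * ∑diag q n))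
        ≈⟨ +-congˡ (*-congˡ (+-congˡ (+-cong (odds-neg n) (*-congʳ z^-neg)))) ⟩
      e * (a + (odds x z z*z≈x n + z ^ (2 ℕ.* n ℕ.+ 1) * ∑diag q n))
        + e * (a + (- odds x z z*z≈x n + (- z ^ (2 ℕ.* n ℕ.+ 1)) * ∑diag q n))
        ≈⟨ solve 5 (λ e a o y b → e :* (a :+ (o :+ y :* b)) :+ e :* (a :+ (:- o :+ (:- y) :* b)) := e :* a :+ e :* a) refl _ _ _ _ _ ⟩
      e * a + e * a
        ≈⟨ +-cong (N≈ x z z*z≈x n) (N≈ x z z*z≈x n) ⟨
      N n + N n ∎
      where
      e = 1# + x ^ (2 ℕ.* n ℕ.+ 1)
      a = ∑diag q n + low n
      z^-neg : (- z) ^ (2 ℕ.* n ℕ.+ 1) ≈ - z ^ (2 ℕ.* n ℕ.+ 1)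
      z^-neg = trans (z^2n+1 x (- z) -z*-z≈x n) (trans (sym (-‿distribˡ-* z _)) (-‿cong (sym (z^2n+1 x z z*z≈x n))))
      odds-neg : ∀ n → odds x (- z) -z*-z≈x n ≈ - odds x z z*z≈x n
      odds-neg zero    = solve 0 (con (+ 0) := :- con (+ 0)) refl
      odds-neg (suc n) = trans
        (∑diag-cong n λ k l _ → solve 2 (λ z a → (:- z) :* a := con (-[1+ 0 ]) :* (z :* a)) refl z
          (p ^ hex k l * x ^ (3 ℕ.* (k ℕ.+ l) ℕ.+ 1)))
        (trans (∑diag-*ˡ n (- 1#) _) (-1*x≈-x _))

    -1^double : ∀ n → (- 1#) ^ (2 ℕ.* n) ≈ 1#
    -1^double n = begin
      (- 1#) ^ (2 ℕ.* n) ≈⟨ ^-assocʳ (- 1#) 2 n ⟨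
      ((- 1#) ^ 2) ^ n ≈⟨ ^-congˡ n (solve 0 (con (-[1+ 0 ]) :* (con (-[1+ 0 ]) :* con (+ 1)) := con (+ 1)) refl) ⟩
      1# ^ n ≈⟨ 1^ n ⟩
      1# ∎
      where
      1^ : ∀ n → 1# ^ n ≈ 1#
      1^ zero    = refl
      1^ (suc n) = trans (*-identityˡ _) (1^ n)

    -1^-+double : ∀ k n → (- 1#) ^ (k ℕ.+ 2 ℕ.* n) ≈ (- 1#) ^ k
    -1^-+double k n = trans (^-homo-* (- 1#) k _) (trans (*-congˡ (-1^double n)) (*-identityʳ _))

    -1^square : ∀ n → (- 1#) ^ (n ℕ.^ 2) ≈ (- 1#) ^ n
    -1^square zero    = refl
    -1^square (suc n) = begin
      (- 1#) ^ (suc n ℕ.^ 2) ≈⟨ ^-congʳ (- 1#) (exponent n) ⟩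
      (- 1#) ^ (suc (n ℕ.^ 2) ℕ.+ 2 ℕ.* n) ≈⟨ -1^-+double (suc (n ℕ.^ 2)) n ⟩
      - 1# * (- 1#) ^ (n ℕ.^ 2) ≈⟨ *-congˡ (-1^square n) ⟩
      (- 1#) ^ suc n ∎
      where
      exponent : ∀ n → suc n ℕ.* (suc n ℕ.* 1) ≡ suc (n ℕ.* (n ℕ.* 1)) ℕ.+ 2 ℕ.* n
      exponent = solve-∀

    -z^ : ∀ k → (- z) ^ k ≈ (- 1#) ^ k * z ^ k
    -z^ k = trans (^-congˡ k (sym (-1*x≈-x z))) (^-distrib-* (- 1#) z k)

    term⁻ : ℕ → Carrier
    term⁻ n = (- 1#) ^ n * z ^ (3 ℕ.* n ℕ.^ 2) * (1# + x ^ (2 ℕ.* n ℕ.+ 1)) * (1# - z ^ (2 ℕ.* n ℕ.+ 1)) *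
              ∑ (suc (2 ℕ.* n)) (λ i → (- 1#) ^ ∣ i ⊖ n ∣ * z ^ (∣ i ⊖ n ∣ ℕ.^ 2))

    -- The signs agree because 3n² has the parity of n, j² that of |j|, and 2n + 1 is odd.
    term⁻≈ : ∀ n → term⁻ n ≈ term⁺ x (- z) -z*-z≈x n
    term⁻≈ n = sym (*-cong (*-cong (*-congʳ cube) linear) (∑-cong (suc (2 ℕ.* n)) square))
      where
      cube : (- z) ^ (3 ℕ.* n ℕ.^ 2) ≈ (- 1#) ^ n * z ^ (3 ℕ.* n ℕ.^ 2)
      cube = trans (-z^ (3 ℕ.* n ℕ.^ 2)) (*-congʳ (begin
        (- 1#) ^ (3 ℕ.* n ℕ.^ 2) ≈⟨ ^-congʳ (- 1#) (exponent (n ℕ.^ 2)) ⟩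
        (- 1#) ^ (n ℕ.^ 2 ℕ.+ 2 ℕ.* n ℕ.^ 2) ≈⟨ -1^-+double (n ℕ.^ 2) (n ℕ.^ 2) ⟩
        (- 1#) ^ (n ℕ.^ 2) ≈⟨ -1^square n ⟩
        (- 1#) ^ n ∎))
        where
        exponent : ∀ a → 3 ℕ.* a ≡ a ℕ.+ 2 ℕ.* a
        exponent = solve-∀
      linear : 1# + (- z) ^ (2 ℕ.* n ℕ.+ 1) ≈ 1# - z ^ (2 ℕ.* n ℕ.+ 1)
      linear = +-congˡ (trans (z^2n+1 x (- z) -z*-z≈x n)
        (trans (sym (-‿distribˡ-* z _)) (-‿cong (sym (z^2n+1 x z z*z≈x n)))))
      square : ∀ i → (- z) ^ (∣ i ⊖ n ∣ ℕ.^ 2) ≈ (- 1#) ^ ∣ i ⊖ n ∣ * z ^ (∣ i ⊖ n ∣ ℕ.^ 2)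
      square i = trans (-z^ (∣ i ⊖ n ∣ ℕ.^ 2)) (*-congʳ (-1^square ∣ i ⊖ n ∣))

    term⁺+term⁻ : ∀ n → term⁺ x z z*z≈x n + term⁻ n ≈ N n + N n
    term⁺+term⁻ n = trans (+-congˡ (term⁻≈ n)) (term⁺-even n)

-- Order, squares and powers in the real field

module Reals {c ℓ₁ ℓ₂} (ℝ : RealField c ℓ₁ ℓ₂) where

  open RealField ℝ public using
    (_<_; _#_; commutativeRing; isStrictPartialOrder; #⇔<; +-monoˡ-<; *-pos; 0<1; archimedean;
     complete; #⇒invertible; invertible⇒#; #-cotrans; IsCauchy; IsLimit; _·_)
  open CommutativeRing commutativeRing public hiding (zero)
  open IsStrictPartialOrder isStrictPartialOrder public
    using (<-respˡ-≈; <-respʳ-≈) renaming (trans to <-trans; irrefl to <-irrefl)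
  open import Algebra.Properties.Semiring.Exp semiring public
  open import Algebra.Properties.Semiring.Mult semiring public using (×1-homo-*)
  open IntegerCoefficients commutativeRing
  open Solver

  <-≈ : ∀ {x x′ y y′} → x ≈ x′ → y ≈ y′ → x < y → x′ < y′
  <-≈ x≈ y≈ x<y = <-respˡ-≈ x≈ (<-respʳ-≈ y≈ x<y)

  <⇒0<- : ∀ {x y} → x < y → 0# < y - x
  <⇒0<- {x} x<y = <-respˡ-≈ (-‿inverseʳ x) (+-monoˡ-< (- x) x<y)

  0<-⇒< : ∀ {x y} → 0# < y - x → x < y
  0<-⇒< {x} {y} 0<y-x = <-≈ (+-identityˡ x) (solve 2 (λ x y → y :- x :+ x := y) refl x y) (+-monoˡ-< x 0<y-x)

  0<⇒< : ∀ {d x y} → 0# < d → d ≈ y - x → x < y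
  0<⇒< 0<d d≈ = 0<-⇒< (<-respʳ-≈ d≈ 0<d)

  +-pos : ∀ {x y} → 0# < x → 0# < y → 0# < x + y
  +-pos {x} {y} 0<x 0<y = <-trans 0<y (<-respˡ-≈ (+-identityˡ y) (+-monoˡ-< y 0<x))

  +-mono-< : ∀ {a b c d} → a < b → c < d → a + c < b + d
  +-mono-< {a} {b} {c} {d} a<b c<d = 0<⇒< (+-pos (<⇒0<- a<b) (<⇒0<- c<d))
    (solve 4 (λ a b c d → (b :- a) :+ (d :- c) := (b :+ d) :- (a :+ c)) refl a b c d)

  neg-< : ∀ {x y} → x < y → - y < - x
  neg-< {x} {y} x<y = 0<⇒< (<⇒0<- x<y) (solve 2 (λ x y → y :- x := (:- x) :- (:- y)) refl x y)

  -- Inherited from the cotransitivity of apartness; it does the work of trichotomy in the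
  -- comparisons below.
  <-cotrans : ∀ {x y} → x < y → ∀ z → x < z ⊎ z < y
  <-cotrans {x} {y} x<y z with #-cotrans (Equivalence.from (#⇔< x y) (inj₁ x<y)) z
  ... | inj₁ x#z with Equivalence.to (#⇔< x z) x#z
  ...   | inj₁ x<z = inj₁ x<z
  ...   | inj₂ z<x = inj₂ (<-trans z<x x<y)
  <-cotrans {x} {y} x<y z | inj₂ z#y with Equivalence.to (#⇔< z y) z#y
  ...   | inj₁ z<y = inj₂ z<y
  ...   | inj₂ y<z = inj₁ (<-trans x<y y<z)

  *-monoˡ-< : ∀ {a x y} → 0# < a → x < y → a * x < a * y
  *-monoˡ-< {a} {x} {y} 0<a x<y = 0<⇒< (*-pos 0<a (<⇒0<- x<y))
    (solve 3 (λ a x y → a :* (y :- x) := a :* y :- a :* x) refl a x y)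

  *-monoʳ-< : ∀ {a x y} → 0# < a → x < y → x * a < y * a
  *-monoʳ-< {a} {x} {y} 0<a x<y = <-≈ (*-comm a x) (*-comm a y) (*-monoˡ-< 0<a x<y)

  *-mono-< : ∀ {a b c d} → 0# < b → 0# < c → a < b → c < d → a * c < b * d
  *-mono-< 0<b 0<c a<b c<d = <-trans (*-monoʳ-< 0<c a<b) (*-monoˡ-< 0<b c<d)

  private
    x-0≈x : ∀ x → x - 0# ≈ x
    x-0≈x x = solve 1 (λ x → x :- con (+ 0) := x) refl x

    neg-pos : ∀ {x} → x < 0# → 0# < - x
    neg-pos x<0 = <-respˡ-≈ (solve 0 (:- con (+ 0) := con (+ 0)) refl) (neg-< x<0)

  invert : ∀ {x} → x < 0# ⊎ 0# < x → ∃[ y ] x * y ≈ 1#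
  invert {x} x≶0 =
    let y , _ , xy≈1 = #⇒invertible (Equivalence.from (#⇔< x 0#) x≶0)
    in y , trans (*-congʳ (sym (x-0≈x x))) xy≈1

  invertible⇒≶0 : ∀ {x y} → x * y ≈ 1# → x < 0# ⊎ 0# < x
  invertible⇒≶0 {x} {y} xy≈1 = Equivalence.to (#⇔< x 0#) (invertible⇒#
    (y , trans (*-congˡ (x-0≈x x)) (trans (*-comm y x) xy≈1) , trans (*-congʳ (x-0≈x x)) xy≈1))

  inverse-pos : ∀ {x} → 0# < x → ∃[ y ] 0# < y × x * y ≈ 1#
  inverse-pos {x} 0<x with invert (inj₂ 0<x)
  ... | y , xy≈1 with invertible⇒≶0 (trans (*-comm y x) xy≈1)
  ...   | inj₂ 0<y = y , 0<y , xy≈1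
  ...   | inj₁ y<0 = ⊥-elim (<-irrefl refl (<-trans 0<1
            (<-≈ (trans (*-comm y x) xy≈1) (zeroˡ x) (*-monoʳ-< 0<x y<0))))

  *-cancel-pos : ∀ {a b} → 0# < a → 0# < a * b → 0# < b
  *-cancel-pos {a} {b} 0<a 0<ab =
    let y , 0<y , ay≈1 = inverse-pos 0<a in
    <-respʳ-≈ (trans (solve 3 (λ y a b → y :* (a :* b) := a :* y :* b) refl y a b) (trans (*-congʳ ay≈1) (*-identityˡ b)))
              (*-pos 0<y 0<ab)

  *-cancelʳ-< : ∀ {a x y} → 0# < a → x * a < y * a → x < y
  *-cancelʳ-< {a} {x} {y} 0<a xa<ya = 0<-⇒< (*-cancel-pos 0<a
    (<-respʳ-≈ (solve 3 (λ a x y → y :* a :- x :* a := a :* (y :- x)) refl a x y) (<⇒0<- xa<ya)))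

  -- A negative y² would be invertible, hence so would y. Then y would be positive or negative, and
  -- y² positive in either case.
  square-≮0 : ∀ y → ¬ y * y < 0#
  square-≮0 y yy<0 with invert (inj₁ yy<0)
  ... | b , yyb≈1 with invertible⇒≶0 (trans (sym (*-assoc y y b)) yyb≈1)
  ...   | inj₁ y<0 = <-irrefl refl (<-trans yy<0
            (<-respʳ-≈ (solve 1 (λ y → (:- y) :* (:- y) := y :* y) refl y) (*-pos (neg-pos y<0) (neg-pos y<0))))
  ...   | inj₂ 0<y = <-irrefl refl (<-trans yy<0 (*-pos 0<y 0<y))

  -- Comparing x with the interval from x + y² to a leaves x < a, since x + y² < x would make y²
  -- negative.
  +square-< : ∀ {x a} y → x + y * y < a → x < a
  +square-< {x} {a} y x+yy<a with <-cotrans x+yy<a x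
  ... | inj₂ x<a    = x<a
  ... | inj₁ x+yy<x = ⊥-elim (square-≮0 y (0<⇒< (<⇒0<- x+yy<x)
          (solve 2 (λ x y → x :- (x :+ y :* y) := con (+ 0) :- y :* y) refl x y)))

  -- Either x < s at once, or -s < x and the factor s + x of s² - x² is positive and can be
  -- cancelled.
  square-cancel-< : ∀ {x s} → 0# < s → x * x < s * s → x < s
  square-cancel-< {x} {s} 0<s xx<ss with <-cotrans (0<⇒< {d = s + s} (+-pos 0<s 0<s) (solve 1 (λ s → s :+ s := s :- (:- s)) refl s)) x
  ... | inj₂ x<s  = x<s
  ... | inj₁ -s<x = 0<-⇒< (*-cancel-pos (<⇒0<- -s<x)
          (<-respʳ-≈ (solve 2 (λ x s → s :* s :- x :* x := (x :- (:- s)) :* (s :- x)) refl x s) (<⇒0<- xx<ss)))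

  square-cancel-pos : ∀ {x} → ¬ x < 0# → 0# < x * x → 0# < x
  square-cancel-pos {x} x≮0 0<xx with invert (inj₂ 0<xx)
  ... | y , xxy≈1 with invertible⇒≶0 (trans (sym (*-assoc x x y)) xxy≈1)
  ...   | inj₁ x<0 = ⊥-elim (x≮0 x<0)
  ...   | inj₂ 0<x = 0<x

  two half : Carrier
  two = 1# + 1#
  0<two : 0# < two
  0<two = +-pos 0<1 0<1
  half = proj₁ (inverse-pos 0<two)
  0<half : 0# < half
  0<half = proj₁ (proj₂ (inverse-pos 0<two))
  half+half : half + half ≈ 1#
  half+half = trans (solve 1 (λ h → h :+ h := (con (+ 1) :+ con (+ 1)) :* h) refl half) (proj₂ (proj₂ (inverse-pos 0<two)))

  half<1 : half < 1#
  half<1 = 0<⇒< 0<half (trans (solve 1 (λ h → h := (h :+ h) :- h) refl half) (+-congʳ half+half))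

  -- The midpoint of ρ and 1, whose square exceeds ρ by ((1-ρ)/2)².
  square-above : ∀ {ρ} → 0# < ρ → ρ < 1# → ∃[ s ] 0# < s × s < 1# × ρ < s * s
  square-above {ρ} 0<ρ ρ<1 = s , *-pos (+-pos 0<1 0<ρ) 0<half , 0<⇒< 0<d d≈1-s , 0<⇒< (*-pos 0<d 0<d) dd≈ss-ρ
    where
    open import Relation.Binary.Reasoning.Setoid setoid
    s d : Carrier
    s = (1# + ρ) * half
    d = (1# - ρ) * half
    0<d : 0# < d
    0<d = *-pos (<⇒0<- ρ<1) 0<half
    d≈1-s : d ≈ 1# - s
    d≈1-s = begin
      d ≈⟨ solve 2 (λ ρ h → (con (+ 1) :- ρ) :* h := (h :+ h) :- (con (+ 1) :+ ρ) :* h) refl ρ half ⟩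
      (half + half) - s ≈⟨ +-congʳ half+half ⟩
      1# - s ∎
    dd≈ss-ρ : d * d ≈ s * s - ρ
    dd≈ss-ρ = begin
      d * d ≈⟨ solve 2 (λ ρ h → ((con (+ 1) :- ρ) :* h) :* ((con (+ 1) :- ρ) :* h)
                                                                := ((con (+ 1) :+ ρ) :* h) :* ((con (+ 1) :+ ρ) :* h) :- ρ :* ((h :+ h) :* (h :+ h)))
                                                                refl ρ half ⟩
      s * s - ρ * ((half + half) * (half + half)) ≈⟨ +-congˡ (-‿cong (*-congˡ (*-cong half+half half+half))) ⟩
      s * s - ρ * (1# * 1#) ≈⟨ solve 2 (λ a ρ → a :- ρ :* (con (+ 1) :* con (+ 1)) := a :- ρ) refl _ _ ⟩
      s * s - ρ ∎

  ^-pos : ∀ {t} → 0# < t → ∀ n → 0# < t ^ n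
  ^-pos 0<t zero    = 0<1
  ^-pos 0<t (suc n) = *-pos 0<t (^-pos 0<t n)

  ·1-pos : ∀ n → 0# < suc n · 1#
  ·1-pos zero    = <-respʳ-≈ (sym (+-identityʳ 1#)) 0<1
  ·1-pos (suc n) = +-pos 0<1 (·1-pos n)

  module Powers {t : Carrier} (0<t : 0# < t) (t<1 : t < 1#) where

    t^-suc-< : ∀ n → t ^ suc n < t ^ n
    t^-suc-< n = <-respʳ-≈ (*-identityˡ _) (*-monoʳ-< (^-pos 0<t n) t<1)

    t^-<two : ∀ n → t ^ n < two
    t^-<two zero    = <-respˡ-≈ (+-identityˡ 1#) (+-monoˡ-< 1# 0<1)
    t^-<two (suc n) = <-trans (t^-suc-< n) (t^-<two n)

    private
      h : Carrier
      h = 1# - t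
      0<h : 0# < h
      0<h = <⇒0<- t<1

      -- Bernoulli's inequality in disguise: the left side decreases, consecutive values differing
      -- by tⁿ(n + 1)h². The bound 2 instead of 1 keeps the case n = 0 strict.
      bernoulli : ∀ n → t ^ n * (1# + (n · 1#) * h) < two
      bernoulli zero    = <-respˡ-≈ (solve 1 (λ h → con (+ 1) := con (+ 1) :* (con (+ 1) :+ con (+ 0) :* h)) refl h)
                                    (<-respˡ-≈ (+-identityˡ 1#) (+-monoˡ-< 1# 0<1))
      bernoulli (suc n) = <-trans (0<⇒< (*-pos (^-pos 0<t n) (*-pos (·1-pos n) (*-pos 0<h 0<h)))
        (solve 3 (λ e ν t → let one = con (+ 1) ; h = one :- t in
           e :* ((one :+ ν) :* (h :* h)) := e :* (one :+ ν :* h) :- (t :* e) :* (one :+ (one :+ ν) :* h)) refl (t ^ n) (n · 1#) t))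
        (bernoulli n)

    -- M = 2/(1 - t) works, because (n + 1)tⁿ(1 - t) is smaller than the left side of `bernoulli` by
    -- tⁿ⁺¹.
    ∃-bound : ∃[ M ] 0# < M × (∀ n → (suc n · 1#) * t ^ n < M)
    ∃-bound =
      let k , 0<k , hk≈1 = inverse-pos 0<h in
      two * k , *-pos 0<two 0<k , λ n → *-cancelʳ-< 0<h (<-≈ refl
        (sym (trans (*-assoc two k h) (trans (*-congˡ (trans (*-comm k h) hk≈1)) (*-identityʳ two))))
        (<-trans (0<⇒< (*-pos (^-pos 0<t n) 0<t)
                   (solve 3 (λ e ν t → let one = con (+ 1) ; h = one :- t in
                      e :* t := e :* (one :+ ν :* h) :- (one :+ ν) :* e :* h) refl (t ^ n) (n · 1#) t))
                 (bernoulli n)))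

    -- The Archimedean property gives N > 2C/((1 - t)ε), while `bernoulli` bounds N(1 - t)tᴺ by 2.
    -- Beyond N the powers only decrease.
    vanishing : ∀ {C ε} → 0# < C → 0# < ε → ∃[ N ] ∀ n → N ℕ.≤ n → C * t ^ n < ε
    vanishing {C} {ε} 0<C 0<ε = N , λ n N≤n → ≡.subst (λ k → C * t ^ k < ε) (ℕ.m+[n∸m]≡n N≤n) (eventually (n ℕ.∸ N))
      where
      k = proj₁ (inverse-pos (*-pos 0<h 0<ε))
      0<k = proj₁ (proj₂ (inverse-pos (*-pos 0<h 0<ε)))
      hεk≈1 = proj₂ (proj₂ (inverse-pos (*-pos 0<h 0<ε)))
      N = proj₁ (archimedean (C * two * k))
      0<N : 0# < N · 1#
      0<N = <-trans (*-pos (*-pos 0<C 0<two) 0<k) (proj₂ (archimedean (C * two * k)))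
      2C<Nhε : C * two < (N · 1#) * (h * ε)
      2C<Nhε = <-respˡ-≈ (trans (*-assoc _ _ _) (trans (*-congˡ (trans (*-comm _ _) hεk≈1)) (*-identityʳ _)))
                 (*-monoʳ-< (*-pos 0<h 0<ε) (proj₂ (archimedean (C * two * k))))
      start : C * t ^ N < ε
      start = *-cancelʳ-< (*-pos 0<N 0<h) (<-trans
        (<-≈ (solve 4 (λ C e ν h → C :* (e :* (ν :* h)) := C :* e :* (ν :* h)) refl C (t ^ N) (N · 1#) h) refl
          (*-monoˡ-< 0<C (<-trans (0<⇒< (^-pos 0<t N)
            (solve 3 (λ e ν h → e := e :* (con (+ 1) :+ ν :* h) :- e :* (ν :* h)) refl (t ^ N) (N · 1#) h)) (bernoulli N))))
        (<-≈ refl (solve 3 (λ ν h ε → ν :* (h :* ε) := ε :* (ν :* h)) refl (N · 1#) h ε) 2C<Nhε))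
      eventually : ∀ d → C * t ^ (N ℕ.+ d) < ε
      eventually zero    = ≡.subst (λ k → C * t ^ k < ε) (≡.sym (ℕ.+-identityʳ N)) start
      eventually (suc d) = ≡.subst (λ k → C * t ^ k < ε) (≡.sym (ℕ.+-suc N d))
        (<-trans (*-monoˡ-< 0<C (t^-suc-< (N ℕ.+ d))) (eventually d))

-- Multiplying the sum of z ^ e over es by 1 + z ^ k.
withShift : ℕ → List ℕ → List ℕ
withShift k es = es ++ map (k ℕ.+_) es

length-withShift : ∀ k es → length (withShift k es) ≡ length es ℕ.+ length es
length-withShift k es = ≡.trans (length-++ es) (≡.cong (length es ℕ.+_) (length-map _ es))

thetaExponents innerTermExponents termExponents : ℕ → List ℕ
thetaExponents n = applyUpTo (λ i → ∣ i ⊖ n ∣ ℕ.^ 2) (suc (2 ℕ.* n))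
innerTermExponents n = withShift (2 ℕ.* (2 ℕ.* n ℕ.+ 1)) (withShift (2 ℕ.* n ℕ.+ 1) (thetaExponents n))
termExponents n = map (3 ℕ.* n ℕ.^ 2 ℕ.+_) (innerTermExponents n)

length-termExponents : ∀ n → length (termExponents n) ≡ 4 ℕ.* suc (2 ℕ.* n)
length-termExponents n = begin
  length (termExponents n)
    ≡⟨ length-map _ (innerTermExponents n) ⟩
  length (innerTermExponents n)
    ≡⟨ length-withShift (2 ℕ.* (2 ℕ.* n ℕ.+ 1)) (withShift (2 ℕ.* n ℕ.+ 1) (thetaExponents n)) ⟩
  length (withShift (2 ℕ.* n ℕ.+ 1) (thetaExponents n)) ℕ.+ length (withShift (2 ℕ.* n ℕ.+ 1) (thetaExponents n))
    ≡⟨ ≡.cong (λ l → l ℕ.+ l) (length-withShift (2 ℕ.* n ℕ.+ 1) (thetaExponents n)) ⟩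
  (length (thetaExponents n) ℕ.+ length (thetaExponents n)) ℕ.+ (length (thetaExponents n) ℕ.+ length (thetaExponents n))
    ≡⟨ ≡.cong (λ l → l ℕ.+ l ℕ.+ (l ℕ.+ l)) (length-applyUpTo (λ i → ∣ i ⊖ n ∣ ℕ.^ 2) (suc (2 ℕ.* n))) ⟩
  suc (2 ℕ.* n) ℕ.+ suc (2 ℕ.* n) ℕ.+ (suc (2 ℕ.* n) ℕ.+ suc (2 ℕ.* n))
    ≡⟨ quadruple (suc (2 ℕ.* n)) ⟩
  4 ℕ.* suc (2 ℕ.* n) ∎
  where
  open ≡.≡-Reasoning
  quadruple : ∀ l → l ℕ.+ l ℕ.+ (l ℕ.+ l) ≡ 4 ℕ.* l
  quadruple = solve-∀

termExponents-≥ : ∀ n → All (n ℕ.≤_) (termExponents n)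
termExponents-≥ n = All.map⁺ (All.universal (λ e → ℕ.≤-trans (n≤3n² n) (ℕ.m≤m+n _ e)) _)
  where
  n≤3n² : ∀ n → n ℕ.≤ 3 ℕ.* n ℕ.^ 2
  n≤3n² zero    = z≤n
  n≤3n² (suc n) = ℕ.≤-trans (ℕ.m≤m*n (suc n) (suc n ℕ.* 1)) (ℕ.m≤m+n (suc n ℕ.^ 2) _)

module ThetaPowers {c ℓ} (R : CommutativeRing c ℓ) where

  open CommutativeRing R hiding (zero)
  open import Algebra.Properties.Semiring.Exp semiring
  open Antidiagonal R
  open QSeries R using (module Hexagonal)
  open Theta R
  open import Relation.Binary.Reasoning.Setoid setoid

  module _ (x z : Carrier) (z*z≈x : z * z ≈ x) where

    open Hexagonal z using (powers; powers-++; powers-map-+)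

    powers-applyUpTo : ∀ e k → ∑ k (λ i → z ^ e i) ≈ powers (applyUpTo e k)
    powers-applyUpTo e zero    = refl
    powers-applyUpTo e (suc k) = trans (∑-suc k _) (+-congˡ (powers-applyUpTo (λ i → e (suc i)) k))

    powers-withShift : ∀ k es → (1# + z ^ k) * powers es ≈ powers (withShift k es)
    powers-withShift k es = begin
      (1# + z ^ k) * powers es ≈⟨ trans (distribʳ _ _ _) (+-congʳ (*-identityˡ _)) ⟩
      powers es + z ^ k * powers es ≈⟨ +-congˡ (powers-map-+ k es) ⟨
      powers es + powers (map (k ℕ.+_) es) ≈⟨ powers-++ es _ ⟨
      powers (es ++ map (k ℕ.+_) es) ∎

    term⁺-powers : ∀ n → term⁺ x z z*z≈x n ≈ powers (termExponents n)
    term⁺-powers n = begin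
      z ^ (3 ℕ.* n ℕ.^ 2) * (1# + x ^ b) * (1# + z ^ b) * theta x z z*z≈x n
        ≈⟨ trans (*-assoc (z ^ (3 ℕ.* n ℕ.^ 2) * (1# + x ^ b)) _ _) (*-assoc (z ^ (3 ℕ.* n ℕ.^ 2)) _ _) ⟩
      z ^ (3 ℕ.* n ℕ.^ 2) * ((1# + x ^ b) * ((1# + z ^ b) * theta x z z*z≈x n))
        ≈⟨ *-congˡ (*-cong (+-congˡ (sym (z^double x z z*z≈x b)))
             (trans (*-congˡ (powers-applyUpTo (λ i → ∣ i ⊖ n ∣ ℕ.^ 2) (suc (2 ℕ.* n)))) (powers-withShift b (thetaExponents n)))) ⟩
      z ^ (3 ℕ.* n ℕ.^ 2) * ((1# + z ^ (2 ℕ.* b)) * powers es)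
        ≈⟨ *-congˡ (powers-withShift (2 ℕ.* b) es) ⟩
      z ^ (3 ℕ.* n ℕ.^ 2) * powers (innerTermExponents n)
        ≈⟨ powers-map-+ (3 ℕ.* n ℕ.^ 2) (innerTermExponents n) ⟨
      powers (termExponents n) ∎
      where
      b = 2 ℕ.* n ℕ.+ 1
      es = withShift b (thetaExponents n)

-- Complex numbers, boxes and geometric majorants

module ComplexNumbers {c ℓ₁ ℓ₂} (ℝ : RealField c ℓ₁ ℓ₂) where

  private
    module ℝ = Reals ℝ
    module Solveℝ = IntegerCoefficients.Solver ℝ.commutativeRing
  open ℝ using (_<_; 0#; 1#)
  module ℂ = Complex ℝ
  open Complex ℝ using (ℂ; _≈_; 0ℂ; 1ℂ; ½; ∣_∣²; _⟶_) public

  ℂ-commutativeRing : CommutativeRing c ℓ₁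
  ℂ-commutativeRing = record
    { Carrier = ℂ
    ; _≈_     = _≈_
    ; _+_     = ℂ._+_
    ; _*_     = ℂ._*_
    ; -_      = ℂ.-_
    ; 0#      = 0ℂ
    ; 1#      = 1ℂ
    ; isCommutativeRing = record
      { isRing = record
        { +-isAbelianGroup = record
          { isGroup = record
            { isMonoid = record
              { isSemigroup = record
                { isMagma = record
                  { isEquivalence = record
                    { refl  = ℝ.refl , ℝ.refl
                    ; sym   = λ (e , e′) → ℝ.sym e , ℝ.sym e′
                    ; trans = λ (e , e′) (f , f′) → ℝ.trans e f , ℝ.trans e′ f′
                    }
                  ; ∙-cong = λ (e , e′) (f , f′) → ℝ.+-cong e f , ℝ.+-cong e′ f′
                  }
                ; assoc = λ (x , y) (x′ , y′) (x″ , y″) → ℝ.+-assoc x x′ x″ , ℝ.+-assoc y y′ y″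
                }
              ; identity = (λ (x , y) → ℝ.+-identityˡ x , ℝ.+-identityˡ y) , (λ (x , y) → ℝ.+-identityʳ x , ℝ.+-identityʳ y)
              }
            ; inverse = (λ (x , y) → ℝ.-‿inverseˡ x , ℝ.-‿inverseˡ y) , (λ (x , y) → ℝ.-‿inverseʳ x , ℝ.-‿inverseʳ y)
            ; ⁻¹-cong = λ (e , e′) → ℝ.-‿cong e , ℝ.-‿cong e′
            }
          ; comm = λ (x , y) (x′ , y′) → ℝ.+-comm x x′ , ℝ.+-comm y y′
          }
        ; *-cong     = λ (e , e′) (f , f′) →
            ℝ.+-cong (ℝ.*-cong e f) (ℝ.-‿cong (ℝ.*-cong e′ f′)) , ℝ.+-cong (ℝ.*-cong e f′) (ℝ.*-cong e′ f)
        ; *-assoc    = λ (a , b) (c , d) (e , f) →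
            solve 6 (λ a b c d e f → (a :* c :- b :* d) :* e :- (a :* d :+ b :* c) :* f
                                     := a :* (c :* e :- d :* f) :- b :* (c :* f :+ d :* e)) ℝ.refl a b c d e f ,
            solve 6 (λ a b c d e f → (a :* c :- b :* d) :* f :+ (a :* d :+ b :* c) :* e
                                     := a :* (c :* f :+ d :* e) :+ b :* (c :* e :- d :* f)) ℝ.refl a b c d e f
        ; *-identity =
            (λ (a , b) → solve 2 (λ a b → con (+ 1) :* a :- con (+ 0) :* b := a) ℝ.refl a b ,
                         solve 2 (λ a b → con (+ 1) :* b :+ con (+ 0) :* a := b) ℝ.refl a b) ,
            (λ (a , b) → solve 2 (λ a b → a :* con (+ 1) :- b :* con (+ 0) := a) ℝ.refl a b ,
                         solve 2 (λ a b → a :* con (+ 0) :+ b :* con (+ 1) := b) ℝ.refl a b)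
        ; distrib    =
            (λ (a , b) (c , d) (e , f) →
              solve 6 (λ a b c d e f → a :* (c :+ e) :- b :* (d :+ f) := (a :* c :- b :* d) :+ (a :* e :- b :* f)) ℝ.refl a b c d e f ,
              solve 6 (λ a b c d e f → a :* (d :+ f) :+ b :* (c :+ e) := (a :* d :+ b :* c) :+ (a :* f :+ b :* e)) ℝ.refl a b c d e f) ,
            (λ (a , b) (c , d) (e , f) →
              solve 6 (λ a b c d e f → (c :+ e) :* a :- (d :+ f) :* b := (c :* a :- d :* b) :+ (e :* a :- f :* b)) ℝ.refl a b c d e f ,
              solve 6 (λ a b c d e f → (c :+ e) :* b :+ (d :+ f) :* a := (c :* b :+ d :* a) :+ (e :* b :+ f :* a)) ℝ.refl a b c d e f)
        }
      ; *-comm = λ (a , b) (c , d) →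
          solve 4 (λ a b c d → a :* c :- b :* d := c :* a :- d :* b) ℝ.refl a b c d ,
          solve 4 (λ a b c d → a :* d :+ b :* c := c :* b :+ d :* a) ℝ.refl a b c d
      }
    }
    where open Solveℝ

  open CommutativeRing ℂ-commutativeRing public
    hiding (_≈_; Carrier; zero; 0#; 1#)
  open import Algebra.Properties.Semiring.Exp semiring public
  open Antidiagonal ℂ-commutativeRing public
  private
    module Solveℂ = IntegerCoefficients.Solver ℂ-commutativeRing

  ½+½ : ½ + ½ ≈ 1ℂ
  ½+½ = ℝ.trans (solve 1 (λ h → h :+ h := (con (+ 1) :+ con (+ 1)) :* h) ℝ.refl h) two*h ,
        ℝ.+-identityˡ 0#
    where
    open Solveℝ
    h = proj₁ ½
    two*h : (1# ℝ.+ 1#) ℝ.* h ℝ.≈ 1#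
    two*h = ℝ.trans (ℝ.*-congʳ (solve 1 (λ x → x := x :- con (+ 0)) ℝ.refl (1# ℝ.+ 1#)))
                    (proj₂ (proj₂ (ℝ.#⇒invertible _)))

  ∣∣²-cong : ∀ {z w} → z ≈ w → ∣ z ∣² ℝ.≈ ∣ w ∣²
  ∣∣²-cong (e , e′) = ℝ.+-cong (ℝ.*-cong e e) (ℝ.*-cong e′ e′)

  ∣∣²-* : ∀ z w → ∣ z * w ∣² ℝ.≈ ∣ z ∣² ℝ.* ∣ w ∣²
  ∣∣²-* (a , b) (c , d) = solve 4 (λ a b c d →
    (a :* c :- b :* d) :* (a :* c :- b :* d) :+ (a :* d :+ b :* c) :* (a :* d :+ b :* c)
    := (a :* a :+ b :* b) :* (c :* c :+ d :* d)) ℝ.refl a b c d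
    where open Solveℝ

  ∣∣²-^ : ∀ z n → ∣ z ^ n ∣² ℝ.≈ ∣ z ∣² ℝ.^ n
  ∣∣²-^ z zero    = solve 0 (con (+ 1) :* con (+ 1) :+ con (+ 0) :* con (+ 0) := con (+ 1)) ℝ.refl
    where open Solveℝ
  ∣∣²-^ z (suc n) = ℝ.trans (∣∣²-* z (z ^ n)) (ℝ.*-congˡ (∣∣²-^ z n))

  ∣∣²-neg : ∀ z → ∣ - z ∣² ℝ.≈ ∣ z ∣²
  ∣∣²-neg (a , b) = solve 2 (λ a b → (:- a) :* (:- a) :+ (:- b) :* (:- b) := a :* a :+ b :* b) ℝ.refl a b
    where open Solveℝ

  Within : ℝ.Carrier → ℝ.Carrier → Set ℓ₂
  Within b x = ℝ.- b < x × x < b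

  within-cong : ∀ {b b′ x x′} → b ℝ.≈ b′ → x ℝ.≈ x′ → Within b x → Within b′ x′
  within-cong b≈ x≈ (-b<x , x<b) = ℝ.<-≈ (ℝ.-‿cong b≈) x≈ -b<x , ℝ.<-≈ x≈ b≈ x<b

  within-0 : ∀ {b} → 0# < b → Within b 0#
  within-0 0<b = ℝ.0<⇒< 0<b (solve 1 (λ b → b := con (+ 0) :- (:- b)) ℝ.refl _) , 0<b
    where open Solveℝ

  within-neg : ∀ {b x} → Within b x → Within b (ℝ.- x)
  within-neg (-b<x , x<b) = ℝ.neg-< x<b , ℝ.<-≈ ℝ.refl (solve 1 (λ b → :- (:- b) := b) ℝ.refl _) (ℝ.neg-< -b<x)
    where open Solveℝ

  within-+ : ∀ {b b′ x x′} → Within b x → Within b′ x′ → Within (b ℝ.+ b′) (x ℝ.+ x′)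
  within-+ (-b<x , x<b) (-b′<x′ , x′<b′) =
    ℝ.<-≈ (solve 2 (λ b b′ → (:- b) :+ (:- b′) := :- (b :+ b′)) ℝ.refl _ _) ℝ.refl (ℝ.+-mono-< -b<x -b′<x′) ,
    ℝ.+-mono-< x<b x′<b′
    where open Solveℝ

  within-mono : ∀ {b b′ x} → b < b′ → Within b x → Within b′ x
  within-mono b<b′ (-b<x , x<b) = ℝ.<-trans (ℝ.neg-< b<b′) -b<x , ℝ.<-trans x<b b<b′

  within-square : ∀ {b x} → Within b x → x ℝ.* x < b ℝ.* b
  within-square {b} {x} (-b<x , x<b) = ℝ.0<⇒< (ℝ.*-pos (ℝ.<⇒0<- -b<x) (ℝ.<⇒0<- x<b))
    (solve 2 (λ b x → (x :- (:- b)) :* (b :- x) := b :* b :- x :* x) ℝ.refl b x)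
    where open Solveℝ

  square-within : ∀ {b x} → 0# < b → x ℝ.* x < b ℝ.* b → Within b x
  square-within {b} {x} 0<b xx<bb =
    ℝ.<-≈ ℝ.refl (solve 1 (λ x → :- (:- x) := x) ℝ.refl x)
      (ℝ.neg-< (ℝ.square-cancel-< 0<b (ℝ.<-respˡ-≈ (solve 1 (λ x → x :* x := (:- x) :* (:- x)) ℝ.refl x) xx<bb))) ,
    ℝ.square-cancel-< 0<b xx<bb
    where open Solveℝ

  -- A square around 0 in place of a disc. Its size is additive under addition of complex numbers,
  -- and no square root is involved.
  record Box (b : ℝ.Carrier) (z : ℂ) : Set ℓ₂ where
    constructor _,_
    field
      re : Within b (proj₁ z)
      im : Within b (proj₂ z)

  box-cong : ∀ {b b′ z z′} → b ℝ.≈ b′ → z ≈ z′ → Box b z → Box b′ z′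
  box-cong b≈ (x≈ , y≈) (bx , by) = within-cong b≈ x≈ bx , within-cong b≈ y≈ by

  box-0 : ∀ {b} → 0# < b → Box b 0ℂ
  box-0 0<b = within-0 0<b , within-0 0<b

  box-neg : ∀ {b z} → Box b z → Box b (- z)
  box-neg (bx , by) = within-neg bx , within-neg by

  box-+ : ∀ {b b′ z z′} → Box b z → Box b′ z′ → Box (b ℝ.+ b′) (z + z′)
  box-+ (bx , by) (bx′ , by′) = within-+ bx bx′ , within-+ by by′

  box-mono : ∀ {b b′ z} → b < b′ → Box b z → Box b′ z
  box-mono b<b′ (bx , by) = within-mono b<b′ bx , within-mono b<b′ by

  ∣∣²-box : ∀ {b z} → 0# < b → ∣ z ∣² < b ℝ.* b → Box b z
  ∣∣²-box {b} {x , y} 0<b zz<bb =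
    square-within 0<b (ℝ.+square-< y zz<bb) ,
    square-within 0<b (ℝ.+square-< x (ℝ.<-respˡ-≈ (ℝ.+-comm _ _) zz<bb))

  Approaches : (ℕ → ℂ) → ℂ → Set (c ⊔ ℓ₂)
  Approaches u l = ∀ ε → 0# < ε → ∃[ N ] ∀ m → N ℕ.≤ m → Box ε (u m + - l)

  -- A box of size ε/2 bounds the squared modulus by 2(ε/2)² = ε²/2 < ε².
  approaches⇒⟶ : ∀ {u l} → Approaches u l → u ⟶ l
  approaches⇒⟶ {u} {l} lim ε 0<ε = N , λ m N≤m →
    let bx , by = proj₂ (lim δ 0<δ) m N≤m in
    ℝ.<-trans (ℝ.+-mono-< (within-square bx) (within-square by)) δδ+δδ<εε
    where
    open Solveℝ
    δ = ε ℝ.* ℝ.half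
    0<δ = ℝ.*-pos 0<ε ℝ.0<half
    N = proj₁ (lim δ 0<δ)
    δδ+δδ<εε : δ ℝ.* δ ℝ.+ δ ℝ.* δ < ε ℝ.* ε
    δδ+δδ<εε = ℝ.<-≈
      (ℝ.trans (ℝ.*-congˡ (ℝ.sym (ℝ.trans (ℝ.*-congʳ ℝ.half+half) (ℝ.*-identityˡ _))))
        (solve 2 (λ e h → (e :* e) :* ((h :+ h) :* h) := (e :* h) :* (e :* h) :+ (e :* h) :* (e :* h)) ℝ.refl ε ℝ.half))
      (ℝ.*-identityʳ _)
      (ℝ.*-monoˡ-< (ℝ.*-pos 0<ε 0<ε) ℝ.half<1)

  module Series {t : ℝ.Carrier} (0<t : 0# < t) (t<1 : t < 1#) (C : ℝ.Carrier) (0<C : 0# < C)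
    (f : ℕ → ℂ) (bound : ∀ n → Box (C ℝ.* t ℝ.^ n) (f n)) where

    private
      k = proj₁ (ℝ.inverse-pos (ℝ.<⇒0<- t<1))
      0<k = proj₁ (proj₂ (ℝ.inverse-pos (ℝ.<⇒0<- t<1)))
      hk≈1 = proj₂ (proj₂ (ℝ.inverse-pos (ℝ.<⇒0<- t<1)))
      D = C ℝ.* k
      0<D = ℝ.*-pos 0<C 0<k

      geometric-step : ∀ n → D ℝ.* t ℝ.^ suc n ℝ.+ C ℝ.* t ℝ.^ n ℝ.≈ D ℝ.* t ℝ.^ n
      geometric-step n = ℝ.trans (ℝ.+-congˡ (ℝ.sym (ℝ.trans (ℝ.*-congʳ (ℝ.*-congˡ hk≈1)) (ℝ.*-congʳ (ℝ.*-identityʳ C)))))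
        (solve 4 (λ C k t e → C :* k :* (t :* e) :+ C :* ((con (+ 1) :- t) :* k) :* e := C :* k :* e) ℝ.refl C k t (t ℝ.^ n))
        where open Solveℝ

    -- D = C/(1 - t) is the sum of the geometric majorant, whence D tⁿ⁺¹ + C tⁿ = D tⁿ. The
    -- induction splits off the lowest summand f n.
    tail-box : ∀ d n → Box (D ℝ.* t ℝ.^ n) (∑ (n ℕ.+ d) f + - ∑ n f)
    tail-box zero    n = box-cong ℝ.refl
      (trans (sym (-‿inverseʳ (∑ n f))) (+-congʳ (reflexive (≡.cong (λ i → ∑ i f) (≡.sym (ℕ.+-identityʳ n))))))
      (box-0 (ℝ.*-pos 0<D (ℝ.^-pos 0<t n)))
    tail-box (suc d) n = box-cong (geometric-step n)
      (trans (solve 3 (λ a b c → (a :+ :- (b :+ c)) :+ c := a :+ :- b) refl (∑ (suc n ℕ.+ d) f) (∑ n f) (f n))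
             (+-congʳ (reflexive (≡.cong (λ i → ∑ i f) (≡.sym (ℕ.+-suc n d))))))
      (box-+ (tail-box d (suc n)) (bound n))
      where open Solveℂ

    private
      close-≤ : ∀ m n → n ℕ.≤ m → Box (D ℝ.* t ℝ.^ n) (∑ m f + - ∑ n f)
      close-≤ m n n≤m = ≡.subst (λ i → Box (D ℝ.* t ℝ.^ n) (∑ i f + - ∑ n f)) (ℕ.m+[n∸m]≡n n≤m) (tail-box (m ℕ.∸ n) n)

      close : ∀ ε → 0# < ε → ∃[ N ] ∀ m n → N ℕ.≤ m → N ℕ.≤ n → Box ε (∑ m f + - ∑ n f)
      close ε 0<ε = N , λ m n N≤m N≤n → case m n N≤m N≤n (ℕ.≤-total n m)
        where
        open ℝ.Powers 0<t t<1
        N = proj₁ (vanishing 0<D 0<ε)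
        case : ∀ m n → N ℕ.≤ m → N ℕ.≤ n → n ℕ.≤ m ⊎ m ℕ.≤ n → Box ε (∑ m f + - ∑ n f)
        case m n N≤m N≤n (inj₁ n≤m) = box-mono (proj₂ (vanishing 0<D 0<ε) n N≤n) (close-≤ m n n≤m)
        case m n N≤m N≤n (inj₂ m≤n) = box-cong ℝ.refl (solve 2 (λ a b → :- (a :+ :- b) := b :+ :- a) refl (∑ n f) (∑ m f))
          (box-neg (box-mono (proj₂ (vanishing 0<D 0<ε) m N≤m) (close-≤ n m m≤n)))
          where open Solveℂ

    convergent : ∃[ l ] Approaches (λ n → ∑ n f) l
    convergent = (proj₁ re , proj₁ im) , λ ε 0<ε →
      let N₁ , re-close = proj₂ re ε 0<ε
          N₂ , im-close = proj₂ im ε 0<ε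
      in N₁ ℕ.⊔ N₂ , λ m N≤m →
           within (re-close m (ℕ.≤-trans (ℕ.m≤m⊔n N₁ N₂) N≤m)) , within (im-close m (ℕ.≤-trans (ℕ.m≤n⊔m N₁ N₂) N≤m))
      where
      re = ℝ.complete (λ n → proj₁ (∑ n f)) λ ε 0<ε →
        let N , e = close ε 0<ε in N , λ m n N≤m N≤n → proj₂ (Box.re (e m n N≤m N≤n))
      im = ℝ.complete (λ n → proj₂ (∑ n f)) λ ε 0<ε →
        let N , e = close ε 0<ε in N , λ m n N≤m N≤n → proj₂ (Box.im (e m n N≤m N≤n))
      within : ∀ {ε u l} → (u ℝ.- l < ε) × (l ℝ.- u < ε) → Within ε (u ℝ.- l)
      within {ε} {u} {l} (u-l<ε , l-u<ε) =
        ℝ.<-≈ ℝ.refl (solve 2 (λ u l → :- (l :- u) := u :- l) ℝ.refl u l) (ℝ.neg-< l-u<ε) , u-l<ε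
        where open Solveℝ

  module Monomials (z : ℂ) (0<ρ : 0# < ∣ z ∣²) (ρ<1 : ∣ z ∣² < 1#) where

    open QSeries.Hexagonal ℂ-commutativeRing z using (powers) public

    private
      ρ = ∣ z ∣²
      -- `square-above` stands in for a square root. Three applications give σ < 1 with σ⁸ > ρ, so
      -- that s = σ⁴ exceeds the modulus of z.
      above₁ = ℝ.square-above 0<ρ ρ<1
      s₁ = proj₁ above₁
      above₂ = ℝ.square-above (proj₁ (proj₂ above₁)) (proj₁ (proj₂ (proj₂ above₁)))
      s₂ = proj₁ above₂
      above₃ = ℝ.square-above (proj₁ (proj₂ above₂)) (proj₁ (proj₂ (proj₂ above₂)))
      σ = proj₁ above₃
      0<σ : 0# < σ
      0<σ = proj₁ (proj₂ above₃)
      σ<1 : σ < 1#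
      σ<1 = proj₁ (proj₂ (proj₂ above₃))
      s = (σ ℝ.* σ) ℝ.* (σ ℝ.* σ)
      0<s : 0# < s
      0<s = ℝ.*-pos (ℝ.*-pos 0<σ 0<σ) (ℝ.*-pos 0<σ 0<σ)
      ρ<ss : ρ < s ℝ.* s
      ρ<ss = ℝ.<-trans (proj₂ (proj₂ (proj₂ above₁))) (ℝ.*-mono-< 0<s 0<s₁ s₁<s s₁<s)
        where
        0<s₁ = proj₁ (proj₂ above₁)
        s₂<σσ = proj₂ (proj₂ (proj₂ above₃))
        s₁<s : s₁ < s
        s₁<s = ℝ.<-trans (proj₂ (proj₂ (proj₂ above₂)))
                 (ℝ.*-mono-< (ℝ.*-pos 0<σ 0<σ) (proj₁ (proj₂ above₂)) s₂<σσ s₂<σσ)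

      size² : ℕ → ℝ.Carrier
      size² n = (ℝ.two ℝ.* s ℝ.^ n) ℝ.* (ℝ.two ℝ.* s ℝ.^ n)

      0<2s^ : ∀ n → 0# < ℝ.two ℝ.* s ℝ.^ n
      0<2s^ n = ℝ.*-pos ℝ.0<two (ℝ.^-pos 0<s n)

      -- The factor 2 in the box provides strictness at n = 0; each further step uses ρ < s².
      ρ^<size² : ∀ n → ρ ℝ.^ n < size² n
      ρ^<size² zero    = ℝ.0<⇒< (ℝ.+-pos ℝ.0<1 ℝ.0<two) (solve 0 (let one = con (+ 1) ; 2′ = one :+ one in
                           one :+ 2′ := (2′ :* one) :* (2′ :* one) :- one) ℝ.refl)
        where open Solveℝ
      ρ^<size² (suc n) = ℝ.<-respʳ-≈
        (solve 3 (λ s e t → (s :* s) :* ((t :* e) :* (t :* e)) := (t :* (s :* e)) :* (t :* (s :* e))) ℝ.refl s (s ℝ.^ n) ℝ.two)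
        (ℝ.*-mono-< (ℝ.*-pos 0<s 0<s) (ℝ.^-pos 0<ρ n) ρ<ss (ρ^<size² n))
        where open Solveℝ

      ρ^-box : ∀ n d → ρ ℝ.^ (n ℕ.+ d) < size² n
      ρ^-box n zero    = ≡.subst (λ k → ρ ℝ.^ k < size² n) (≡.sym (ℕ.+-identityʳ n)) (ρ^<size² n)
      ρ^-box n (suc d) = ≡.subst (λ k → ρ ℝ.^ k < size² n) (≡.sym (ℕ.+-suc n d))
        (ℝ.<-trans (ℝ.Powers.t^-suc-< 0<ρ ρ<1 (n ℕ.+ d)) (ρ^-box n d))

    monomial-box : ∀ n e → n ℕ.≤ e → Box (ℝ.two ℝ.* s ℝ.^ n) (z ^ e)
    monomial-box n e n≤e = ∣∣²-box (0<2s^ n) (ℝ.<-respˡ-≈ (ℝ.sym (∣∣²-^ z e))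
      (≡.subst (λ k → ρ ℝ.^ k < size² n) (ℕ.m+[n∸m]≡n n≤e) (ρ^-box n (e ℕ.∸ n))))

    private
      powers-box′ : ∀ n m es → All (n ℕ.≤_) es → length es ℕ.< m →
                    Box ((m ℝ.· 1#) ℝ.* (ℝ.two ℝ.* s ℝ.^ n)) (powers es)
      powers-box′ n (suc m) []       []          _         = box-0 (ℝ.*-pos (ℝ.·1-pos m) (0<2s^ n))
      powers-box′ n (suc m) (e ∷ es) (n≤e ∷ n≤) (s≤s len) = box-cong
        (solve 2 (λ ν b → b :+ ν :* b := (con (+ 1) :+ ν) :* b) ℝ.refl (m ℝ.· 1#) _) refl
        (box-+ (monomial-box n e n≤e) (powers-box′ n m es n≤ len))
        where open Solveℝ

    -- The polynomial number of monomials is absorbed by two of the four factors σ ^ n of s ^ n.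
    t : ℝ.Carrier
    t = σ ℝ.* σ
    0<t : 0# < t
    0<t = ℝ.*-pos 0<σ 0<σ
    t<1 : t < 1#
    t<1 = ℝ.<-respʳ-≈ (ℝ.*-identityˡ 1#) (ℝ.*-mono-< ℝ.0<1 0<σ σ<1 σ<1)
    private
      M = proj₁ (ℝ.Powers.∃-bound 0<σ σ<1)
      0<M = proj₁ (proj₂ (ℝ.Powers.∃-bound 0<σ σ<1))
      νσ^<M = proj₂ (proj₂ (ℝ.Powers.∃-bound 0<σ σ<1))
      0<8 = ℝ.·1-pos 7
    C : ℝ.Carrier
    C = (8 ℝ.· 1#) ℝ.* ℝ.two ℝ.* (M ℝ.* M)
    0<C : 0# < C
    0<C = ℝ.*-pos (ℝ.*-pos 0<8 ℝ.0<two) (ℝ.*-pos 0<M 0<M)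

    -- The length 8(n + 1)² is generous enough both for a term of either series, with 4(2n + 1)
    -- monomials, and for the discarded part of the lattice sum, with at most 2n².
    powers-box : ∀ n es → All (n ℕ.≤_) es → length es ℕ.< 8 ℕ.* (suc n ℕ.* suc n) → Box (C ℝ.* t ℝ.^ n) (powers es)
    powers-box n es n≤ len = box-mono (ℝ.<-≈ (ℝ.sym lower) (ℝ.sym upper)
      (ℝ.*-monoˡ-< (ℝ.*-pos 0<8 ℝ.0<two) (ℝ.*-monoʳ-< (ℝ.*-pos 0<e 0<e)
        (ℝ.*-mono-< 0<M 0<νe (νσ^<M n) (νσ^<M n)))))
      (powers-box′ n (8 ℕ.* (suc n ℕ.* suc n)) es n≤ len)
      where
      open Solveℝ
      open import Algebra.Properties.CommutativeSemiring.Exp ℝ.commutativeSemiring using (^-distrib-*)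
      e = σ ℝ.^ n
      ν = suc n ℝ.· 1#
      0<e = ℝ.^-pos 0<σ n
      0<νe = ℝ.*-pos (ℝ.·1-pos n) 0<e
      t^≈ : t ℝ.^ n ℝ.≈ e ℝ.* e
      t^≈ = ^-distrib-* σ σ n
      lower : ((8 ℕ.* (suc n ℕ.* suc n)) ℝ.· 1#) ℝ.* (ℝ.two ℝ.* s ℝ.^ n) ℝ.≈
              (8 ℝ.· 1#) ℝ.* ℝ.two ℝ.* ((ν ℝ.* e) ℝ.* (ν ℝ.* e) ℝ.* (e ℝ.* e))
      lower = ℝ.trans (ℝ.*-cong (ℝ.trans (ℝ.×1-homo-* 8 (suc n ℕ.* suc n)) (ℝ.*-congˡ (ℝ.×1-homo-* (suc n) (suc n))))
                                (ℝ.*-congˡ (ℝ.trans (^-distrib-* t t n) (ℝ.*-cong t^≈ t^≈))))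
        (solve 4 (λ a b ν e → a :* (ν :* ν) :* (b :* ((e :* e) :* (e :* e))) := a :* b :* ((ν :* e) :* (ν :* e) :* (e :* e)))
          ℝ.refl (8 ℝ.· 1#) ℝ.two ν e)
      upper : C ℝ.* t ℝ.^ n ℝ.≈ (8 ℝ.· 1#) ℝ.* ℝ.two ℝ.* (M ℝ.* M ℝ.* (e ℝ.* e))
      upper = ℝ.trans (ℝ.*-congˡ t^≈) (ℝ.*-assoc _ _ _)

-- Truncated evaluation and the comparison of partial sums

length-antidiagonal : ∀ {a} {A : Set a} (φ : ℕ → ℕ → A) n → length (antidiagonal φ n) ≡ suc n
length-antidiagonal φ zero    = ≡.refl
length-antidiagonal φ (suc n) = ≡.cong suc (length-antidiagonal (λ i j → φ (suc i) j) n)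

length-innerExponents : ∀ r → length (innerExponents r) ≡ suc (r ℕ.+ r)
length-innerExponents r = ≡.trans (length-++ (antidiagonal hex² r))
  (≡.cong₂ ℕ._+_ (length-antidiagonal hex² r) (low r))
  where
  low : ∀ r → length (lowExponents r) ≡ r
  low zero    = ≡.refl
  low (suc r) = ≡.trans (length-map _ (antidiagonal hex² r)) (length-antidiagonal hex² r)

length-latticeExponents< : ∀ n → length (latticeExponents< n) ≡ 2 ℕ.* (n ℕ.* n)
length-latticeExponents< zero    = ≡.refl
length-latticeExponents< (suc n) = begin
  length (latticeExponents< n ++ latticeExponents n)
    ≡⟨ length-++ (latticeExponents< n) ⟩
  length (latticeExponents< n) ℕ.+ length (latticeExponents n)
    ≡⟨ ≡.cong₂ ℕ._+_ (length-latticeExponents< n)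
         (≡.trans (length-withShift (suc (n ℕ.+ n)) (innerExponents n))
                  (≡.cong (λ l → l ℕ.+ l) (length-innerExponents n))) ⟩
  2 ℕ.* (n ℕ.* n) ℕ.+ (suc (n ℕ.+ n) ℕ.+ suc (n ℕ.+ n))
    ≡⟨ square n ⟩
  2 ℕ.* (suc n ℕ.* suc n) ∎
  where
  open ≡.≡-Reasoning
  square : ∀ n → 2 ℕ.* (n ℕ.* n) ℕ.+ (suc (n ℕ.+ n) ℕ.+ suc (n ℕ.+ n)) ≡ 2 ℕ.* (suc n ℕ.* suc n)
  square = solve-∀

module Evaluation {c ℓ} (R : CommutativeRing c ℓ) where

  open CommutativeRing R hiding (zero)
  open Antidiagonal R
  open IntegerCoefficients R
  open import Algebra.Properties.Semiring.Exp semiring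
  open import Algebra.Properties.Semiring.Mult semiring using (×-assoc-*; ×-congʳ) renaming (_×_ to _·_)
  open import Algebra.Properties.Semiring.Mult.TCOptimised semiring using (×ᵤ≈×)
  open import Relation.Binary.Reasoning.Setoid setoid
  private
    module X = QSeries.Hexagonal PowerSeries.ℤ⟦X⟧ PowerSeries.X
    module ∑ᶻ = Antidiagonal ℤ.+-*-commutativeRing
    module ∑ˢ = Antidiagonal PowerSeries.ℤ⟦X⟧
    module PS = PowerSeries

  ∑-cong< : ∀ n {f g} → (∀ i → i ℕ.< n → f i ≈ g i) → ∑ n f ≈ ∑ n g
  ∑-cong< zero    f≈g = refl
  ∑-cong< (suc n) f≈g = +-cong (∑-cong< n (λ i i<n → f≈g i (ℕ.m<n⇒m<1+n i<n))) (f≈g n ℕ.≤-refl)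

  ∑-zero : ∀ n → ∑ n (λ _ → 0#) ≈ 0#
  ∑-zero zero    = refl
  ∑-zero (suc n) = trans (+-identityʳ _) (∑-zero n)

  ∑-comm : ∀ m n (f : ℕ → ℕ → Carrier) → ∑ m (λ i → ∑ n (f i)) ≈ ∑ n (λ j → ∑ m (λ i → f i j))
  ∑-comm zero    n f = sym (∑-zero n)
  ∑-comm (suc m) n f = trans (+-congʳ (∑-comm m n f)) (sym (∑-+ n _ _))

  ∑-*ʳ : ∀ n a f → ∑ n (λ i → f i * a) ≈ ∑ n f * a
  ∑-*ʳ n a f = trans (∑-cong n (λ i → *-comm _ _)) (trans (∑-*ˡ n a f) (*-comm _ _))

  ι-∑ : ∀ n f → ι (∑ᶻ.∑ n f) ≈ ∑ n (λ i → ι (f i))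
  ι-∑ zero    f = refl
  ι-∑ (suc n) f = trans (ι-+ (∑ᶻ.∑ n f) (f n)) (+-congʳ (ι-∑ n f))

  ∑ˢ-coefficient : ∀ k (f : ℕ → PS.Series) n → ∑ˢ.∑ k f n ≡ ∑ᶻ.∑ k (λ m → f m n)
  ∑ˢ-coefficient zero    f n = ≡.refl
  ∑ˢ-coefficient (suc k) f n = ≡.cong (λ i → i ℤ.+ f k n) (∑ˢ-coefficient k f n)

  ·≈ι* : ∀ n w → n · w ≈ ι (+ n) * w
  ·≈ι* n w = begin
    n · w ≈⟨ ×-congʳ n (*-identityˡ w) ⟨
    n · (1# * w) ≈⟨ ×-assoc-* n 1# w ⟨
    (n · 1#) * w ≈⟨ *-congʳ (×ᵤ≈× n 1#) ⟩
    ι (+ n) * w ∎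

  ι-^ : ∀ j → ι (-1ℤ ℤ.^ j) ≈ (- 1#) ^ j
  ι-^ zero    = refl
  ι-^ (suc j) = trans (ι-* -1ℤ (-1ℤ ℤ.^ j)) (*-congˡ (ι-^ j))

  module _ (x : Carrier) where

    open QSeries.Hexagonal R x using (powers)

    private
      evaluate : ℕ → PS.Series → Carrier
      evaluate k f = ∑ k (λ n → ι (f n) * x ^ n)

      evaluate-shift : ∀ k f g → (f 0 ≡ 0ℤ) → (∀ n → f (suc n) ≡ g n) → evaluate (suc k) f ≈ x * evaluate k g
      evaluate-shift k f g f0≡0 f-suc = begin
        ∑ (suc k) (λ n → ι (f n) * x ^ n)
          ≈⟨ ∑-suc k _ ⟩
        ι (f 0) * 1# + ∑ k (λ n → ι (f (suc n)) * (x * x ^ n))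
          ≈⟨ +-cong (trans (*-identityʳ _) (reflexive (≡.cong ι f0≡0)))
                    (∑-cong k (λ n → trans (*-congʳ (reflexive (≡.cong ι (f-suc n)))) (swap _ x _))) ⟩
        0# + ∑ k (λ n → x * (ι (g n) * x ^ n))
          ≈⟨ trans (+-identityˡ _) (∑-*ˡ k x _) ⟩
        x * evaluate k g ∎
        where
        swap : ∀ a b c → a * (b * c) ≈ b * (a * c)
        swap a b c = trans (sym (*-assoc a b c)) (trans (*-congʳ (*-comm a b)) (*-assoc b a c))

      evaluate-0 : ∀ k f → (∀ n → f n ≡ 0ℤ) → evaluate k f ≈ 0#
      evaluate-0 k f f≡0 = trans (∑-cong k (λ n → trans (*-congʳ (reflexive (≡.cong ι (f≡0 n)))) (zeroˡ _))) (∑-zero k)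

      X^-zero : ∀ e → (PS.X PS.^ suc e) 0 ≡ 0ℤ
      X^-zero e = ≡.refl

      X^-suc : ∀ e n → (PS.X PS.^ suc e) (suc n) ≡ (PS.X PS.^ e) n
      X^-suc e n = PS.X⊛-suc (PS.X PS.^ e) n

      evaluate-X^-< : ∀ k e → e ℕ.< k → evaluate k (PS.X PS.^ e) ≈ x ^ e
      evaluate-X^-< (suc k) zero    _         = begin
        ∑ (suc k) (λ n → ι (PS.constant 1ℤ n) * x ^ n)
          ≈⟨ ∑-suc k _ ⟩
        1# * 1# + ∑ k (λ n → 0# * x ^ suc n)
          ≈⟨ +-cong (*-identityʳ 1#) (trans (∑-cong k (λ n → zeroˡ _)) (∑-zero k)) ⟩
        1# + 0#
          ≈⟨ +-identityʳ 1# ⟩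
        1# ∎
      evaluate-X^-< (suc k) (suc e) (s≤s e<k) =
        trans (evaluate-shift k (PS.X PS.^ suc e) (PS.X PS.^ e) (X^-zero e) (X^-suc e)) (*-congˡ (evaluate-X^-< k e e<k))

      evaluate-X^-≥ : ∀ k e → k ℕ.≤ e → evaluate k (PS.X PS.^ e) ≈ 0#
      evaluate-X^-≥ zero    e       _         = refl
      evaluate-X^-≥ (suc k) (suc e) (s≤s k≤e) =
        trans (evaluate-shift k (PS.X PS.^ suc e) (PS.X PS.^ e) (X^-zero e) (X^-suc e))
              (trans (*-congˡ (evaluate-X^-≥ k e k≤e)) (zeroʳ x))

      evaluate-⊕ : ∀ k f g → evaluate k (f PS.⊕ g) ≈ evaluate k f + evaluate k g
      evaluate-⊕ k f g = trans (∑-cong k (λ n → trans (*-congʳ (ι-+ (f n) (g n))) (distribʳ _ _ _))) (∑-+ k _ _)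

    -- Cutting a series off at degree k loses exactly the monomials of exponent at least k, and
    -- these are added back.
    evaluate-powers : ∀ k es → ∑ k (λ n → ι (X.powers es n) * x ^ n) + powers (filter (k ℕ.≤?_) es) ≈ powers es
    evaluate-powers k []       = trans (+-identityʳ _) (evaluate-0 k _ (λ _ → ≡.refl))
    evaluate-powers k (e ∷ es) = trans (+-congʳ (evaluate-⊕ k (PS.X PS.^ e) (X.powers es))) (by-cases (k ℕ.≤? e))
      where
      E = evaluate k (X.powers es)
      rest = powers (filter (k ℕ.≤?_) es)
      by-cases : Dec (k ℕ.≤ e) → evaluate k (PS.X PS.^ e) + E + powers (filter (k ℕ.≤?_) (e ∷ es)) ≈ x ^ e + powers es
      by-cases (yes k≤e) = begin
        evaluate k (PS.X PS.^ e) + E + powers (filter (k ℕ.≤?_) (e ∷ es))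
          ≈⟨ +-cong (trans (+-congʳ (evaluate-X^-≥ k e k≤e)) (+-identityˡ E)) (reflexive (≡.cong powers (filter-accept (k ℕ.≤?_) k≤e))) ⟩
        E + (x ^ e + rest)
          ≈⟨ trans (sym (+-assoc E (x ^ e) rest)) (trans (+-congʳ (+-comm E (x ^ e))) (+-assoc (x ^ e) E rest)) ⟩
        x ^ e + (E + rest)
          ≈⟨ +-congˡ (evaluate-powers k es) ⟩
        x ^ e + powers es ∎
      by-cases (no k≰e) = begin
        evaluate k (PS.X PS.^ e) + E + powers (filter (k ℕ.≤?_) (e ∷ es))
          ≈⟨ +-cong (+-congʳ (evaluate-X^-< k e (ℕ.≰⇒> k≰e))) (reflexive (≡.cong powers (filter-reject (k ℕ.≤?_) k≰e))) ⟩
        x ^ e + E + rest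
          ≈⟨ trans (+-assoc (x ^ e) E rest) (+-congˡ (evaluate-powers k es)) ⟩
        x ^ e + powers es ∎

    tripleSum : ℕ → Carrier
    tripleSum k = ∑ k (λ m → ∑ k (λ n → ∑ k (λ j → Q m j n · ((- 1#) ^ j * x ^ n))))

    -- In the cube all three indices are below k. For n < k this suffices for the sum over j to be a
    -- full coefficient of O m ⊛ T m, and for `∑-O⊛T` to apply to the sum over m.
    tripleSum≈ : ∀ k → tripleSum k ≈ ∑ k (λ n → ι (X.powers (latticeExponents< k) n) * x ^ n)
    tripleSum≈ k = begin
      tripleSum k
        ≈⟨ ∑-cong k (λ m → ∑-cong< k (inner m)) ⟩
      ∑ k (λ m → ∑ k (λ n → ι ((O m ⊛ T m) n) * x ^ n))
        ≈⟨ ∑-comm k k (λ m n → ι ((O m ⊛ T m) n) * x ^ n) ⟩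
      ∑ k (λ n → ∑ k (λ m → ι ((O m ⊛ T m) n) * x ^ n))
        ≈⟨ ∑-cong< k outer ⟩
      ∑ k (λ n → ι (X.powers (latticeExponents< k) n) * x ^ n) ∎
      where
      open GeneratingFunctions using (O; T; ∑-O⊛T)
      open PowerSeries using (_⊛_)
      open Solver
      inner : ∀ m n → n ℕ.< k → ∑ k (λ j → Q m j n · ((- 1#) ^ j * x ^ n)) ≈ ι ((O m ⊛ T m) n) * x ^ n
      inner m n n<k = begin
        ∑ k (λ j → Q m j n · ((- 1#) ^ j * x ^ n))
          ≈⟨ ∑-cong k (λ j → trans (·≈ι* (Q m j n) _)
               (trans (solve 3 (λ a b c → a :* (b :* c) := (b :* a) :* c) refl (ι (+ Q m j n)) ((- 1#) ^ j) (x ^ n))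
                      (*-congʳ (trans (*-congʳ (sym (ι-^ j))) (sym (ι-* (-1ℤ ℤ.^ j) (+ Q m j n))))))) ⟩
        ∑ k (λ j → ι (-1ℤ ℤ.^ j ℤ.* + Q m j n) * x ^ n)
          ≈⟨ ∑-*ʳ k _ _ ⟩
        ∑ k (λ j → ι (-1ℤ ℤ.^ j ℤ.* + Q m j n)) * x ^ n
          ≈⟨ *-congʳ (ι-∑ k _) ⟨
        ι (∑ᶻ.∑ k (λ j → -1ℤ ℤ.^ j ℤ.* + Q m j n)) * x ^ n
          ≡⟨ ≡.cong (λ i → ι i * x ^ n) (Pairs.∑-Q k m n n<k) ⟩
        ι ((O m ⊛ T m) n) * x ^ n ∎
      outer : ∀ n → n ℕ.< k → ∑ k (λ m → ι ((O m ⊛ T m) n) * x ^ n) ≈ ι (X.powers (latticeExponents< k) n) * x ^ n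
      outer n n<k = begin
        ∑ k (λ m → ι ((O m ⊛ T m) n) * x ^ n)
          ≈⟨ ∑-*ʳ k _ _ ⟩
        ∑ k (λ m → ι ((O m ⊛ T m) n)) * x ^ n
          ≈⟨ *-congʳ (ι-∑ k _) ⟨
        ι (∑ᶻ.∑ k (λ m → (O m ⊛ T m) n)) * x ^ n
          ≡⟨ ≡.cong (λ i → ι i * x ^ n) (≡.trans (≡.sym (∑ˢ-coefficient k (λ m → O m ⊛ T m) n)) (∑-O⊛T k n n<k)) ⟩
        ι (X.powers (latticeExponents< k) n) * x ^ n ∎

module Assembly {c ℓ} (R : CommutativeRing c ℓ) where

  open CommutativeRing R hiding (zero)
  open Antidiagonal R
  open Theta R using (term⁺; term⁻; term⁺+term⁻)
  open Evaluation R using (tripleSum; tripleSum≈; evaluate-powers)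
  open IntegerCoefficients R
  open Solver
  open import Algebra.Definitions.RawSemiring (Semiring.rawSemiring semiring) using (_^_) renaming (sum to sumᶠ; _×_ to _·_)

  sumᶠ≈∑ : ∀ n f → sumᶠ {n} (f ∘ toℕ) ≈ ∑ n f
  sumᶠ≈∑ zero    f = refl
  sumᶠ≈∑ (suc n) f = trans (+-congˡ (sumᶠ≈∑ n (f ∘ suc))) (sym (∑-suc n f))

  sumᶠ-cong : ∀ n {f g} → (∀ i → f i ≈ g i) → sumᶠ {n} (f ∘ toℕ) ≈ ∑ n g
  sumᶠ-cong n f≈g = trans (sumᶠ≈∑ n _) (∑-cong n f≈g)

  -- The left side is spelled out so that over the complex numbers it is definitionally the partial
  -- sum in `HasTripleSum`.
  cube-sum : ∀ x k →
    sumᶠ {k} ((λ m → sumᶠ {k} ((λ n → sumᶠ {k} ((λ j → Q m j n · ((- 1#) ^ j * x ^ n)) ∘ toℕ)) ∘ toℕ)) ∘ toℕ) ≈ tripleSum x k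
  cube-sum x k = sumᶠ-cong k λ m → sumᶠ-cong k λ n → sumᶠ≈∑ k _

  module _ (x z : Carrier) (z*z≈x : z * z ≈ x) where

    sum⁺ : ∀ k → sumᶠ {k} ((λ n →
      z ^ (3 ℕ.* n ℕ.^ 2) * (1# + x ^ (2 ℕ.* n ℕ.+ 1)) * (1# + z ^ (2 ℕ.* n ℕ.+ 1)) *
      sumᶠ {suc (2 ℕ.* n)} ((λ i → z ^ (∣ i ⊖ n ∣ ℕ.^ 2)) ∘ toℕ)) ∘ toℕ) ≈ ∑ k (term⁺ x z z*z≈x)
    sum⁺ k = sumᶠ-cong k λ n → *-congˡ (sumᶠ≈∑ (suc (2 ℕ.* n)) _)

    sum⁻ : ∀ k → sumᶠ {k} ((λ n →
      (- 1#) ^ n * z ^ (3 ℕ.* n ℕ.^ 2) * (1# + x ^ (2 ℕ.* n ℕ.+ 1)) * (1# - z ^ (2 ℕ.* n ℕ.+ 1)) *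
      sumᶠ {suc (2 ℕ.* n)} ((λ i → (- 1#) ^ ∣ i ⊖ n ∣ * z ^ (∣ i ⊖ n ∣ ℕ.^ 2)) ∘ toℕ)) ∘ toℕ) ≈ ∑ k (term⁻ x z z*z≈x)
    sum⁻ k = sumᶠ-cong k λ n → *-congˡ (sumᶠ≈∑ (suc (2 ℕ.* n)) _)

  module _ (x z : Carrier) (z*z≈x : z * z ≈ x) (h : Carrier) (h+h≈1 : h + h ≈ 1#) where

    open QSeries.Hexagonal R x using (powers; N; ∑-N)
    open import Relation.Binary.Reasoning.Setoid setoid

    -- The difference between the lattice sum and the cube sum. Its monomials all have degree at
    -- least k, so it tends to 0.
    rest : ℕ → Carrier
    rest k = powers (filter (k ℕ.≤?_) (latticeExponents< k))

    tripleSum+rest : ∀ k → tripleSum x k + rest k ≈ ∑ k N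
    tripleSum+rest k = trans (+-congʳ (tripleSum≈ x k))
      (trans (evaluate-powers x k (latticeExponents< k)) (sym (∑-N k)))

    ∑term⁺+∑term⁻ : ∀ k → ∑ k (term⁺ x z z*z≈x) + ∑ k (term⁻ x z z*z≈x) ≈ ∑ k N + ∑ k N
    ∑term⁺+∑term⁻ k = trans (sym (∑-+ k _ _)) (trans (∑-cong k (term⁺+term⁻ x z z*z≈x)) (∑-+ k N N))

    -- The identity is stated in doubled form because the two series add up to twice the sum of `N`,
    -- and h enters only through h + h ≈ 1.
    twice-error : ∀ A B k → ((∑ k (term⁺ x z z*z≈x) - A) + (∑ k (term⁻ x z z*z≈x) - B)) + (- rest k - rest k)
                            ≈ (tripleSum x k - (h * A + h * B)) + (tripleSum x k - (h * A + h * B))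
    twice-error A B k = begin
      ((a - A) + (b - B)) + (- r - r)
        ≈⟨ solve 5 (λ a b A B r → ((a :- A) :+ (b :- B)) :+ (:- r :- r) := (a :+ b) :- (A :+ B) :- (r :+ r)) refl a b A B r ⟩
      (a + b) - (A + B) - (r + r)
        ≈⟨ +-congʳ (+-cong (trans (∑term⁺+∑term⁻ k) (sym (+-cong (tripleSum+rest k) (tripleSum+rest k)))) (-‿cong l+l)) ⟩
      ((s + r) + (s + r)) - (l + l) - (r + r)
        ≈⟨ solve 3 (λ s r l → ((s :+ r) :+ (s :+ r)) :- (l :+ l) :- (r :+ r) := (s :- l) :+ (s :- l)) refl s r l ⟩
      (s - l) + (s - l) ∎
      where
      a = ∑ k (term⁺ x z z*z≈x)
      b = ∑ k (term⁻ x z z*z≈x)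
      r = rest k
      s = tripleSum x k
      l = h * A + h * B
      l+l : A + B ≈ l + l
      l+l = begin
        A + B ≈⟨ *-identityˡ _ ⟨
        1# * (A + B) ≈⟨ *-congʳ h+h≈1 ⟨
        (h + h) * (A + B) ≈⟨ solve 3 (λ h A B → (h :+ h) :* (A :+ B) := (h :* A :+ h :* B) :+ (h :* A :+ h :* B)) refl h A B ⟩
        l + l ∎

-- Passage to the limit

module Limits {c ℓ₁ ℓ₂} (ℝ : RealField c ℓ₁ ℓ₂) where

  open ComplexNumbers ℝ
  private
    module ℝ = Reals ℝ
    module Solveℝ = IntegerCoefficients.Solver ℝ.commutativeRing
  open ℝ using (_<_; 0#; 1#)
  open Theta ℂ-commutativeRing using (term⁺; term⁻; term⁻≈; -z*-z≈x)
  open ThetaPowers ℂ-commutativeRing using (term⁺-powers)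
  open Evaluation ℂ-commutativeRing using (tripleSum)
  open Assembly ℂ-commutativeRing using (rest; twice-error)

  approaches-cong : ∀ {u v l} → (∀ n → u n ≈ v n) → Approaches v l → Approaches u l
  approaches-cong {u} {v} {l} u≈v lim ε 0<ε =
    let N , close = lim ε 0<ε
    in N , λ m N≤m → box-cong {z = v m + - l} {u m + - l} ℝ.refl (+-congʳ {x = - l} {v m} {u m} (sym {u m} {v m} (u≈v m))) (close m N≤m)

  within-halve : ∀ {b x} → Within (b ℝ.+ b) (x ℝ.+ x) → Within b x
  within-halve {b} {x} (lower , upper) =
    ℝ.*-cancelʳ-< ℝ.0<two (ℝ.<-≈ (solve 1 (λ b → :- (b :+ b) := (:- b) :* (con (+ 1) :+ con (+ 1))) ℝ.refl b)
                                 (solve 1 (λ x → x :+ x := x :* (con (+ 1) :+ con (+ 1))) ℝ.refl x) lower) ,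
    ℝ.*-cancelʳ-< ℝ.0<two (ℝ.<-≈ (solve 1 (λ x → x :+ x := x :* (con (+ 1) :+ con (+ 1))) ℝ.refl x)
                                 (solve 1 (λ b → b :+ b := b :* (con (+ 1) :+ con (+ 1))) ℝ.refl b) upper)
    where open Solveℝ

  box-halve : ∀ {b z} → Box (b ℝ.+ b) (z + z) → Box b z
  box-halve (bx , by) = within-halve bx , within-halve by

  ∣∣²-≮0 : ∀ z → ¬ ∣ z ∣² < 0#
  ∣∣²-≮0 (a , b) <0 = ℝ.square-≮0 a (ℝ.+square-< b <0)

  module _ (q q½ : ℂ) (q½*q½≈q : q½ * q½ ≈ q) (0<∣q∣² : 0# < ∣ q ∣²) (∣q∣²<1 : ∣ q ∣² < 1#) where

    private
      ρ = ∣ q½ ∣²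

      ρρ≈ : ∣ q ∣² ℝ.≈ ρ ℝ.* ρ
      ρρ≈ = ℝ.trans (∣∣²-cong {q} {q½ * q½} (sym {q½ * q½} {q} q½*q½≈q)) (∣∣²-* q½ q½)

      0<ρρ : 0# < ρ ℝ.* ρ
      0<ρρ = ℝ.<-respʳ-≈ ρρ≈ 0<∣q∣²

      0<ρ : 0# < ρ
      0<ρ = ℝ.square-cancel-pos (∣∣²-≮0 q½) 0<ρρ

      ρ<1 : ρ < 1#
      ρ<1 = ℝ.square-cancel-< ℝ.0<1 (ℝ.<-≈ ρρ≈ (ℝ.sym (ℝ.*-identityʳ 1#)) ∣q∣²<1)

      module M⁺ = Monomials q½ 0<ρ ρ<1
      module M⁻ = Monomials (- q½) (ℝ.<-respʳ-≈ (ℝ.sym (∣∣²-neg q½)) 0<ρ) (ℝ.<-respˡ-≈ (ℝ.sym (∣∣²-neg q½)) ρ<1)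
      module M = Monomials q 0<∣q∣² ∣q∣²<1

      -q½*-q½≈q = -z*-z≈x q q½ q½*q½≈q

      a b : ℕ → ℂ
      a = term⁺ q q½ q½*q½≈q
      b = term⁻ q q½ q½*q½≈q

      short : ∀ n → length (termExponents n) ℕ.< 8 ℕ.* (suc n ℕ.* suc n)
      short n = ≡.subst (ℕ._≤ 8 ℕ.* (suc n ℕ.* suc n)) (≡.cong suc (≡.sym (length-termExponents n)))
        (≡.subst (suc (4 ℕ.* suc (2 ℕ.* n)) ℕ.≤_) (≡.sym (difference n)) (ℕ.m≤m+n _ _))
        where
        difference : ∀ n → 8 ℕ.* (suc n ℕ.* suc n) ≡ suc (4 ℕ.* suc (2 ℕ.* n)) ℕ.+ (8 ℕ.* (n ℕ.* n) ℕ.+ 8 ℕ.* n ℕ.+ 3)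
        difference = solve-∀

      a-bound : ∀ n → Box (M⁺.C ℝ.* M⁺.t ℝ.^ n) (a n)
      a-bound n = box-cong {z = M⁺.powers es} {a n} ℝ.refl
        (sym {a n} {M⁺.powers es} (term⁺-powers q q½ q½*q½≈q n))
        (M⁺.powers-box n es (termExponents-≥ n) (short n))
        where es = termExponents n

      b-bound : ∀ n → Box (M⁻.C ℝ.* M⁻.t ℝ.^ n) (b n)
      b-bound n = box-cong {z = M⁻.powers es} {b n} ℝ.refl
        (sym {b n} {M⁻.powers es} (trans {b n} {term⁺ q (- q½) -q½*-q½≈q n} {M⁻.powers es}
          (term⁻≈ q q½ q½*q½≈q n) (term⁺-powers q (- q½) -q½*-q½≈q n)))
        (M⁻.powers-box n es (termExponents-≥ n) (short n))
        where es = termExponents n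

    limit⁺ : ∃[ l ] Approaches (λ n → ∑ n a) l
    limit⁺ = Series.convergent M⁺.0<t M⁺.t<1 M⁺.C M⁺.0<C a a-bound

    limit⁻ : ∃[ l ] Approaches (λ n → ∑ n b) l
    limit⁻ = Series.convergent M⁻.0<t M⁻.t<1 M⁻.C M⁻.0<C b b-bound

    private
      A = proj₁ limit⁺
      B = proj₁ limit⁻

      r : ℕ → ℂ
      r = rest q q½ q½*q½≈q ½ ½+½

      r-bound : ∀ k → Box (M.C ℝ.* M.t ℝ.^ k) (r k)
      r-bound k = M.powers-box k (filter (k ℕ.≤?_) (latticeExponents< k)) (All.all-filter (k ℕ.≤?_) (latticeExponents< k))
        (ℕ.≤-<-trans (length-filter (k ℕ.≤?_) (latticeExponents< k))
          (≡.subst (ℕ._< 8 ℕ.* (suc k ℕ.* suc k)) (≡.sym (length-latticeExponents< k))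
            (≡.subst (suc (2 ℕ.* (k ℕ.* k)) ℕ.≤_) (≡.sym (difference k)) (ℕ.m≤m+n _ _))))
        where
        difference : ∀ k → 8 ℕ.* (suc k ℕ.* suc k) ≡ suc (2 ℕ.* (k ℕ.* k)) ℕ.+ (6 ℕ.* (k ℕ.* k) ℕ.+ 16 ℕ.* k ℕ.+ 7)
        difference = solve-∀

    -- By `twice-error` twice the error is a sum of four quantities, each eventually in a box of
    -- size ε/2. Their sum lies in a box of size 2ε, which is then halved.
    tripleSum-limit : Approaches (tripleSum q) (½ * A + ½ * B)
    tripleSum-limit ε 0<ε = N₁ ℕ.⊔ N₂ ℕ.⊔ N₃ , λ m N≤m →
      let N₁⊔N₂≤m = ℕ.≤-trans (ℕ.m≤m⊔n (N₁ ℕ.⊔ N₂) N₃) N≤m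
          r-box = box-neg (box-mono (r-small m (ℕ.≤-trans (ℕ.m≤n⊔m (N₁ ℕ.⊔ N₂) N₃) N≤m)) (r-bound m))
      in box-halve (box-cong {z = twice m} {error m + error m} four-quarters (twice-error q q½ q½*q½≈q ½ ½+½ A B m)
           (box-+ (box-+ (a-close m (ℕ.≤-trans (ℕ.m≤m⊔n N₁ N₂) N₁⊔N₂≤m)) (b-close m (ℕ.≤-trans (ℕ.m≤n⊔m N₁ N₂) N₁⊔N₂≤m)))
                  (box-+ r-box r-box)))
      where
      l = ½ * A + ½ * B
      error twice : ℕ → ℂ
      error m = tripleSum q m + - l
      twice m = ((∑ m a + - A) + (∑ m b + - B)) + (- r m + - r m)
      δ = ε ℝ.* ℝ.half
      0<δ = ℝ.*-pos 0<ε ℝ.0<half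
      N₁ = proj₁ (proj₂ limit⁺ δ 0<δ)
      a-close = proj₂ (proj₂ limit⁺ δ 0<δ)
      N₂ = proj₁ (proj₂ limit⁻ δ 0<δ)
      b-close = proj₂ (proj₂ limit⁻ δ 0<δ)
      N₃ = proj₁ (ℝ.Powers.vanishing M.0<t M.t<1 M.0<C 0<δ)
      r-small = proj₂ (ℝ.Powers.vanishing M.0<t M.t<1 M.0<C 0<δ)
      four-quarters : (δ ℝ.+ δ) ℝ.+ (δ ℝ.+ δ) ℝ.≈ ε ℝ.+ ε
      four-quarters = ℝ.+-cong two-halves two-halves
        where
        two-halves : δ ℝ.+ δ ℝ.≈ ε
        two-halves = ℝ.trans (ℝ.sym (ℝ.distribˡ ε ℝ.half ℝ.half)) (ℝ.trans (ℝ.*-congˡ ℝ.half+half) (ℝ.*-identityʳ ε))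

theorem1p2 : ∀ {c ℓ₁ ℓ₂ : Level} (ℝ : RealField c ℓ₁ ℓ₂) → let open Complex ℝ in
    ∀ (q q½ : ℂ) → q½ * q½ ≈ q → 0ℝ < ∣ q ∣² → ∣ q ∣² < 1ℝ →
    ∃[ L ] ∃[ A ] ∃[ B ]
    HasTripleSum (λ m n j → Q m j n · ((- 1ℂ) ^ j * q ^ n)) L ×
    HasSum (λ n →
    q½ ^ (3 ℕ.* n ℕ.^ 2) * (1ℂ + q ^ (2 ℕ.* n ℕ.+ 1)) * (1ℂ + q½ ^ (2 ℕ.* n ℕ.+ 1)) *
    (∑± n λ j → q½ ^ (∣ j ∣ ℕ.^ 2))) A ×
    HasSum (λ n →
    (- 1ℂ) ^ n * q½ ^ (3 ℕ.* n ℕ.^ 2) *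
    (1ℂ + q ^ (2 ℕ.* n ℕ.+ 1)) * (1ℂ - q½ ^ (2 ℕ.* n ℕ.+ 1)) *
    (∑± n λ j → (- 1ℂ) ^ ∣ j ∣ * q½ ^ (∣ j ∣ ℕ.^ 2))) B ×
    L ≈ ½ * A + ½ * B
theorem1p2 ℝ q q½ q½*q½≈q 0<∣q∣² ∣q∣²<1 =
  L , A , B ,
  approaches⇒⟶ {cubes} {L} (approaches-cong {cubes} {tripleSum q} {L} (cube-sum q) (tripleSum-limit q q½ q½*q½≈q 0<∣q∣² ∣q∣²<1)) ,
  approaches⇒⟶ {sums⁺} {A} (approaches-cong {sums⁺} {λ k → ∑ k (term⁺ q q½ q½*q½≈q)} {A} (sum⁺ q q½ q½*q½≈q) (proj₂ A-limit)) ,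
  approaches⇒⟶ {sums⁻} {B} (approaches-cong {sums⁻} {λ k → ∑ k (term⁻ q q½ q½*q½≈q)} {B} (sum⁻ q q½ q½*q½≈q) (proj₂ B-limit)) ,
  refl {L}
  where
  open ComplexNumbers ℝ using (approaches⇒⟶; refl; ℂ-commutativeRing; ∑)
  open Limits ℝ using (approaches-cong; limit⁺; limit⁻; tripleSum-limit)
  open Theta ℂ-commutativeRing using (term⁺; term⁻)
  open Evaluation ℂ-commutativeRing using (tripleSum)
  open Assembly ℂ-commutativeRing using (cube-sum; sum⁺; sum⁻)
  open Complex ℝ
  A-limit = limit⁺ q q½ q½*q½≈q 0<∣q∣² ∣q∣²<1
  B-limit = limit⁻ q q½ q½*q½≈q 0<∣q∣² ∣q∣²<1
  L A B : ℂ
  A = proj₁ A-limit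
  B = proj₁ B-limit
  L = ½ * A + ½ * B
  cubes sums⁺ sums⁻ : ℕ → ℂ
  cubes k = ∑< k λ m → ∑< k λ n → ∑< k λ j → Q m j n · ((- 1ℂ) ^ j * q ^ n)
  sums⁺ k = ∑< k λ n →
    q½ ^ (3 ℕ.* n ℕ.^ 2) * (1ℂ + q ^ (2 ℕ.* n ℕ.+ 1)) * (1ℂ + q½ ^ (2 ℕ.* n ℕ.+ 1)) *
    (∑± n λ j → q½ ^ (∣ j ∣ ℕ.^ 2))
  sums⁻ k = ∑< k λ n →
    (- 1ℂ) ^ n * q½ ^ (3 ℕ.* n ℕ.^ 2) * (1ℂ + q ^ (2 ℕ.* n ℕ.+ 1)) * (1ℂ - q½ ^ (2 ℕ.* n ℕ.+ 1)) *
    (∑± n λ j → (- 1ℂ) ^ ∣ j ∣ * q½ ^ (∣ j ∣ ℕ.^ 2))
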